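{- For all sufficiently large primes $p$, $$f(p)\ge \log_2 p + \left(\frac{1}{2\log 2}+o(1)\right)\log\log p,$$ where $o(1)$ denotes a quantity tending to $0$ as $p\to\infty$ through primes.
   Context: Here $\log$ is the natural logarithm and $\log_2 x=\log x/\log 2$. For a prime $p$, $\mathbb{F}_p$ is viewed as the additive cyclic group of order $p$ (the only abelian group of order $p$ up to isomorphism). For $A\subseteq\mathbb{F}_p$, $\Sigma(A):=\{\sum_{x\in S}x : S\subseteq A\}$, where the empty sum is $0$. The number $f(p)$ is the least integer $k$ such that a uniformly random $k$-element subset $A\subseteq\mathbb{F}_p$ satisfies $\mathbb{P}(\Sigma(A)=\mathbb{F}_p)\ge \tfrac12$. -}

module Defs where

open import Data.Nat.Base as ℕ using (ℕ; zero; suc; NonZero; NonTrivial; z≤n; s≤s)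
import Data.Nat.Properties as ℕ
open import Data.Nat.DivMod using (_mod_; m<n⇒m%n≡m)
open import Data.Fin.Base as Fin using (Fin; toℕ)
import Data.Fin.Properties as Fin
open import Data.Fin.Subset using (Subset; inside; outside; _⊆_; ⊤; ⁅_⁆) renaming (_∈_ to _∈ₛ_; ∣_∣ to card)
open import Data.Fin.Subset.Properties using (anySubset?; _∈?_; _⊆?_; ⊆⊤; x∈⁅x⁆; x∈⁅y⁆⇒x≡y; ∣⊤∣≡n; ∣p∣≡n⇒p≡⊤)
open import Data.List.Base as List using (List; []; _∷_; _++_; allFin; filter; foldr; length)
open import Data.List.Properties using (filter-all; filter-none)
open import Data.List.Membership.Propositional using (_∈_)
open import Data.List.Membership.Propositional.Properties using (∈-map⁺; ∈-++⁺ˡ; ∈-++⁺ʳ; ∈-filter⁺; ∈-filter⁻; ∈-allFin)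
open import Data.List.Relation.Unary.All as All using (All; []; _∷_)
import Data.List.Relation.Unary.All.Properties as All
open import Data.List.Relation.Unary.Any using (here; there)
open import Data.List.Relation.Unary.Unique.Propositional using (Unique; []; _∷_)
open import Data.List.Relation.Unary.Unique.Propositional.Properties using (allFin⁺)
open import Data.Vec.Base as Vec using ([]; _∷_)
open import Data.Nat.Primality using (Prime; prime⇒nonZero; prime⇒nonTrivial)
open import Data.Integer.Base as ℤ using (+_)
import Data.Integer.Properties as ℤ
open import Data.Rational.Base as ℚ
  using (ℚ; mkℚ; 0ℚ; 1ℚ; ½; _+_; _*_; _-_; -_; _≤_; _<_; ∣_∣; 1/_; _/_; Positive;
         NonNegative; positive; nonNegative; >-nonZero; *≤*; *<*; toℚᵘ)
open import Data.Rational.Properties as ℚ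
open import Data.Rational.Solver using (module +-*-Solver)
import Data.Rational.Unnormalised.Base as ℚᵘ
import Data.Rational.Unnormalised.Properties as ℚᵘ
open import Data.Product.Base using (Σ; Σ-syntax; ∃; ∃-syntax; _×_; _,_; proj₁; proj₂)
open import Data.Sum.Base using (_⊎_; inj₁; inj₂)
open import Function.Base using (_∘_)
open import Relation.Binary.PropositionalEquality
  using (_≡_; refl; sym; trans; cong; cong₂; subst; subst₂)
open import Relation.Nullary using (¬_; Dec; yes; no; contradiction)
open import Relation.Nullary.Decidable using (_×-dec_; map′)
open import Relation.Unary using (Decidable)

open +-*-Solver using (solve; _:+_; _:*_; _:-_; :-_; _:=_; con)

fromℕ : ℕ → ℚ
fromℕ n = + n / 1

recip : (a : ℚ) → .(0ℚ < a) → ℚ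
recip a 0<a = (1/ a) {{>-nonZero 0<a}}

module RationalLemmas where

  toℚᵘ-fromℕ : ∀ n → toℚᵘ (fromℕ n) ℚᵘ.≃ ℚᵘ.mkℚᵘ (+ n) 0
  toℚᵘ-fromℕ n = toℚᵘ-fromℚᵘ (ℚᵘ.mkℚᵘ (+ n) 0)

  fromℕ-suc : ∀ n → fromℕ (suc n) ≡ 1ℚ + fromℕ n
  fromℕ-suc n = toℚᵘ-injective (ℚᵘ.≃-trans (toℚᵘ-fromℕ (suc n)) (ℚᵘ.≃-sym
    (ℚᵘ.≃-trans (toℚᵘ-homo-+ 1ℚ (fromℕ n))
      (ℚᵘ.≃-trans (ℚᵘ.+-congʳ (toℚᵘ 1ℚ) (toℚᵘ-fromℕ n))
        (ℚᵘ.*≡* (cong (ℤ._* + 1) (cong (λ i → + 1 ℤ.+ i) (ℤ.*-identityʳ (+ n)))))))))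

  fromℕ-mono : ∀ {m n} → m ℕ.≤ n → fromℕ m ≤ fromℕ n
  fromℕ-mono {m} {n} m≤n = toℚᵘ-cancel-≤
    (ℚᵘ.≤-respʳ-≃ (ℚᵘ.≃-sym (toℚᵘ-fromℕ n)) (ℚᵘ.≤-respˡ-≃ (ℚᵘ.≃-sym (toℚᵘ-fromℕ m))
      (ℚᵘ.*≤* (ℤ.*-monoʳ-≤-nonNeg (+ 1) (ℤ.+≤+ m≤n)))))

  archimedean : ∀ q → ∃[ n ] q ≤ fromℕ n
  archimedean q@(mkℚ n d _) = ℤ.∣ n ∣ , toℚᵘ-cancel-≤
    (ℚᵘ.≤-respʳ-≃ (ℚᵘ.≃-sym (toℚᵘ-fromℕ ℤ.∣ n ∣)) (ℚᵘ.*≤* (le n)))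
    where
    le : ∀ i → i ℤ.* + 1 ℤ.≤ + ℤ.∣ i ∣ ℤ.* + suc d
    le (+ k) = subst₂ ℤ._≤_ (ℤ.pos-* k 1) (ℤ.pos-* k (suc d))
                 (ℤ.+≤+ (ℕ.*-monoʳ-≤ k (s≤s (z≤n {d}))))
    le ℤ.-[1+ k ] = ℤ.-≤+

  0<½ : 0ℚ < ½
  0<½ = positive⁻¹ ½

  0<1 : 0ℚ < 1ℚ
  0<1 = positive⁻¹ 1ℚ

  +-pos : ∀ {p q} → 0ℚ < p → 0ℚ < q → 0ℚ < p + q
  +-pos = +-mono-<

  *-pos : ∀ {p q} → 0ℚ < p → 0ℚ < q → 0ℚ < p * q
  *-pos {p} {q} 0<p 0<q =
    positive⁻¹ _ {{pos*pos⇒pos p {{positive 0<p}} q {{positive 0<q}}}}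

  *-nonNeg : ∀ {p q} → 0ℚ ≤ p → 0ℚ ≤ q → 0ℚ ≤ p * q
  *-nonNeg {p} {q} 0≤p 0≤q =
    nonNegative⁻¹ _ {{nonNeg*nonNeg⇒nonNeg p {{nonNegative 0≤p}} q {{nonNegative 0≤q}}}}

  *-monoˡ : ∀ r {p q} → 0ℚ ≤ r → p ≤ q → r * p ≤ r * q
  *-monoˡ r 0≤r = *-monoˡ-≤-nonNeg r {{nonNegative 0≤r}}

  *-monoʳ : ∀ r {p q} → 0ℚ ≤ r → p ≤ q → p * r ≤ q * r
  *-monoʳ r 0≤r = *-monoʳ-≤-nonNeg r {{nonNegative 0≤r}}

  *-mono : ∀ {p q r s} → 0ℚ ≤ p → 0ℚ ≤ s → p ≤ q → r ≤ s → p * r ≤ q * s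
  *-mono {p} {q} {r} {s} 0≤p 0≤s p≤q r≤s =
    ≤-trans (*-monoˡ p 0≤p r≤s) (*-monoʳ s 0≤s p≤q)

  recip-inv : ∀ a .(0<a : 0ℚ < a) → a * recip a 0<a ≡ 1ℚ
  recip-inv a 0<a = *-inverseʳ a {{>-nonZero 0<a}}

  recip-pos : ∀ a (0<a : 0ℚ < a) → 0ℚ < recip a 0<a
  recip-pos a 0<a = positive⁻¹ _ {{1/pos⇒pos a {{positive 0<a}}}}

  inv-diff : ∀ a b r s → a * r ≡ 1ℚ → b * s ≡ 1ℚ → r - s ≡ (b - a) * (r * s)
  inv-diff a b r s ar bs = sym (trans
    (solve 4 (λ a b r s → (b :- a) :* (r :* s) := (b :* s) :* r :- (a :* r) :* s) refl a b r s)
    (cong₂ _-_ (trans (cong (_* r) bs) (*-identityˡ r)) (trans (cong (_* s) ar) (*-identityˡ s))))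

  p-q≥0 : ∀ {p q} → q ≤ p → 0ℚ ≤ p - q
  p-q≥0 {p} {q} q≤p = subst (_≤ p - q) (+-inverseʳ q) (+-monoˡ-≤ (- q) q≤p)

  p-q≥0⁻¹ : ∀ {p q} → 0ℚ ≤ p - q → q ≤ p
  p-q≥0⁻¹ {p} {q} le = subst₂ _≤_ (+-identityˡ q)
    (solve 2 (λ p q → (p :- q) :+ q := p) refl p q) (+-monoˡ-≤ q le)

  recip-anti : ∀ a b (0<a : 0ℚ < a) (0<b : 0ℚ < b) → a ≤ b → recip b 0<b ≤ recip a 0<a
  recip-anti a b 0<a 0<b a≤b = p-q≥0⁻¹ (subst (0ℚ ≤_)
    (sym (inv-diff a b _ _ (recip-inv a 0<a) (recip-inv b 0<b)))
    (*-nonNeg (p-q≥0 a≤b)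
      (*-nonNeg (<⇒≤ (recip-pos a 0<a)) (<⇒≤ (recip-pos b 0<b)))))

  recip-diff-bound : ∀ c a b (0<c : 0ℚ < c) (0<a : 0ℚ < a) (0<b : 0ℚ < b) → c ≤ a → c ≤ b →
    ∣ recip a 0<a - recip b 0<b ∣ ≤ (recip c 0<c * recip c 0<c) * ∣ a - b ∣
  recip-diff-bound c a b 0<c 0<a 0<b c≤a c≤b = begin
    ∣ r - s ∣             ≡⟨ cong ∣_∣ (inv-diff a b r s (recip-inv a 0<a) (recip-inv b 0<b)) ⟩
    ∣ (b - a) * (r * s) ∣ ≡⟨ ∣p*q∣≡∣p∣*∣q∣ (b - a) (r * s) ⟩
    ∣ b - a ∣ * ∣ r * s ∣ ≡⟨ cong₂ _*_ (trans (cong ∣_∣ (solve 2 (λ a b → b :- a := :- (a :- b)) refl a b)) (∣-p∣≡∣p∣ (a - b)))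
                                       (0≤p⇒∣p∣≡p (*-nonNeg 0≤r 0≤s)) ⟩
    ∣ a - b ∣ * (r * s)   ≤⟨ *-monoˡ _ (0≤∣p∣ (a - b))
                               (*-mono 0≤r (<⇒≤ (recip-pos c 0<c)) (recip-anti c a 0<c 0<a c≤a) (recip-anti c b 0<c 0<b c≤b)) ⟩
    ∣ a - b ∣ * (t * t)   ≡⟨ *-comm ∣ a - b ∣ (t * t) ⟩
    (t * t) * ∣ a - b ∣   ∎
    where
    open ≤-Reasoning
    r = recip a 0<a
    s = recip b 0<b
    t = recip c 0<c
    0≤r = <⇒≤ (recip-pos a 0<a)
    0≤s = <⇒≤ (recip-pos b 0<b)

  ∣-∣-sym : ∀ p q → ∣ p - q ∣ ≡ ∣ q - p ∣
  ∣-∣-sym p q = trans (cong ∣_∣ (solve 2 (λ p q → p :- q := :- (q :- p)) refl p q)) (∣-p∣≡∣p∣ (q - p))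

  ∣-∣-tri : ∀ p q r → ∣ p - r ∣ ≤ ∣ p - q ∣ + ∣ q - r ∣
  ∣-∣-tri p q r = subst (λ z → ∣ z ∣ ≤ ∣ p - q ∣ + ∣ q - r ∣)
    (solve 3 (λ p q r → (p :- q) :+ (q :- r) := p :- r) refl p q r)
    (∣p+q∣≤∣p∣+∣q∣ (p - q) (q - r))

  ∣a∣≤∣a-b∣+∣b∣ : ∀ a b → ∣ a ∣ ≤ ∣ a - b ∣ + ∣ b ∣
  ∣a∣≤∣a-b∣+∣b∣ a b = subst (λ z → ∣ z ∣ ≤ ∣ a - b ∣ + ∣ b ∣)
    (solve 2 (λ a b → (a :- b) :+ b := a) refl a b) (∣p+q∣≤∣p∣+∣q∣ (a - b) b)

  ∣+-+∣ : ∀ a b c d → ∣ (a + b) - (c + d) ∣ ≤ ∣ a - c ∣ + ∣ b - d ∣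
  ∣+-+∣ a b c d = subst (λ z → ∣ z ∣ ≤ ∣ a - c ∣ + ∣ b - d ∣)
    (solve 4 (λ a b c d → (a :- c) :+ (b :- d) := (a :+ b) :- (c :+ d)) refl a b c d)
    (∣p+q∣≤∣p∣+∣q∣ (a - c) (b - d))

  half-half : ∀ ε → ½ * ε + ½ * ε ≡ ε
  half-half = solve 1 (λ ε → con ½ :* ε :+ con ½ :* ε := ε) refl

  half-pos : ∀ {ε} → 0ℚ < ε → 0ℚ < ½ * ε
  half-pos = *-pos 0<½

  shrink : ∀ {B ε} → 0ℚ < B → 0ℚ < ε → ∃[ δ ] 0ℚ < δ × B * δ ≡ ε
  shrink {B} {ε} 0<B 0<ε = recip B 0<B * ε , *-pos (recip-pos B 0<B) 0<ε ,
    trans (sym (*-assoc B _ ε)) (trans (cong (_* ε) (recip-inv B 0<B)) (*-identityˡ ε))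

open RationalLemmas

-- Real numbers are Cauchy sequences of rationals.  Two sequences with the same
-- limit are the same real number although they are not propositionally equal;
-- x ≤ℝ y says lim x ≤ lim y, and x <ℝ y says lim x < lim y.

Cauchy : (ℕ → ℚ) → Set
Cauchy s = ∀ {ε} → 0ℚ < ε → ∃[ N ] (∀ m n → N ℕ.≤ m → N ℕ.≤ n → ∣ s m - s n ∣ ≤ ε)

record ℝ : Set where
  constructor mkℝ
  field
    seq    : ℕ → ℚ
    cauchy : Cauchy seq

open ℝ public

infix 4 _≤ℝ_ _<ℝ_ _≥ℝ_
infixl 6 _+ℝ_
infixl 7 _*ℝ_ _/ℝ_[_]

_≤ℝ_ : ℝ → ℝ → Set
x ≤ℝ y = ∀ {ε} → 0ℚ < ε → ∃[ N ] (∀ n → N ℕ.≤ n → seq x n ≤ seq y n + ε)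

_≥ℝ_ : ℝ → ℝ → Set
x ≥ℝ y = y ≤ℝ x

_<ℝ_ : ℝ → ℝ → Set
x <ℝ y = ∃[ δ ] 0ℚ < δ × ∃[ N ] (∀ n → N ℕ.≤ n → seq x n + δ ≤ seq y n)

fromℚ : ℚ → ℝ
fromℚ q = mkℝ (λ _ → q) λ {ε} 0<ε → 0 , λ _ _ _ _ →
  subst (λ z → ∣ z ∣ ≤ ε) (sym (+-inverseʳ q)) (<⇒≤ 0<ε)

0ℝ 1ℝ 2ℝ : ℝ
0ℝ = fromℚ 0ℚ
1ℝ = fromℚ 1ℚ
2ℝ = fromℚ (fromℕ 2)

module CauchyLemmas where

  lipschitz : ∀ {A B} (z : ℕ → ℚ) (x y : ℝ) → 0ℚ < A → 0ℚ < B → ∀ N₀ →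
    (∀ m n → N₀ ℕ.≤ m → N₀ ℕ.≤ n →
      ∣ z m - z n ∣ ≤ A * ∣ seq x m - seq x n ∣ + B * ∣ seq y m - seq y n ∣) →
    Cauchy z
  lipschitz {A} {B} z x y 0<A 0<B N₀ h {ε} 0<ε
    with shrink 0<A (half-pos 0<ε) | shrink 0<B (half-pos 0<ε)
  ... | δ₁ , 0<δ₁ , e₁ | δ₂ , 0<δ₂ , e₂
    with cauchy x 0<δ₁ | cauchy y 0<δ₂
  ... | N₁ , h₁ | N₂ , h₂ = N₀ ℕ.⊔ (N₁ ℕ.⊔ N₂) , λ m n N≤m N≤n → begin
    ∣ z m - z n ∣ ≤⟨ h m n (ℕ.m⊔n≤o⇒m≤o _ _ N≤m) (ℕ.m⊔n≤o⇒m≤o _ _ N≤n) ⟩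
    A * ∣ seq x m - seq x n ∣ + B * ∣ seq y m - seq y n ∣
      ≤⟨ +-mono-≤
           (*-monoˡ A (<⇒≤ 0<A) (h₁ m n (ℕ.m⊔n≤o⇒m≤o N₁ N₂ (ℕ.m⊔n≤o⇒n≤o N₀ _ N≤m)) (ℕ.m⊔n≤o⇒m≤o N₁ N₂ (ℕ.m⊔n≤o⇒n≤o N₀ _ N≤n))))
           (*-monoˡ B (<⇒≤ 0<B) (h₂ m n (ℕ.m⊔n≤o⇒n≤o N₁ N₂ (ℕ.m⊔n≤o⇒n≤o N₀ _ N≤m)) (ℕ.m⊔n≤o⇒n≤o N₁ N₂ (ℕ.m⊔n≤o⇒n≤o N₀ _ N≤n)))) ⟩
    A * δ₁ + B * δ₂ ≡⟨ cong₂ _+_ e₁ e₂ ⟩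
    ½ * ε + ½ * ε   ≡⟨ half-half ε ⟩
    ε ∎
    where open ≤-Reasoning

  bounded : ∀ (x : ℝ) → ∃[ B ] 0ℚ < B × ∃[ N ] (∀ n → N ℕ.≤ n → ∣ seq x n ∣ ≤ B)
  bounded x with cauchy x 0<1
  ... | N , h = 1ℚ + ∣ seq x N ∣ , +-mono-<-≤ 0<1 (0≤∣p∣ (seq x N)) , N , λ n N≤n →
    ≤-trans (∣a∣≤∣a-b∣+∣b∣ (seq x n) (seq x N)) (+-monoˡ-≤ ∣ seq x N ∣ (h n N N≤n ℕ.≤-refl))

open CauchyLemmas

_+ℝ_ : ℝ → ℝ → ℝ
x +ℝ y = mkℝ (λ n → seq x n + seq y n)
  (lipschitz {1ℚ} {1ℚ} (λ n → seq x n + seq y n) x y 0<1 0<1 0 λ m n _ _ →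
    subst₂ (λ u v → ∣ (seq x m + seq y m) - (seq x n + seq y n) ∣ ≤ u + v)
      (sym (*-identityˡ ∣ seq x m - seq x n ∣)) (sym (*-identityˡ ∣ seq y m - seq y n ∣))
      (∣+-+∣ (seq x m) (seq y m) (seq x n) (seq y n)))

_*ℝ_ : ℝ → ℝ → ℝ
x *ℝ y = mkℝ (λ n → seq x n * seq y n) cau
  where
  cau : Cauchy (λ n → seq x n * seq y n)
  cau =
    let A , 0<A , N₁ , hA = bounded x
        B , 0<B , N₂ , hB = bounded y
    in
    lipschitz (λ n → seq x n * seq y n) x y 0<B 0<A (N₁ ℕ.⊔ N₂) λ m n N≤m N≤n → bound A B (seq x m) (seq y m) (seq x n) (seq y n)
      (hA m (ℕ.m⊔n≤o⇒m≤o _ _ N≤m)) (hB n (ℕ.m⊔n≤o⇒n≤o N₁ N₂ N≤n))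
    where
    open ≤-Reasoning
    bound : ∀ A B a b c d → ∣ a ∣ ≤ A → ∣ d ∣ ≤ B → ∣ a * b - c * d ∣ ≤ B * ∣ a - c ∣ + A * ∣ b - d ∣
    bound A B a b c d a≤A d≤B = begin
      ∣ a * b - c * d ∣
        ≡⟨ cong ∣_∣ (solve 4 (λ a b c d → a :* b :- c :* d := d :* (a :- c) :+ a :* (b :- d)) refl a b c d) ⟩
      ∣ d * (a - c) + a * (b - d) ∣
        ≤⟨ ∣p+q∣≤∣p∣+∣q∣ (d * (a - c)) (a * (b - d)) ⟩
      ∣ d * (a - c) ∣ + ∣ a * (b - d) ∣
        ≡⟨ cong₂ _+_ (∣p*q∣≡∣p∣*∣q∣ d (a - c)) (∣p*q∣≡∣p∣*∣q∣ a (b - d)) ⟩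
      ∣ d ∣ * ∣ a - c ∣ + ∣ a ∣ * ∣ b - d ∣
        ≤⟨ +-mono-≤ (*-monoʳ _ (0≤∣p∣ (a - c)) d≤B) (*-monoʳ _ (0≤∣p∣ (b - d)) a≤A) ⟩
      B * ∣ a - c ∣ + A * ∣ b - d ∣ ∎

-- A positive real, with an initial segment of its sequence dropped, is a
-- sequence of rationals bounded below by a positive rational.

module Tail (x : ℝ) (0<x : 0ℝ <ℝ x) where

  δ : ℚ
  δ = proj₁ 0<x

  0<δ : 0ℚ < δ
  0<δ = proj₁ (proj₂ 0<x)

  N : ℕ
  N = proj₁ (proj₂ (proj₂ 0<x))

  tail : ℕ → ℚ
  tail n = seq x (N ℕ.+ n)

  δ≤tail : ∀ n → δ ≤ tail n
  δ≤tail n = subst (_≤ tail n) (+-identityˡ δ) (proj₂ (proj₂ (proj₂ 0<x)) (N ℕ.+ n) (ℕ.m≤m+n N n))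

  0<tail : ∀ n → 0ℚ < tail n
  0<tail n = <-≤-trans 0<δ (δ≤tail n)

  tail-cauchy : Cauchy tail
  tail-cauchy 0<ε with cauchy x 0<ε
  ... | M , h = M , λ m n M≤m M≤n → h _ _ (ℕ.≤-trans M≤m (ℕ.m≤n+m m N)) (ℕ.≤-trans M≤n (ℕ.m≤n+m n N))

  tailℝ : ℝ
  tailℝ = mkℝ tail tail-cauchy

_/ℝ_[_] : (x y : ℝ) → 0ℝ <ℝ y → ℝ
x /ℝ y [ 0<y ] = x *ℝ mkℝ (λ n → recip (tail n) (0<tail n)) cau
  where
  open Tail y 0<y
  K = recip δ 0<δ * recip δ 0<δ
  0<K = *-pos (recip-pos δ 0<δ) (recip-pos δ 0<δ)
  cau : Cauchy (λ n → recip (tail n) (0<tail n))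
  cau = lipschitz (λ n → recip (tail n) (0<tail n)) tailℝ tailℝ 0<K 0<K 0 λ m n _ _ →
    ≤-trans (recip-diff-bound δ (tail m) (tail n) 0<δ (0<tail m) (0<tail n) (δ≤tail m) (δ≤tail n))
      (p≤p+q _ {{nonNegative (*-nonNeg (<⇒≤ 0<K) (0≤∣p∣ (tail m - tail n)))}})
    where
    p≤p+q : ∀ p {q} {{_ : NonNegative q}} → p ≤ p + q
    p≤p+q p {q} = subst (_≤ p + q) (+-identityʳ p) (+-monoʳ-≤ p (nonNegative⁻¹ q))

mid : ℚ → ℚ → ℚ
mid a b = ½ * (a + b)

0<mid : ∀ {a b} → 0ℚ < a → 0ℚ < b → 0ℚ < mid a b
0<mid 0<a 0<b = *-pos 0<½ (+-pos 0<a 0<b)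

-- The left Riemann sum of the integral of dt / t from a to b, for 2ⁿ intervals
-- of equal length.
riemann : ℕ → (a b : ℚ) → .(0ℚ < a) → .(0ℚ < b) → ℚ
riemann zero    a b 0<a 0<b = (b - a) * recip a 0<a
riemann (suc n) a b 0<a 0<b = riemann n a (mid a b) 0<a (0<mid 0<a 0<b)
                            + riemann n (mid a b) b (0<mid 0<a 0<b) 0<b

½^ : ℕ → ℚ
½^ zero    = 1ℚ
½^ (suc n) = ½ * ½^ n

module RiemannLemmas where

  mid-a : ∀ a b → mid a b - a ≡ ½ * (b - a)
  mid-a = solve 2 (λ a b → con ½ :* (a :+ b) :- a := con ½ :* (b :- a)) refl

  b-mid : ∀ a b → b - mid a b ≡ ½ * (b - a)
  b-mid = solve 2 (λ a b → b :- con ½ :* (a :+ b) := con ½ :* (b :- a)) refl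

  mid-≥ : ∀ {c a b} → c ≤ a → c ≤ b → c ≤ mid a b
  mid-≥ {c} {a} {b} c≤a c≤b = subst (_≤ mid a b)
    (solve 1 (λ c → con ½ :* (c :+ c) := c) refl c)
    (*-monoˡ ½ (<⇒≤ 0<½) (+-mono-≤ c≤a c≤b))

  0≤sq : ∀ d → 0ℚ ≤ d * d
  0≤sq d with ≤-total 0ℚ d
  ... | inj₁ 0≤d = *-nonNeg 0≤d 0≤d
  ... | inj₂ d≤0 = subst (0ℚ ≤_) (solve 1 (λ d → (:- d) :* (:- d) := d :* d) refl d)
                     (*-nonNeg (neg-antimono-≤ d≤0) (neg-antimono-≤ d≤0))

  ∣d∣∣d∣ : ∀ d → ∣ d ∣ * ∣ d ∣ ≡ d * d
  ∣d∣∣d∣ d = trans (sym (∣p*q∣≡∣p∣*∣q∣ d d)) (0≤p⇒∣p∣≡p (0≤sq d))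

  module _ (c : ℚ) (0<c : 0ℚ < c) where

    K : ℚ
    K = recip c 0<c * recip c 0<c

    0<K : 0ℚ < K
    0<K = *-pos (recip-pos c 0<c) (recip-pos c 0<c)

    halving : ∀ a b (0<a : 0ℚ < a) (0<b : 0ℚ < b) → c ≤ a → c ≤ b →
      ∣ riemann 1 a b 0<a 0<b - riemann 0 a b 0<a 0<b ∣
        ≤ K * ((½ * (b - a)) * (½ * (b - a)))
    halving a b 0<a 0<b c≤a c≤b = begin
      ∣ ((m - a) * r + (b - m) * s) - (b - a) * r ∣
        ≡⟨ cong ∣_∣ (solve 4 (λ a b r s →
              (con ½ :* (a :+ b) :- a) :* r :+ (b :- con ½ :* (a :+ b)) :* s :- (b :- a) :* r
                := (con ½ :* (b :- a)) :* (s :- r)) refl a b r s) ⟩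
      ∣ h * (s - r) ∣       ≡⟨ ∣p*q∣≡∣p∣*∣q∣ h (s - r) ⟩
      ∣ h ∣ * ∣ s - r ∣     ≤⟨ *-monoˡ ∣ h ∣ (0≤∣p∣ h)
                                 (recip-diff-bound c m a 0<c (0<mid 0<a 0<b) 0<a (mid-≥ c≤a c≤b) c≤a) ⟩
      ∣ h ∣ * (K * ∣ m - a ∣) ≡⟨ cong (λ z → ∣ h ∣ * (K * ∣ z ∣)) (mid-a a b) ⟩
      ∣ h ∣ * (K * ∣ h ∣)   ≡⟨ solve 2 (λ k h → h :* (k :* h) := k :* (h :* h)) refl K ∣ h ∣ ⟩
      K * (∣ h ∣ * ∣ h ∣)   ≡⟨ cong (K *_) (∣d∣∣d∣ h) ⟩
      K * (h * h)           ∎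
      where
      open ≤-Reasoning
      m = mid a b
      h = ½ * (b - a)
      r = recip a 0<a
      s = recip m (0<mid 0<a 0<b)

    refine₀ : ∀ m a b (0<a : 0ℚ < a) (0<b : 0ℚ < b) → c ≤ a → c ≤ b →
      ∣ riemann m a b 0<a 0<b - riemann 0 a b 0<a 0<b ∣ ≤ K * ((b - a) * (b - a))
    refine₀ zero a b 0<a 0<b c≤a c≤b =
      subst (λ z → ∣ z ∣ ≤ K * ((b - a) * (b - a))) (sym (+-inverseʳ (riemann 0 a b 0<a 0<b)))
        (*-nonNeg (<⇒≤ 0<K) (0≤sq (b - a)))
    refine₀ (suc m) a b 0<a 0<b c≤a c≤b = begin
      ∣ riemann (suc m) a b 0<a 0<b - riemann 0 a b 0<a 0<b ∣
        ≤⟨ ∣-∣-tri (riemann (suc m) a b 0<a 0<b) (riemann 1 a b 0<a 0<b) (riemann 0 a b 0<a 0<b) ⟩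
      ∣ riemann (suc m) a b 0<a 0<b - riemann 1 a b 0<a 0<b ∣
        + ∣ riemann 1 a b 0<a 0<b - riemann 0 a b 0<a 0<b ∣
        ≤⟨ +-mono-≤
             (≤-trans (∣+-+∣ (riemann m a c' 0<a 0<c') (riemann m c' b 0<c' 0<b)
                             (riemann 0 a c' 0<a 0<c') (riemann 0 c' b 0<c' 0<b))
               (+-mono-≤ (subst (λ z → ∣ riemann m a c' 0<a 0<c' - riemann 0 a c' 0<a 0<c' ∣ ≤ K * (z * z)) (mid-a a b)
                            (refine₀ m a c' 0<a 0<c' c≤a c≤c'))
                         (subst (λ z → ∣ riemann m c' b 0<c' 0<b - riemann 0 c' b 0<c' 0<b ∣ ≤ K * (z * z)) (b-mid a b)
                            (refine₀ m c' b 0<c' 0<b c≤c' c≤b))))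
             (halving a b 0<a 0<b c≤a c≤b) ⟩
      (K * (h * h) + K * (h * h)) + K * (h * h)
        ≤⟨ +-monoʳ-≤ (K * (h * h) + K * (h * h))
             (subst (_≤ K * (h * h) + K * (h * h)) (+-identityʳ (K * (h * h)))
               (+-monoʳ-≤ (K * (h * h)) (*-nonNeg (<⇒≤ 0<K) (0≤sq h)))) ⟩
      (K * (h * h) + K * (h * h)) + (K * (h * h) + K * (h * h))
        ≡⟨ solve 2 (λ k d → let h = con ½ :* d ; t = k :* (h :* h) in (t :+ t) :+ (t :+ t) := k :* (d :* d)) refl K (b - a) ⟩
      K * ((b - a) * (b - a)) ∎
      where
      open ≤-Reasoning
      c' = mid a b
      0<c' = 0<mid 0<a 0<b
      c≤c' = mid-≥ c≤a c≤b
      h = ½ * (b - a)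

    refine : ∀ {n m} → n ℕ.≤ m → ∀ a b (0<a : 0ℚ < a) (0<b : 0ℚ < b) → c ≤ a → c ≤ b →
      ∣ riemann m a b 0<a 0<b - riemann n a b 0<a 0<b ∣ ≤ (K * ((b - a) * (b - a))) * ½^ n
    refine {m = m} z≤n a b 0<a 0<b c≤a c≤b =
      ≤-trans (refine₀ m a b 0<a 0<b c≤a c≤b) (≤-reflexive (sym (*-identityʳ _)))
    refine {suc n} {suc m} (s≤s n≤m) a b 0<a 0<b c≤a c≤b = begin
      ∣ riemann (suc m) a b 0<a 0<b - riemann (suc n) a b 0<a 0<b ∣
        ≤⟨ ∣+-+∣ (riemann m a c' 0<a 0<c') (riemann m c' b 0<c' 0<b)
                 (riemann n a c' 0<a 0<c') (riemann n c' b 0<c' 0<b) ⟩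
      ∣ riemann m a c' 0<a 0<c' - riemann n a c' 0<a 0<c' ∣
        + ∣ riemann m c' b 0<c' 0<b - riemann n c' b 0<c' 0<b ∣
        ≤⟨ +-mono-≤ (refine n≤m a c' 0<a 0<c' c≤a c≤c') (refine n≤m c' b 0<c' 0<b c≤c' c≤b) ⟩
      (K * ((c' - a) * (c' - a))) * ½^ n + (K * ((b - c') * (b - c'))) * ½^ n
        ≡⟨ solve 4 (λ k a b p → let c' = con ½ :* (a :+ b) in
              (k :* ((c' :- a) :* (c' :- a))) :* p :+ (k :* ((b :- c') :* (b :- c'))) :* p
                := (k :* ((b :- a) :* (b :- a))) :* (con ½ :* p)) refl K a b (½^ n) ⟩
      (K * ((b - a) * (b - a))) * ½^ (suc n) ∎
      where
      open ≤-Reasoning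
      c' = mid a b
      0<c' = 0<mid 0<a 0<b
      c≤c' = mid-≥ c≤a c≤b

    riemann-lipschitz : ∀ n a b a' b' (0<a : 0ℚ < a) (0<b : 0ℚ < b) (0<a' : 0ℚ < a') (0<b' : 0ℚ < b') →
      c ≤ a → c ≤ b → c ≤ a' → c ≤ b' →
      ∣ riemann n a b 0<a 0<b - riemann n a' b' 0<a' 0<b' ∣ ≤ K * ∣ b * a' - b' * a ∣
    riemann-lipschitz zero a b a' b' 0<a 0<b 0<a' 0<b' c≤a c≤b c≤a' c≤b' = begin
      ∣ (b - a) * r - (b' - a') * r' ∣   ≡⟨ cong ∣_∣ eq ⟩
      ∣ (b * a' - b' * a) * (r * r') ∣   ≡⟨ ∣p*q∣≡∣p∣*∣q∣ (b * a' - b' * a) (r * r') ⟩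
      X * ∣ r * r' ∣                     ≡⟨ cong (X *_) (0≤p⇒∣p∣≡p (*-nonNeg 0≤r 0≤r')) ⟩
      X * (r * r')                       ≤⟨ *-monoˡ X (0≤∣p∣ (b * a' - b' * a))
                                              (*-mono 0≤r (<⇒≤ (recip-pos c 0<c))
                                                (recip-anti c a 0<c 0<a c≤a) (recip-anti c a' 0<c 0<a' c≤a')) ⟩
      X * K                              ≡⟨ *-comm X K ⟩
      K * X                              ∎
      where
      open ≤-Reasoning
      r = recip a 0<a
      r' = recip a' 0<a'
      X = ∣ b * a' - b' * a ∣
      0≤r = <⇒≤ (recip-pos a 0<a)
      0≤r' = <⇒≤ (recip-pos a' 0<a')
      eq : (b - a) * r - (b' - a') * r' ≡ (b * a' - b' * a) * (r * r')
      eq = trans (solve 6 (λ a b r a' b' r' → (b :- a) :* r :- (b' :- a') :* r'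
                             := (b :* r :- b' :* r') :- (a :* r :- a' :* r')) refl a b r a' b' r')
           (trans (cong₂ (λ u v → (b * r - b' * r') - (u - v)) (recip-inv a 0<a) (recip-inv a' 0<a'))
           (trans (solve 4 (λ b r b' r' → (b :* r :- b' :* r') :- (con 1ℚ :- con 1ℚ)
                             := b :* con 1ℚ :* r :- b' :* con 1ℚ :* r') refl b r b' r')
           (trans (cong₂ (λ u v → b * u * r - b' * v * r') (sym (recip-inv a' 0<a')) (sym (recip-inv a 0<a)))
           (solve 6 (λ a b r a' b' r' → b :* (a' :* r') :* r :- b' :* (a :* r) :* r'
                             := (b :* a' :- b' :* a) :* (r :* r')) refl a b r a' b' r'))))
    riemann-lipschitz (suc n) a b a' b' 0<a 0<b 0<a' 0<b' c≤a c≤b c≤a' c≤b' = begin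
      ∣ riemann (suc n) a b 0<a 0<b - riemann (suc n) a' b' 0<a' 0<b' ∣
        ≤⟨ ∣+-+∣ (riemann n a m 0<a 0<m) (riemann n m b 0<m 0<b)
                 (riemann n a' m' 0<a' 0<m') (riemann n m' b' 0<m' 0<b') ⟩
      ∣ riemann n a m 0<a 0<m - riemann n a' m' 0<a' 0<m' ∣
        + ∣ riemann n m b 0<m 0<b - riemann n m' b' 0<m' 0<b' ∣
        ≤⟨ +-mono-≤ (riemann-lipschitz n a m a' m' 0<a 0<m 0<a' 0<m' c≤a c≤m c≤a' c≤m')
                    (riemann-lipschitz n m b m' b' 0<m 0<b 0<m' 0<b' c≤m c≤b c≤m' c≤b') ⟩
      K * ∣ m * a' - m' * a ∣ + K * ∣ b * m' - b' * m ∣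
        ≡⟨ cong₂ (λ u v → K * u + K * v)
             (trans (cong ∣_∣ (solve 4 (λ a b a' b' → con ½ :* (a :+ b) :* a' :- con ½ :* (a' :+ b') :* a
                                          := con ½ :* (b :* a' :- b' :* a)) refl a b a' b'))
                    (∣p*q∣≡∣p∣*∣q∣ ½ (b * a' - b' * a)))
             (trans (cong ∣_∣ (solve 4 (λ a b a' b' → b :* (con ½ :* (a' :+ b')) :- b' :* (con ½ :* (a :+ b))
                                          := con ½ :* (b :* a' :- b' :* a)) refl a b a' b'))
                    (∣p*q∣≡∣p∣*∣q∣ ½ (b * a' - b' * a))) ⟩
      K * (½ * X) + K * (½ * X)
        ≡⟨ solve 2 (λ k x → k :* (con ½ :* x) :+ k :* (con ½ :* x) := k :* x) refl K X ⟩
      K * X ∎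
      where
      open ≤-Reasoning
      X = ∣ b * a' - b' * a ∣
      m = mid a b
      0<m = 0<mid 0<a 0<b
      c≤m = mid-≥ c≤a c≤b
      m' = mid a' b'
      0<m' = 0<mid 0<a' 0<b'
      c≤m' = mid-≥ c≤a' c≤b'

  riemann-≥ : ∀ n a b (0<a : 0ℚ < a) (0<b : 0ℚ < b) → a ≤ b →
    (b - a) * recip b 0<b ≤ riemann n a b 0<a 0<b
  riemann-≥ zero a b 0<a 0<b a≤b = *-monoˡ (b - a) (p-q≥0 a≤b) (recip-anti a b 0<a 0<b a≤b)
  riemann-≥ (suc n) a b 0<a 0<b a≤b = begin
    (b - a) * s ≡⟨ solve 3 (λ a b s → (b :- a) :* s
                      := (con ½ :* (a :+ b) :- a) :* s :+ (b :- con ½ :* (a :+ b)) :* s) refl a b s ⟩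
    (m - a) * s + (b - m) * s
      ≤⟨ +-mono-≤ (≤-trans (*-monoˡ (m - a) (p-q≥0 a≤m) (recip-anti m b 0<m 0<b m≤b))
                           (riemann-≥ n a m 0<a 0<m a≤m))
                  (riemann-≥ n m b 0<m 0<b m≤b) ⟩
    riemann (suc n) a b 0<a 0<b ∎
    where
    open ≤-Reasoning
    m = mid a b
    0<m = 0<mid 0<a 0<b
    s = recip b 0<b
    a≤m : a ≤ m
    a≤m = mid-≥ ≤-refl a≤b
    m≤b : m ≤ b
    m≤b = p-q≥0⁻¹ (subst (0ℚ ≤_) (sym (b-mid a b)) (*-nonNeg (<⇒≤ 0<½) (p-q≥0 a≤b)))

  0≤½^ : ∀ n → 0ℚ ≤ ½^ n
  0≤½^ zero    = <⇒≤ 0<1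
  0≤½^ (suc n) = *-nonNeg (<⇒≤ 0<½) (0≤½^ n)

  ½^-≤1 : ∀ n → ½^ n ≤ 1ℚ
  ½^-≤1 zero    = ≤-refl
  ½^-≤1 (suc n) = ≤-trans (*-mono {½} {1ℚ} (<⇒≤ 0<½) (<⇒≤ 0<1) (*≤* (ℤ.+≤+ (s≤s z≤n))) (½^-≤1 n)) (≤-reflexive (*-identityˡ 1ℚ))

  ½^-anti : ∀ {m n} → m ℕ.≤ n → ½^ n ≤ ½^ m
  ½^-anti {n = n} z≤n = ½^-≤1 n
  ½^-anti (s≤s m≤n)   = *-monoˡ ½ (<⇒≤ 0<½) (½^-anti m≤n)

  n*½^n≤1 : ∀ n → fromℕ n * ½^ n ≤ 1ℚ
  n*½^n≤1 zero = <⇒≤ 0<1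
  n*½^n≤1 (suc n) = begin
    fromℕ (suc n) * (½ * ½^ n)           ≡⟨ cong (_* (½ * ½^ n)) (fromℕ-suc n) ⟩
    (1ℚ + fromℕ n) * (½ * ½^ n)          ≡⟨ solve 2 (λ f p → (con 1ℚ :+ f) :* (con ½ :* p) := con ½ :* p :+ con ½ :* (f :* p)) refl (fromℕ n) (½^ n) ⟩
    ½ * ½^ n + ½ * (fromℕ n * ½^ n)      ≤⟨ +-mono-≤ (*-monoˡ ½ (<⇒≤ 0<½) (½^-≤1 n)) (*-monoˡ ½ (<⇒≤ 0<½) (n*½^n≤1 n)) ⟩
    ½ * 1ℚ + ½ * 1ℚ                      ≡⟨ half-half 1ℚ ⟩
    1ℚ                                   ∎
    where open ≤-Reasoning

  ½^-small : ∀ C {ε} → 0ℚ < ε → ∃[ N ] C * ½^ N ≤ ε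
  ½^-small C {ε} 0<ε with archimedean (recip ε 0<ε * C)
  ... | N , le = N , (begin
    C * ½^ N                          ≡⟨ cong (_* ½^ N) (sym (*-identityˡ C)) ⟩
    1ℚ * C * ½^ N                     ≡⟨ cong (λ z → z * C * ½^ N) (sym (recip-inv ε 0<ε)) ⟩
    ε * recip ε 0<ε * C * ½^ N        ≡⟨ solve 4 (λ e r c p → e :* r :* c :* p := e :* ((r :* c) :* p)) refl ε (recip ε 0<ε) C (½^ N) ⟩
    ε * ((recip ε 0<ε * C) * ½^ N)    ≤⟨ *-monoˡ ε (<⇒≤ 0<ε) (*-monoʳ (½^ N) (0≤½^ N) le) ⟩
    ε * (fromℕ N * ½^ N)              ≤⟨ *-monoˡ ε (<⇒≤ 0<ε) (n*½^n≤1 N) ⟩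
    ε * 1ℚ                            ≡⟨ *-identityʳ ε ⟩
    ε                                 ∎)
    where open ≤-Reasoning

open RiemannLemmas

-- The natural logarithm, as the integral of dt / t from 1 to x: the n-th term is
-- the Riemann sum for 2ⁿ intervals at the n-th term (of the tail) of x.  The sums
-- converge uniformly for upper limits in a compact subset of (0 , ∞).
log : (x : ℝ) → 0ℝ <ℝ x → ℝ
log x 0<x = mkℝ L cau
  where
  open Tail x 0<x
  open ≤-Reasoning

  L : ℕ → ℚ
  L n = riemann n 1ℚ (tail n) 0<1 (0<tail n)

  c : ℚ
  c = δ ℚ.⊓ 1ℚ

  0<c : 0ℚ < c
  0<c with ⊓-sel δ 1ℚ
  ... | inj₁ e = subst (0ℚ <_) (sym e) 0<δ
  ... | inj₂ e = subst (0ℚ <_) (sym e) 0<1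

  c≤1 : c ≤ 1ℚ
  c≤1 = p⊓q≤q δ 1ℚ

  c≤tail : ∀ n → c ≤ tail n
  c≤tail n = ≤-trans (p⊓q≤p δ 1ℚ) (δ≤tail n)

  k : ℚ
  k = K c 0<c

  0<k : 0ℚ < k
  0<k = 0<K c 0<c

  close : ∀ {n m} → n ℕ.≤ m →
    ∣ L m - L n ∣ ≤ k * ∣ tail m - tail n ∣ + (k * ((tail n - 1ℚ) * (tail n - 1ℚ))) * ½^ n
  close {n} {m} n≤m = ≤-trans
    (∣-∣-tri (L m) (riemann m 1ℚ (tail n) 0<1 (0<tail n)) (L n))
    (+-mono-≤
      (subst (λ z → ∣ L m - riemann m 1ℚ (tail n) 0<1 (0<tail n) ∣ ≤ k * ∣ z ∣)
        (cong₂ _-_ (*-identityʳ (tail m)) (*-identityʳ (tail n)))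
        (riemann-lipschitz c 0<c m 1ℚ (tail m) 1ℚ (tail n) 0<1 (0<tail m) 0<1 (0<tail n)
          c≤1 (c≤tail m) c≤1 (c≤tail n)))
      (refine c 0<c n≤m 1ℚ (tail n) 0<1 (0<tail n) c≤1 (c≤tail n)))

  cau : Cauchy L
  cau {ε} 0<ε =
    let η , 0<η , kη≡ = shrink 0<k (half-pos 0<ε)
        B , 0<B , N₁ , hB = bounded (tailℝ +ℝ fromℚ (- 1ℚ))
        N₂ , h₂ = tail-cauchy 0<η
        N₃ , h₃ = ½^-small (k * (B * B)) (half-pos 0<ε)
    in N₁ ℕ.⊔ (N₂ ℕ.⊔ N₃) , main η kη≡ B 0<B N₁ hB N₂ h₂ N₃ h₃
    where
    module _ η (kη≡ : k * η ≡ ½ * ε) B (0<B : 0ℚ < B)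
             N₁ (hB : ∀ n → N₁ ℕ.≤ n → ∣ tail n - 1ℚ ∣ ≤ B)
             N₂ (h₂ : ∀ m n → N₂ ℕ.≤ m → N₂ ℕ.≤ n → ∣ tail m - tail n ∣ ≤ η)
             N₃ (h₃ : (k * (B * B)) * ½^ N₃ ≤ ½ * ε) where
      M = N₁ ℕ.⊔ (N₂ ℕ.⊔ N₃)
      ordered : ∀ m n → M ℕ.≤ n → n ℕ.≤ m → ∣ L m - L n ∣ ≤ ε
      ordered m n M≤n n≤m = begin
        ∣ L m - L n ∣ ≤⟨ close n≤m ⟩
        k * ∣ tail m - tail n ∣ + (k * (d * d)) * ½^ n
          ≤⟨ +-mono-≤
               (*-monoˡ k (<⇒≤ 0<k) (h₂ m n (ℕ.≤-trans N₂≤n n≤m) N₂≤n))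
               (*-mono {k * (d * d)} {k * (B * B)} {½^ n} {½^ N₃} (*-nonNeg (<⇒≤ 0<k) (0≤sq d)) (0≤½^ N₃)
                 (*-monoˡ k (<⇒≤ 0<k) (subst (_≤ B * B) (∣d∣∣d∣ d) (*-mono {∣ d ∣} {B} {∣ d ∣} {B} (0≤∣p∣ d) (<⇒≤ 0<B) d≤B d≤B)))
                 (½^-anti N₃≤n)) ⟩
        k * η + (k * (B * B)) * ½^ N₃ ≤⟨ +-mono-≤ (≤-reflexive kη≡) h₃ ⟩
        ½ * ε + ½ * ε                 ≡⟨ half-half ε ⟩
        ε ∎
        where
        d = tail n - 1ℚ
        d≤B = hB n (ℕ.m⊔n≤o⇒m≤o N₁ _ M≤n)
        N₂≤n = ℕ.m⊔n≤o⇒m≤o N₂ N₃ (ℕ.m⊔n≤o⇒n≤o N₁ _ M≤n)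
        N₃≤n = ℕ.m⊔n≤o⇒n≤o N₂ N₃ (ℕ.m⊔n≤o⇒n≤o N₁ _ M≤n)
      main : ∀ m n → M ℕ.≤ m → M ℕ.≤ n → ∣ L m - L n ∣ ≤ ε
      main m n M≤m M≤n with ℕ.≤-total n m
      ... | inj₁ n≤m = ordered m n M≤n n≤m
      ... | inj₂ m≤n = subst (_≤ ε) (∣-∣-sym (L n) (L m)) (ordered n m M≤m m≤n)

log-pos : ∀ x (0<x : 0ℝ <ℝ x) → 1ℝ <ℝ x → 0ℝ <ℝ log x 0<x
log-pos x 0<x (η , 0<η , N₁ , h) =
  η * r , *-pos 0<η (recip-pos e 0<e) , N₁ , λ n N₁≤n → begin
    0ℚ + η * r                                  ≡⟨ +-identityˡ (η * r) ⟩
    η * r                                       ≡⟨ ηr≡1-r ⟩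
    1ℚ - r                                      ≤⟨ +-monoʳ-≤ 1ℚ (neg-antimono-≤ (recip-anti e (tail n) 0<e (0<tail n) (e≤ n N₁≤n))) ⟩
    1ℚ - recip (tail n) (0<tail n)              ≡⟨ cong (_- recip (tail n) (0<tail n)) (sym (recip-inv (tail n) (0<tail n))) ⟩
    tail n * recip (tail n) (0<tail n) - recip (tail n) (0<tail n)
      ≡⟨ solve 2 (λ t r → t :* r :- r := (t :- con 1ℚ) :* r) refl (tail n) (recip (tail n) (0<tail n)) ⟩
    (tail n - 1ℚ) * recip (tail n) (0<tail n)   ≤⟨ riemann-≥ n 1ℚ (tail n) 0<1 (0<tail n) (≤-trans 1≤e (e≤ n N₁≤n)) ⟩
    riemann n 1ℚ (tail n) 0<1 (0<tail n)        ∎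
  where
  open Tail x 0<x
  open ≤-Reasoning
  e = 1ℚ + η
  0<e = +-pos 0<1 0<η
  r = recip e 0<e
  1≤e : 1ℚ ≤ e
  1≤e = subst (_≤ e) (+-identityʳ 1ℚ) (+-monoʳ-≤ 1ℚ (<⇒≤ 0<η))
  e≤ : ∀ n → N₁ ℕ.≤ n → e ≤ tail n
  e≤ n N₁≤n = h (N ℕ.+ n) (ℕ.≤-trans N₁≤n (ℕ.m≤n+m n N))
  ηr≡1-r : η * r ≡ 1ℚ - r
  ηr≡1-r = trans (solve 2 (λ η r → η :* r := (con 1ℚ :+ η) :* r :- r) refl η r)
                 (cong (_- r) (recip-inv e 0<e))

fromℕℝ : ℕ → ℝ
fromℕℝ n = fromℚ (fromℕ n)

1<fromℕ : ∀ n .{{_ : NonTrivial n}} → 1ℝ <ℝ fromℕℝ n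
1<fromℕ n@(suc (suc _)) = 1ℚ , 0<1 , 0 , λ _ _ → fromℕ-mono {2} {n} (s≤s (s≤s z≤n))

0<fromℕ : ∀ n .{{_ : NonTrivial n}} → 0ℝ <ℝ fromℕℝ n
0<fromℕ n@(suc (suc _)) = 1ℚ , 0<1 , 0 , λ _ _ → fromℕ-mono {1} {n} (s≤s z≤n)

logℕ : (n : ℕ) → .{{NonTrivial n}} → ℝ
logℕ n = log (fromℕℝ n) (0<fromℕ n)

0<logℕ : ∀ n .{{_ : NonTrivial n}} → 0ℝ <ℝ logℕ n
0<logℕ n = log-pos (fromℕℝ n) (0<fromℕ n) (1<fromℕ n)

loglogℕ : (n : ℕ) → .{{NonTrivial n}} → ℝ
loglogℕ n = log (logℕ n) (0<logℕ n)

log₂ℕ : (n : ℕ) → .{{NonTrivial n}} → ℝ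
log₂ℕ n = logℕ n /ℝ logℕ 2 [ 0<logℕ 2 ]

0<2log2 : 0ℝ <ℝ 2ℝ *ℝ logℕ 2
0<2log2 =
  let δ , 0<δ , N , h = 0<logℕ 2 in
  fromℕ 2 * δ , *-pos (positive⁻¹ (fromℕ 2)) 0<δ , N , λ n N≤n →
    subst (_≤ fromℕ 2 * seq (logℕ 2) n) (sym (+-identityˡ (fromℕ 2 * δ)))
      (*-monoˡ (fromℕ 2) (<⇒≤ (positive⁻¹ (fromℕ 2)))
        (subst (_≤ seq (logℕ 2) n) (+-identityˡ δ) (h n N≤n)))

TendsToZeroAlongPrimes : (ℕ → ℝ) → Set
TendsToZeroAlongPrimes o = ∀ {ε} → 0ℚ < ε →
  ∃[ N ] (∀ p → Prime p → N ℕ.≤ p → fromℚ (- ε) ≤ℝ o p × o p ≤ℝ fromℚ ε)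

-- The cyclic group of order p is realised on Fin p, with addition modulo p.

module _ {p : ℕ} .{{_ : NonZero p}} where

  infixl 6 _⊕_

  _⊕_ : Fin p → Fin p → Fin p
  x ⊕ y = (toℕ x ℕ.+ toℕ y) mod p

  𝟘 : Fin p
  𝟘 = 0 mod p

  elements : Subset p → List (Fin p)
  elements S = filter (_∈? S) (allFin p)

  ∑ : Subset p → Fin p
  ∑ S = foldr _⊕_ 𝟘 (elements S)

  SubsetSum : Subset p → Fin p → Set
  SubsetSum A x = ∃[ S ] S ⊆ A × ∑ S ≡ x

  Complete : Subset p → Set
  Complete A = ∀ x → SubsetSum A x

  complete? : Decidable Complete
  complete? A = Fin.all? λ x → anySubset? λ S → (S ⊆? A) ×-dec (∑ S Fin.≟ x)

allSubsets : ∀ n → List (Subset n)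
allSubsets zero    = [] ∷ []
allSubsets (suc n) = List.map (inside ∷_) (allSubsets n) ++ List.map (outside ∷_) (allSubsets n)

subsetsOfSize : ∀ n → ℕ → List (Subset n)
subsetsOfSize n k = filter (λ A → card A ℕ.≟ k) (allSubsets n)

IsLeast : (ℕ → Set) → ℕ → Set
IsLeast P k = P k × (∀ j → P j → k ℕ.≤ j)

module _ (p : ℕ) .{{_ : NonZero p}} where

  #all #complete : ℕ → ℕ
  #all      k = length (subsetsOfSize p k)
  #complete k = length (filter complete? (subsetsOfSize p k))

  -- The first component says that p has subsets of size k, so that there is a
  -- uniform distribution on them.
  CompleteWithProbability≥½ : ℕ → Set
  CompleteWithProbability≥½ k = Σ[ nz ∈ NonZero (#all k) ] ½ ≤ (+ #complete k / #all k) {{nz}}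

-- The least k with the property exists because k = p has it: the only subset of
-- size p is all of Fin p, and that is complete.

module Existence where

  least : ∀ {P : ℕ → Set} → Decidable P → ∀ n → P n → ∃[ k ] IsLeast P k
  least P? n Pn with P? 0
  ... | yes P0 = 0 , P0 , λ _ _ → z≤n
  least P? zero    P0 | no ¬P0 = contradiction P0 ¬P0
  least P? (suc n) Pn | no ¬P0 with least (P? ∘ suc) n Pn
  ... | k , Pk , k≤ = suc k , Pk , λ
    { zero P0 → contradiction P0 ¬P0
    ; (suc j) Pj → s≤s (k≤ j Pj) }

  half-mono : ∀ m n .{{_ : NonZero n}} → m ≡ n → ½ ≤ + m / n
  half-mono m (suc n) refl = toℚᵘ-cancel-≤
    (ℚᵘ.≤-respʳ-≃ (ℚᵘ.≃-sym (toℚᵘ-fromℚᵘ (ℚᵘ.mkℚᵘ (+ m) n)))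
      (ℚᵘ.*≤* (ℤ.+≤+ (ℕ.≤-trans (ℕ.*-monoˡ-≤ m {1} {2} (s≤s z≤n)) (ℕ.≤-reflexive (ℕ.*-comm 2 m))))))

  ½≤? : ∀ m n → Dec (Σ[ nz ∈ NonZero n ] ½ ≤ (+ m / n) {{nz}})
  ½≤? m zero    = no λ ()
  ½≤? m (suc n) = map′ (_ ,_) proj₂ (½ ℚ.≤? (+ m / suc n))

  ∈-allSubsets : ∀ {n} (A : Subset n) → A ∈ allSubsets n
  ∈-allSubsets []            = here refl
  ∈-allSubsets (inside  ∷ A) = ∈-++⁺ˡ (∈-map⁺ (inside ∷_) (∈-allSubsets A))
  ∈-allSubsets {suc n} (outside ∷ A) =
    ∈-++⁺ʳ (List.map (inside ∷_) (allSubsets n)) (∈-map⁺ (outside ∷_) (∈-allSubsets A))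

  module _ (p : ℕ) .{{_ : NonZero p}} where

    decidable : Decidable (CompleteWithProbability≥½ p)
    decidable k = ½≤? (#complete p k) (#all p k)

    filter-singleton : ∀ (x : Fin p) xs → Unique xs → x ∈ xs → filter (_∈? ⁅ x ⁆) xs ≡ x ∷ []
    filter-singleton x (y ∷ ys) (y∉ ∷ u) x∈ with y ∈? ⁅ x ⁆
    filter-singleton x (y ∷ ys) (y∉ ∷ u) x∈ | yes y∈ with x∈⁅y⁆⇒x≡y x y∈
    ... | refl = cong (x ∷_) (filter-none (_∈? ⁅ x ⁆)
                   (All.map (λ x≢z z∈ → x≢z (sym (x∈⁅y⁆⇒x≡y x z∈))) y∉))
    filter-singleton x (y ∷ ys) (y∉ ∷ u) (here refl) | no y∉x = contradiction (x∈⁅x⁆ x) y∉x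
    filter-singleton x (y ∷ ys) (y∉ ∷ u) (there x∈) | no y∉x = filter-singleton x ys u x∈

    ∑-singleton : ∀ (x : Fin p) → ∑ ⁅ x ⁆ ≡ x
    ∑-singleton x = trans (cong (foldr _⊕_ 𝟘) (filter-singleton x (allFin p) (allFin⁺ p) (∈-allFin x)))
                          (⊕-identityʳ x)
      where
      toℕ-mod : ∀ m → m ℕ.< p → toℕ (m mod p) ≡ m
      toℕ-mod m m<p = trans (Fin.toℕ-fromℕ< _) (m<n⇒m%n≡m m<p)
      ⊕-identityʳ : ∀ x → x ⊕ 𝟘 ≡ x
      ⊕-identityʳ x = Fin.toℕ-injective (trans
        (cong (λ z → toℕ ((toℕ x ℕ.+ z) mod p)) (toℕ-mod 0 (ℕ.>-nonZero⁻¹ p)))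
        (trans (cong (λ z → toℕ (z mod p)) (ℕ.+-identityʳ (toℕ x))) (toℕ-mod (toℕ x) (Fin.toℕ<n x))))

    ⊤-complete : Complete ⊤
    ⊤-complete x = ⁅ x ⁆ , ⊆⊤ , ∑-singleton x

    size-p-complete : ∀ A → card A ≡ p → Complete A
    size-p-complete A e = subst Complete (sym (∣p∣≡n⇒p≡⊤ e)) ⊤-complete

    nonempty : ∀ {A : Set} {x : A} {xs} → x ∈ xs → NonZero (length xs)
    nonempty (here _)  = _
    nonempty (there _) = _

    at-p : CompleteWithProbability≥½ p p
    at-p = nz , half-mono (#complete p p) (#all p p) {{nz}} (cong length (filter-all complete? (All.tabulate λ {A} A∈ →
        size-p-complete A (proj₂ (∈-filter⁻ (λ A → card A ℕ.≟ p) {xs = allSubsets p} A∈)))))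
      where
      nz = nonempty (∈-filter⁺ (λ A → card A ℕ.≟ p) (∈-allSubsets (⊤ {p})) (∣⊤∣≡n p))

f-exists : ∀ p .{{_ : NonZero p}} → ∃[ k ] IsLeast (CompleteWithProbability≥½ p) k
f-exists p = Existence.least (Existence.decidable p) p (Existence.at-p p)

f : (p : ℕ) → .{{NonZero p}} → ℕ
f p = proj₁ (f-exists p)

{-# OPTIONS --safe #-}

-- Write q k for the probability that a random x is not a subset sum of a random
-- sequence of length k.  The density δ of missed elements satisfies 𝔼 δ(a ∷ as) = δ(as)²
-- over a, so q (k + 1) = 𝔼 δ² ≥ (q k)², whence q k ≥ (1 - 1/p)^(2^k) from q 0 = 1 - 1/p, and
-- by Cauchy–Schwarz δ ≠ 0 with probability at least (q k)² / q (k + 1).  It remains to bound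
-- q (k + 1) from above by a little more than (1 - 1/p)^(2^(k+1)), which is what one would get if
-- the 2^(k+1) subsets hit x independently.  By Bonferroni's inequalities this is a matter
-- of comparing factorial moments of the number of hits: r subsets all hit x with
-- probability p^-d for d the rank of a 0/1 matrix with r rows and a column of ones.  If the
-- rows are distinct and d < r then the column space contains at most 3/4 · 2^d points of the
-- cube, so there are at most 2^(r d) (3/4 · 2^d)^(k+1) such matrices.  This is negligible as
-- long as r² is small compared with log p, and r of order 2^k / p is enough for Bonferroni;
-- so 2^k may exceed p by a factor of order √(log p).

module Submission where

open import Defs
open import Data.Nat.Base as ℕ using (ℕ; zero; suc; NonZero; NonTrivial; z≤n; s≤s; _≥_)
import Data.Nat.Properties as ℕ
open import Data.Nat.DivMod using (_mod_; _%_; m%n<n; %-distribˡ-+; %-distribˡ-*; m<n⇒m%n≡m; n%n≡0; m≡m%n+[m/n]*n; m/n*n≤m)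
open import Data.Nat.Divisibility using (_∣_; divides; n∣m⇒m%n≡0)
open import Data.Nat.Primality using (Prime; prime⇒nonZero; prime⇒nonTrivial)
open import Data.Nat.Coprimality using (coprime-Bézout; prime⇒coprime)
open import Data.Nat.GCD using (module Bézout)
open import Data.Bool.Base using (Bool; true; false)
open import Data.Fin.Base as Fin using (Fin; toℕ)
import Data.Fin.Properties as Fin
open import Data.Fin.Subset using (Subset; inside; outside; _⊆_) renaming (_∈_ to _∈ₛ_; _∉_ to _∉ₛ_; ∣_∣ to card; ⊥ to ∅)
open import Data.Fin.Subset.Properties using (_∈?_; ∉⊥; ∣⊥∣≡0)
open import Data.List.Base as List using (List; []; _∷_; _++_; allFin; filter; foldr; length; cartesianProductWith)
import Data.List.Properties as List
open import Data.List.Membership.Propositional using (_∈_; _∉_)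
open import Data.List.Membership.Propositional.Properties using (∈-map⁻; ∈-++⁺ʳ; ∈-++⁻; ∈-filter⁺; ∈-filter⁻; ∈-allFin; ∈-cartesianProductWith⁺; ∈-cartesianProductWith⁻; ∈-upTo⁺; ∈-upTo⁻)
open import Data.List.Relation.Unary.All as All using (All; []; _∷_)
open import Data.List.Relation.Unary.Any using (Any; here; there)
import Data.List.Relation.Unary.Any as Any
open import Data.List.Relation.Unary.Unique.Propositional using (Unique; []; _∷_)
import Data.List.Relation.Unary.Unique.Propositional.Properties as Unique
open import Data.Vec.Base as Vec using (Vec; []; _∷_; lookup; replicate; zipWith; _[_]≔_)
import Data.Vec.Properties as Vec
import Data.Integer.Base as ℤ
import Data.Integer.Properties as ℤ
open import Data.Rational.Base as ℚ
  using (ℚ; 0ℚ; 1ℚ; ½; _+_; _*_; _-_; -_; _≤_; _<_; ∣_∣; _/_; positive; >-nonZero; *≤*)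
open import Data.Rational.Properties as ℚ
  using (module ≤-Reasoning; ≤-refl; ≤-trans; ≤-reflexive; <⇒≤; ≤-total; <-≤-trans; ≤-<-trans; +-mono-≤; +-monoˡ-≤; +-monoʳ-≤;
         +-identityˡ; +-identityʳ; +-comm; +-assoc; +-inverseʳ; *-identityˡ; *-identityʳ; *-comm; *-assoc;
         *-zeroˡ; *-zeroʳ; *-distribˡ-+; *-distribʳ-+; positive⁻¹; neg-antimono-≤)
open import Data.Rational.Solver using (module +-*-Solver)
import Data.Rational.Unnormalised.Base as ℚᵘ
import Data.Rational.Unnormalised.Properties as ℚᵘ
import Algebra.Bundles as Bundles
open import Algebra.Properties.CommutativeSemiring.Exp (Bundles.CommutativeRing.commutativeSemiring ℚ.+-*-commutativeRing)
  using (_^_; ^-homo-*; ^-assocʳ; ^-distrib-*)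
open import Data.Empty using (⊥; ⊥-elim)
open import Data.Unit.Base using () renaming (⊤ to Unit)
open import Data.Product.Base using (Σ-syntax; ∃-syntax; _×_; _,_; proj₁; proj₂)
open import Data.Sum.Base using (_⊎_; inj₁; inj₂)
open import Data.Nat.Solver using () renaming (module +-*-Solver to ℕSolver)
open ℕSolver using () renaming (solve to solveⁿ; _:+_ to _:+ⁿ_; _:*_ to _:*ⁿ_; _:=_ to _:=ⁿ_; con to conⁿ)
open import Function.Base using (_∘_; id; case_of_)
open import Relation.Binary.PropositionalEquality
  using (_≡_; _≢_; refl; sym; trans; cong; cong₂; subst; subst₂; module ≡-Reasoning)
open import Relation.Nullary using (¬_; Dec; yes; no; contradiction)
open import Relation.Nullary.Decidable using (_×-dec_; ¬?)
open import Relation.Unary using (Decidable)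

open +-*-Solver using (solve; _:+_; _:*_; _:-_; :-_; _:=_; con)
open RationalLemmas
open RiemannLemmas using (0≤sq; riemann-≥; ½^-small; 0≤½^; ½^-anti)

-- The recursion for δ bounds q k from below for every k without any moments, so only q (k + 1)
-- needs an upper bound: `q (k + 1) ≤ 3/2 (q k)²` already makes δ nonzero with probability 2/3. The
-- obstacle is that the main term is exponentially small in the mean number 2^(k+1) / p of hits, and
-- this mean grows. A variance bound on the number of hits would only give the reciprocal of the
-- mean, and each error has to stay below a quarter of the main term. Hence the truncation order is
-- a fixed large multiple of the mean. The proportion 3/4 comes from p being odd: the four corners
-- of a parallelogram with nonzero sides never all lie in {0, 1}. A random set differs from a random
-- sequence only through repetitions, of probability at most k² / p; the gap between 1/3 and 1/2
-- absorbs them. Logarithms are compared on rational Riemann sums, with p rounded up to a power of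
-- 2. All roundings together cost a bounded amount, which becomes an error of order 1 / log log p in
-- the coefficient.

length-product : ∀ {A B C : Set} (φ : A → B → C) xs ys →
  length (cartesianProductWith φ xs ys) ≡ length xs ℕ.* length ys
length-product φ []       ys = refl
length-product φ (x ∷ xs) ys = trans (List.length-++ (List.map (φ x) ys))
  (cong₂ ℕ._+_ (List.length-map (φ x) ys) (length-product φ xs ys))

-- Enumerations of vectors and words, and counting by injections

vecs : ∀ {A : Set} → List A → ∀ k → List (Vec A k)
vecs xs zero    = [] ∷ []
vecs xs (suc k) = cartesianProductWith _∷_ xs (vecs xs k)

∈-vecs : ∀ {A : Set} {xs : List A} → (∀ x → x ∈ xs) → ∀ {k} (v : Vec A k) → v ∈ vecs xs k
∈-vecs all []      = here refl
∈-vecs all (x ∷ v) = ∈-cartesianProductWith⁺ _∷_ (all x) (∈-vecs all v)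

vecs-unique : ∀ {A : Set} {xs : List A} → Unique xs → ∀ k → Unique (vecs xs k)
vecs-unique u zero    = [] ∷ []
vecs-unique u (suc k) = Unique.cartesianProductWith⁺ _∷_ Vec.∷-injective u (vecs-unique u k)

length-vecs : ∀ {A : Set} (xs : List A) k → length (vecs xs k) ≡ length xs ℕ.^ k
length-vecs xs zero    = refl
length-vecs xs (suc k) = trans (length-product _∷_ xs (vecs xs k)) (cong (length xs ℕ.*_) (length-vecs xs k))

words : ∀ {A : Set} → List A → ℕ → List (List A)
words xs zero    = [] ∷ []
words xs (suc k) = cartesianProductWith _∷_ xs (words xs k)

∈-words : ∀ {A : Set} {xs : List A} → (∀ x → x ∈ xs) → ∀ w → w ∈ words xs (length w)
∈-words all []      = here refl
∈-words all (x ∷ w) = ∈-cartesianProductWith⁺ _∷_ (all x) (∈-words all w)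

length-words : ∀ {A : Set} (xs : List A) k → length (words xs k) ≡ length xs ℕ.^ k
length-words xs zero    = refl
length-words xs (suc k) = trans (length-product _∷_ xs (words xs k)) (cong (length xs ℕ.*_) (length-words xs k))

remove : ∀ {A : Set} {x : A} (ys : List A) → x ∈ ys → List A
remove (y ∷ ys) (here _)   = ys
remove (y ∷ ys) (there x∈) = y ∷ remove ys x∈

length-remove : ∀ {A : Set} {x : A} {ys} (x∈ : x ∈ ys) → suc (length (remove ys x∈)) ≡ length ys
length-remove (here _)   = refl
length-remove {ys = _ ∷ _} (there x∈) = cong suc (length-remove x∈)

∈-remove : ∀ {A : Set} {x y : A} {ys} (x∈ : x ∈ ys) → y ∈ ys → y ≢ x → y ∈ remove ys x∈
∈-remove (here refl) (here refl) y≢x = contradiction refl y≢x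
∈-remove (here refl) (there y∈) y≢x = y∈
∈-remove (there x∈) (here eq)   y≢x = here eq
∈-remove (there x∈) (there y∈)  y≢x = there (∈-remove x∈ y∈ y≢x)

-- Each image is struck from `ys` before the induction continues; injectivity keeps all later images
-- in the shortened list.
injection-length : ∀ {A B : Set} (φ : A → B) xs {ys} → Unique xs → (∀ x → x ∈ xs → φ x ∈ ys) →
  (∀ x y → x ∈ xs → y ∈ xs → φ x ≡ φ y → x ≡ y) → length xs ℕ.≤ length ys
injection-length φ []       u into inj = z≤n
injection-length φ (x ∷ xs) {ys} (x∉ ∷ u) into inj = ℕ.≤-trans
  (s≤s (injection-length φ xs u
    (λ y y∈ → ∈-remove (into x (here refl)) (into y (there y∈)) λ eq → All.lookup x∉ y∈ (inj x y (here refl) (there y∈) (sym eq)))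
    (λ y z y∈ z∈ → inj y z (there y∈) (there z∈))))
  (ℕ.≤-reflexive (length-remove (into x (here refl))))

-- Linear algebra over a finite field

record FieldOn (p : ℕ) : Set where
  infixl 6 _+ᶠ_
  infixl 7 _*ᶠ_
  field
    _+ᶠ_ _*ᶠ_ : Fin p → Fin p → Fin p
    -ᶠ_ : Fin p → Fin p
    0ᶠ 1ᶠ : Fin p
    +ᶠ-assoc     : ∀ a b c → (a +ᶠ b) +ᶠ c ≡ a +ᶠ (b +ᶠ c)
    +ᶠ-comm      : ∀ a b → a +ᶠ b ≡ b +ᶠ a
    +ᶠ-identityˡ : ∀ a → 0ᶠ +ᶠ a ≡ a
    +ᶠ-inverseʳ  : ∀ a → a +ᶠ (-ᶠ a) ≡ 0ᶠ
    *ᶠ-assoc     : ∀ a b c → (a *ᶠ b) *ᶠ c ≡ a *ᶠ (b *ᶠ c)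
    *ᶠ-comm      : ∀ a b → a *ᶠ b ≡ b *ᶠ a
    *ᶠ-identityˡ : ∀ a → 1ᶠ *ᶠ a ≡ a
    *ᶠ-distribˡ  : ∀ a b c → a *ᶠ (b +ᶠ c) ≡ a *ᶠ b +ᶠ a *ᶠ c
    *ᶠ-inverse   : ∀ a → a ≢ 0ᶠ → ∃[ b ] b *ᶠ a ≡ 1ᶠ
    1≢0 : 1ᶠ ≢ 0ᶠ

bools : List Bool
bools = true ∷ false ∷ []

∈-bools : ∀ b → b ∈ bools
∈-bools true  = here refl
∈-bools false = there (here refl)

bools-unique : Unique bools
bools-unique = ((λ ()) ∷ []) ∷ [] ∷ []

module LinearAlgebra {p : ℕ} (𝔽 : FieldOn p) where

  open FieldOn 𝔽
  open ≡-Reasoning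

  +ᶠ-identityʳ : ∀ a → a +ᶠ 0ᶠ ≡ a
  +ᶠ-identityʳ a = trans (+ᶠ-comm a 0ᶠ) (+ᶠ-identityˡ a)

  +ᶠ-cancelʳ : ∀ a b c → a +ᶠ c ≡ b +ᶠ c → a ≡ b
  +ᶠ-cancelʳ a b c eq = trans (sym (undo a)) (trans (cong (_+ᶠ (-ᶠ c)) eq) (undo b))
    where
    undo : ∀ a → (a +ᶠ c) +ᶠ (-ᶠ c) ≡ a
    undo a = trans (+ᶠ-assoc a c (-ᶠ c)) (trans (cong (a +ᶠ_) (+ᶠ-inverseʳ c)) (+ᶠ-identityʳ a))

  +ᶠ-cancelˡ : ∀ a b c → c +ᶠ a ≡ c +ᶠ b → a ≡ b
  +ᶠ-cancelˡ a b c eq = +ᶠ-cancelʳ a b c (trans (+ᶠ-comm a c) (trans eq (+ᶠ-comm c b)))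

  +ᶠ-swap : ∀ a b c → (a +ᶠ b) +ᶠ c ≡ (a +ᶠ c) +ᶠ b
  +ᶠ-swap a b c = trans (+ᶠ-assoc a b c) (trans (cong (a +ᶠ_) (+ᶠ-comm b c)) (sym (+ᶠ-assoc a c b)))

  +ᶠ-interchange : ∀ a b c d → (a +ᶠ b) +ᶠ (c +ᶠ d) ≡ (a +ᶠ c) +ᶠ (b +ᶠ d)
  +ᶠ-interchange a b c d = trans (sym (+ᶠ-assoc (a +ᶠ b) c d))
    (trans (cong (_+ᶠ d) (+ᶠ-swap a b c)) (+ᶠ-assoc (a +ᶠ c) b d))

  *ᶠ-distribʳ : ∀ a b c → (b +ᶠ c) *ᶠ a ≡ b *ᶠ a +ᶠ c *ᶠ a
  *ᶠ-distribʳ a b c = trans (*ᶠ-comm (b +ᶠ c) a)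
    (trans (*ᶠ-distribˡ a b c) (cong₂ _+ᶠ_ (*ᶠ-comm a b) (*ᶠ-comm a c)))

  *ᶠ-zeroʳ : ∀ a → a *ᶠ 0ᶠ ≡ 0ᶠ
  *ᶠ-zeroʳ a = +ᶠ-cancelʳ _ _ (a *ᶠ 0ᶠ) (trans (sym (*ᶠ-distribˡ a 0ᶠ 0ᶠ))
    (trans (cong (a *ᶠ_) (+ᶠ-identityˡ 0ᶠ)) (sym (+ᶠ-identityˡ (a *ᶠ 0ᶠ)))))

  *ᶠ-zeroˡ : ∀ a → 0ᶠ *ᶠ a ≡ 0ᶠ
  *ᶠ-zeroˡ a = trans (*ᶠ-comm 0ᶠ a) (*ᶠ-zeroʳ a)

  *ᶠ-identityʳ : ∀ a → a *ᶠ 1ᶠ ≡ a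
  *ᶠ-identityʳ a = trans (*ᶠ-comm a 1ᶠ) (*ᶠ-identityˡ a)

  V : ℕ → Set
  V r = Vec (Fin p) r

  infixl 6 _⊞_
  infixr 7 _⊙_

  _⊞_ : ∀ {r} → V r → V r → V r
  _⊞_ = zipWith _+ᶠ_

  _⊙_ : ∀ {r} → Fin p → V r → V r
  a ⊙ z = Vec.map (a *ᶠ_) z

  𝟎 : ∀ {r} → V r
  𝟎 = replicate _ 0ᶠ

  ⊞-assoc : ∀ {r} (z w x : V r) → (z ⊞ w) ⊞ x ≡ z ⊞ (w ⊞ x)
  ⊞-assoc = Vec.zipWith-assoc +ᶠ-assoc

  ⊞-comm : ∀ {r} (z w : V r) → z ⊞ w ≡ w ⊞ z
  ⊞-comm = Vec.zipWith-comm +ᶠ-comm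

  ⊞-identityʳ : ∀ {r} (z : V r) → z ⊞ 𝟎 ≡ z
  ⊞-identityʳ = Vec.zipWith-identityʳ +ᶠ-identityʳ

  ⊞-identityˡ : ∀ {r} (z : V r) → 𝟎 ⊞ z ≡ z
  ⊞-identityˡ = Vec.zipWith-identityˡ +ᶠ-identityˡ

  ⊞-swap : ∀ {r} (x y z : V r) → (x ⊞ y) ⊞ z ≡ (x ⊞ z) ⊞ y
  ⊞-swap x y z = trans (⊞-assoc x y z) (trans (cong (x ⊞_) (⊞-comm y z)) (sym (⊞-assoc x z y)))

  ⊞-interchange : ∀ {r} (a b c d : V r) → (a ⊞ b) ⊞ (c ⊞ d) ≡ (a ⊞ c) ⊞ (b ⊞ d)
  ⊞-interchange a b c d = trans (sym (⊞-assoc (a ⊞ b) c d))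
    (trans (cong (_⊞ d) (⊞-swap a b c)) (⊞-assoc (a ⊞ c) b d))

  ⊙-distribˡ : ∀ {r} a (z w : V r) → a ⊙ (z ⊞ w) ≡ (a ⊙ z) ⊞ (a ⊙ w)
  ⊙-distribˡ a []      []      = refl
  ⊙-distribˡ a (x ∷ z) (y ∷ w) = cong₂ _∷_ (*ᶠ-distribˡ a x y) (⊙-distribˡ a z w)

  ⊙-distribʳ : ∀ {r} a b (z : V r) → (a +ᶠ b) ⊙ z ≡ (a ⊙ z) ⊞ (b ⊙ z)
  ⊙-distribʳ a b []      = refl
  ⊙-distribʳ a b (x ∷ z) = cong₂ _∷_ (*ᶠ-distribʳ x a b) (⊙-distribʳ a b z)

  ⊙-assoc : ∀ {r} a b (z : V r) → a ⊙ (b ⊙ z) ≡ (a *ᶠ b) ⊙ z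
  ⊙-assoc a b []      = refl
  ⊙-assoc a b (x ∷ z) = cong₂ _∷_ (sym (*ᶠ-assoc a b x)) (⊙-assoc a b z)

  ⊙-zeroˡ : ∀ {r} (z : V r) → 0ᶠ ⊙ z ≡ 𝟎
  ⊙-zeroˡ []      = refl
  ⊙-zeroˡ (x ∷ z) = cong₂ _∷_ (*ᶠ-zeroˡ x) (⊙-zeroˡ z)

  ⊙-zeroʳ : ∀ {r} a → a ⊙ 𝟎 {r} ≡ 𝟎
  ⊙-zeroʳ {zero}  a = refl
  ⊙-zeroʳ {suc r} a = cong₂ _∷_ (*ᶠ-zeroʳ a) (⊙-zeroʳ a)

  ⊙-identityˡ : ∀ {r} (z : V r) → 1ᶠ ⊙ z ≡ z
  ⊙-identityˡ []      = refl
  ⊙-identityˡ (x ∷ z) = cong₂ _∷_ (*ᶠ-identityˡ x) (⊙-identityˡ z)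

  ⊞-⊙-inverse : ∀ {r} a (z : V r) → (a ⊙ z) ⊞ ((-ᶠ a) ⊙ z) ≡ 𝟎
  ⊞-⊙-inverse a z = trans (sym (⊙-distribʳ a (-ᶠ a) z)) (trans (cong (_⊙ z) (+ᶠ-inverseʳ a)) (⊙-zeroˡ z))

  ⊞-⊙-undo : ∀ {r} a (z u : V r) → (z ⊞ (a ⊙ u)) ⊞ ((-ᶠ a) ⊙ u) ≡ z
  ⊞-⊙-undo a z u = trans (⊞-assoc z _ _) (trans (cong (z ⊞_) (⊞-⊙-inverse a u)) (⊞-identityʳ z))

  _≟ᵛ_ : ∀ {r} (z w : V r) → Dec (z ≡ w)
  _≟ᵛ_ = Vec.≡-dec Fin._≟_

  along : ∀ {A B : Set} → (A → B) → (I : List A) → Vec B (length I)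
  along f []      = []
  along f (i ∷ I) = f i ∷ along f I

  along-cong : ∀ {A B : Set} {f g : A → B} → (∀ i → f i ≡ g i) → ∀ I → along f I ≡ along g I
  along-cong eq []      = refl
  along-cong eq (i ∷ I) = cong₂ _∷_ (eq i) (along-cong eq I)

  map-along : ∀ {A B C : Set} (f : B → C) (g : A → B) I → Vec.map f (along g I) ≡ along (f ∘ g) I
  map-along f g []      = refl
  map-along f g (i ∷ I) = cong (f (g i) ∷_) (map-along f g I)

  dot : ∀ {r} → V r → V r → Fin p
  dot []      []      = 0ᶠ
  dot (a ∷ y) (b ∷ z) = dot y z +ᶠ a *ᶠ b

  dot-⊞ : ∀ {r} (y z w : V r) → dot y (z ⊞ w) ≡ dot y z +ᶠ dot y w
  dot-⊞ []      []      []      = sym (+ᶠ-identityˡ 0ᶠ)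
  dot-⊞ (a ∷ y) (b ∷ z) (c ∷ w) = trans (cong₂ _+ᶠ_ (dot-⊞ y z w) (*ᶠ-distribˡ a b c))
    (+ᶠ-interchange _ _ _ _)

  dot-⊙ : ∀ {r} c (y z : V r) → dot y (c ⊙ z) ≡ c *ᶠ dot y z
  dot-⊙ c []      []      = sym (*ᶠ-zeroʳ c)
  dot-⊙ c (a ∷ y) (b ∷ z) = trans (cong₂ _+ᶠ_ (dot-⊙ c y z)
      (trans (sym (*ᶠ-assoc a c b)) (trans (cong (_*ᶠ b) (*ᶠ-comm a c)) (*ᶠ-assoc c a b))))
    (sym (*ᶠ-distribˡ c _ _))

  dot-𝟎 : ∀ {r} (y : V r) → dot y 𝟎 ≡ 0ᶠ
  dot-𝟎 []      = refl
  dot-𝟎 (a ∷ y) = trans (cong₂ _+ᶠ_ (dot-𝟎 y) (*ᶠ-zeroʳ a)) (+ᶠ-identityˡ 0ᶠ)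

  -- An indexed family rather than a list of vectors: the indices are `Vec Bool r` for the columns
  -- and `Fin r` for the rows of a matrix, and a basis of the rows has to remember which rows it
  -- consists of.
  module Family {A : Set} {r : ℕ} (g : A → V r) where

    comb : (B : List A) → V (length B) → V r
    comb []      []      = 𝟎
    comb (u ∷ B) (a ∷ y) = comb B y ⊞ (a ⊙ g u)

    -- One coefficient is searched for at a time, which makes membership decidable over a finite
    -- field and matches the averaging in `solvable`. The witness `a` is minus the coefficient of
    -- `u`.
    Span : List A → V r → Set
    Span []      z = z ≡ 𝟎
    Span (u ∷ B) z = ∃[ a ] Span B (z ⊞ (a ⊙ g u))

    span? : ∀ B → Decidable (Span B)
    span? []      z = z ≟ᵛ 𝟎
    span? (u ∷ B) z = Fin.any? λ a → span? B (z ⊞ (a ⊙ g u))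

    span-𝟎 : ∀ B → Span B 𝟎
    span-𝟎 []      = refl
    span-𝟎 (u ∷ B) = 0ᶠ , subst (Span B) (sym (trans (cong (𝟎 ⊞_) (⊙-zeroˡ (g u))) (⊞-identityʳ 𝟎))) (span-𝟎 B)

    span-⊞ : ∀ B {z w} → Span B z → Span B w → Span B (z ⊞ w)
    span-⊞ []      refl refl = ⊞-identityʳ 𝟎
    span-⊞ (u ∷ B) {z} {w} (a , s) (b , t) = a +ᶠ b , subst (Span B)
      (trans (⊞-interchange z (a ⊙ g u) w (b ⊙ g u)) (cong ((z ⊞ w) ⊞_) (sym (⊙-distribʳ a b (g u)))))
      (span-⊞ B s t)

    span-⊙ : ∀ B c {z} → Span B z → Span B (c ⊙ z)
    span-⊙ []      c refl = ⊙-zeroʳ c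
    span-⊙ (u ∷ B) c {z} (a , s) = c *ᶠ a , subst (Span B)
      (trans (⊙-distribˡ c z (a ⊙ g u)) (cong ((c ⊙ z) ⊞_) (⊙-assoc c a (g u)))) (span-⊙ B c s)

    span-weaken : ∀ u B {z} → Span B z → Span (u ∷ B) z
    span-weaken u B {z} s = 0ᶠ , subst (Span B) (sym (trans (cong (z ⊞_) (⊙-zeroˡ (g u))) (⊞-identityʳ z))) s

    span-head : ∀ u B → Span (u ∷ B) (g u)
    span-head u B = -ᶠ 1ᶠ , subst (Span B)
      (trans (sym (⊞-⊙-inverse 1ᶠ (g u))) (cong (_⊞ ((-ᶠ 1ᶠ) ⊙ g u)) (⊙-identityˡ (g u)))) (span-𝟎 B)

    span-undo : ∀ B {u z} a → Span B (g u) → Span B (z ⊞ (a ⊙ g u)) → Span B z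
    span-undo B {u} {z} a s t = subst (Span B) (⊞-⊙-undo a z (g u)) (span-⊞ B t (span-⊙ B (-ᶠ a) s))

    -- Subtracting the two memberships leaves `(a - b) ⊙ g u` in the span; if `a - b` were nonzero,
    -- dividing by it would put `g u` there.
    span-unique : ∀ B {u z a b} → ¬ Span B (g u) → Span B (z ⊞ (a ⊙ g u)) → Span B (z ⊞ (b ⊙ g u)) → a ≡ b
    span-unique B {u} {z} {a} {b} ¬s s t with (a +ᶠ (-ᶠ b)) Fin.≟ 0ᶠ
    ... | yes eq = +ᶠ-cancelʳ a b (-ᶠ b) (trans eq (sym (+ᶠ-inverseʳ b)))
    ... | no neq with *ᶠ-inverse _ neq
    ...   | c , eq = contradiction (subst (Span B)
              (trans (⊙-assoc c _ (g u)) (trans (cong (_⊙ g u) eq) (⊙-identityˡ (g u)))) (span-⊙ B c difference)) ¬s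
      where
      m = -ᶠ 1ᶠ
      neg : ∀ x → m *ᶠ x ≡ -ᶠ x
      neg x = +ᶠ-cancelʳ _ _ x (trans (cong (m *ᶠ x +ᶠ_) (sym (*ᶠ-identityˡ x)))
        (trans (sym (*ᶠ-distribʳ x m 1ᶠ)) (trans (cong (_*ᶠ x) (trans (+ᶠ-comm m 1ᶠ) (+ᶠ-inverseʳ 1ᶠ)))
          (trans (*ᶠ-zeroˡ x) (trans (sym (+ᶠ-inverseʳ x)) (+ᶠ-comm x (-ᶠ x)))))))
      difference : Span B ((a +ᶠ (-ᶠ b)) ⊙ g u)
      difference = subst (Span B) (begin
        (z ⊞ (a ⊙ g u)) ⊞ (m ⊙ (z ⊞ (b ⊙ g u)))
          ≡⟨ cong ((z ⊞ (a ⊙ g u)) ⊞_) (⊙-distribˡ m z (b ⊙ g u)) ⟩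
        (z ⊞ (a ⊙ g u)) ⊞ ((m ⊙ z) ⊞ (m ⊙ (b ⊙ g u)))
          ≡⟨ ⊞-interchange z (a ⊙ g u) (m ⊙ z) (m ⊙ (b ⊙ g u)) ⟩
        (z ⊞ (m ⊙ z)) ⊞ ((a ⊙ g u) ⊞ (m ⊙ (b ⊙ g u)))
          ≡⟨ cong₂ _⊞_ (trans (cong (_⊞ (m ⊙ z)) (sym (⊙-identityˡ z))) (⊞-⊙-inverse 1ᶠ z))
                       (cong ((a ⊙ g u) ⊞_) (trans (⊙-assoc m b (g u)) (cong (_⊙ g u) (neg b)))) ⟩
        𝟎 ⊞ ((a ⊙ g u) ⊞ ((-ᶠ b) ⊙ g u)) ≡⟨ ⊞-identityˡ _ ⟩
        (a ⊙ g u) ⊞ ((-ᶠ b) ⊙ g u) ≡⟨ sym (⊙-distribʳ a (-ᶠ b) (g u)) ⟩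
        (a +ᶠ (-ᶠ b)) ⊙ g u ∎) (span-⊞ B s (span-⊙ B m t))

    span⇒comb : ∀ B {z} → Span B z → ∃[ y ] z ≡ comb B y
    span⇒comb []      refl = [] , refl
    span⇒comb (u ∷ B) {z} (a , s) with span⇒comb B s
    ... | y , eq = (-ᶠ a) ∷ y , trans (sym (⊞-⊙-undo a z (g u))) (cong (_⊞ ((-ᶠ a) ⊙ g u)) eq)

    comb⇒span : ∀ B y → Span B (comb B y)
    comb⇒span []      []      = refl
    comb⇒span (u ∷ B) (a ∷ y) = span-⊞ (u ∷ B) (span-weaken u B (comb⇒span B y))
                                  (span-⊙ (u ∷ B) a (span-head u B))

    Independent : List A → Set
    Independent []      = Unit
    Independent (u ∷ B) = ¬ Span B (g u) × Independent B

    comb-injective : ∀ B → Independent B → ∀ y y′ → comb B y ≡ comb B y′ → y ≡ y′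
    comb-injective []      _ []      []       eq = refl
    comb-injective (u ∷ B) (¬s , ind) (a ∷ y) (a′ ∷ y′) eq
      with span-unique B {u} {comb B y ⊞ (a ⊙ g u)} { -ᶠ a} { -ᶠ a′} ¬s
        (subst (Span B) (sym (⊞-⊙-undo a (comb B y) (g u))) (comb⇒span B y))
        (subst (Span B) (sym (trans (cong (_⊞ ((-ᶠ a′) ⊙ g u)) eq) (⊞-⊙-undo a′ (comb B y′) (g u)))) (comb⇒span B y′))
    ... | -a≡-a′ with +ᶠ-cancelʳ a a′ (-ᶠ a) (trans (+ᶠ-inverseʳ a) (trans (sym (+ᶠ-inverseʳ a′)) (cong (a′ +ᶠ_) (sym -a≡-a′))))
    ...   | refl = cong (a ∷_) (comb-injective B ind y y′ (begin
      comb B y ≡⟨ sym (⊞-⊙-undo a (comb B y) (g u)) ⟩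
      (comb B y ⊞ (a ⊙ g u)) ⊞ ((-ᶠ a) ⊙ g u) ≡⟨ cong (_⊞ ((-ᶠ a) ⊙ g u)) eq ⟩
      (comb B y′ ⊞ (a ⊙ g u)) ⊞ ((-ᶠ a) ⊙ g u) ≡⟨ ⊞-⊙-undo a (comb B y′) (g u) ⟩
      comb B y′ ∎))

    -- Counting replaces the exchange lemma: `p ^ length B` coefficient vectors inject into `p ^ r`
    -- vectors.
    independent-length : 1 ℕ.< p → ∀ B → Independent B → length B ℕ.≤ r
    independent-length 1<p B ind = ℕ.≮⇒≥ λ r<B → ℕ.<⇒≱ (ℕ.^-monoʳ-< p 1<p r<B)
      (subst₂ ℕ._≤_ (size (length B)) (size r)
        (injection-length (comb B) (vecs (allFin p) (length B)) (vecs-unique (Unique.allFin⁺ p) (length B))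
          (λ y _ → ∈-vecs ∈-allFin (comb B y)) (λ y y′ _ _ → comb-injective B ind y y′)))
      where
      size : ∀ k → length (vecs (allFin p) k) ≡ p ℕ.^ k
      size k = trans (length-vecs (allFin p) k) (cong (ℕ._^ k) (List.length-tabulate {n = p} id))

    -- Selection runs from the end of the list, so a nonzero last vector always survives;
    -- `basis-trues` depends on this.
    basis : List A → List A
    basis []       = []
    basis (u ∷ us) with span? (basis us) (g u)
    ... | yes _ = basis us
    ... | no  _ = u ∷ basis us

    basis-new : ∀ {u us} → ¬ Span (basis us) (g u) → basis (u ∷ us) ≡ u ∷ basis us
    basis-new {u} {us} ¬s with span? (basis us) (g u)
    ... | yes s = contradiction s ¬s
    ... | no  _ = refl

    basis-old : ∀ {u us} → Span (basis us) (g u) → basis (u ∷ us) ≡ basis us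
    basis-old {u} {us} s with span? (basis us) (g u)
    ... | yes _ = refl
    ... | no ¬s = contradiction s ¬s

    basis-independent : ∀ us → Independent (basis us)
    basis-independent []       = _
    basis-independent (u ∷ us) with span? (basis us) (g u)
    ... | yes _ = basis-independent us
    ... | no ¬s = ¬s , basis-independent us

    basis-⊆ : ∀ us {u} → u ∈ basis us → u ∈ us
    basis-⊆ (v ∷ us) u∈ with span? (basis us) (g v)
    ... | yes _ = there (basis-⊆ us u∈)
    basis-⊆ (v ∷ us) (here eq)  | no _ = here eq
    basis-⊆ (v ∷ us) (there u∈) | no _ = there (basis-⊆ us u∈)

    basis-spans : ∀ us {u} → u ∈ us → Span (basis us) (g u)
    basis-spans (v ∷ us) u∈ with span? (basis us) (g v)
    basis-spans (v ∷ us) (here refl) | yes s = s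
    basis-spans (v ∷ us) (there u∈)  | yes s = basis-spans us u∈
    basis-spans (v ∷ us) (here refl) | no _  = span-head v (basis us)
    basis-spans (v ∷ us) (there u∈)  | no _  = span-weaken v (basis us) (basis-spans us u∈)

    lookup-comb : ∀ B y i → lookup (comb B y) i ≡ dot y (along (λ u → lookup (g u) i) B)
    lookup-comb []      []      i = Vec.lookup-replicate i 0ᶠ
    lookup-comb (u ∷ B) (a ∷ y) i = trans (Vec.lookup-zipWith _+ᶠ_ i (comb B y) (a ⊙ g u))
      (cong₂ _+ᶠ_ (lookup-comb B y i) (Vec.lookup-map i (a *ᶠ_) (g u)))

    dot-comb : ∀ w B y → dot w (comb B y) ≡ dot y (along (λ u → dot w (g u)) B)
    dot-comb w []      []      = dot-𝟎 w
    dot-comb w (u ∷ B) (a ∷ y) = trans (dot-⊞ w (comb B y) (a ⊙ g u))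
      (cong₂ _+ᶠ_ (dot-comb w B y) (dot-⊙ a w (g u)))

-- Points of the discrete cube in a subspace

count : ∀ {A : Set} {P : A → Set} → Decidable P → List A → ℕ
count P? xs = length (filter P? xs)

count-++ : ∀ {A : Set} {P : A → Set} (P? : Decidable P) xs ys →
  count P? (xs ++ ys) ≡ count P? xs ℕ.+ count P? ys
count-++ P? xs ys = trans (cong length (List.filter-++ P? xs ys)) (List.length-++ (filter P? xs))

count-map : ∀ {A B : Set} {P : B → Set} (P? : Decidable P) (φ : A → B) xs →
  count P? (List.map φ xs) ≡ count (P? ∘ φ) xs
count-map P? φ []       = refl
count-map P? φ (x ∷ xs) with P? (φ x)
... | yes _ = cong suc (count-map P? φ xs)
... | no  _ = count-map P? φ xs

count-bools : ∀ {k} {P : Vec Bool (suc k) → Set} (P? : Decidable P) →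
  count P? (vecs bools (suc k)) ≡
    count (P? ∘ (true ∷_)) (vecs bools k) ℕ.+ count (P? ∘ (false ∷_)) (vecs bools k)
count-bools {k} P? = trans (count-++ P? (List.map (true ∷_) vs) _)
  (cong₂ ℕ._+_ (count-map P? (true ∷_) vs)
    (trans (count-++ P? (List.map (false ∷_) vs) []) (trans (ℕ.+-identityʳ _) (count-map P? (false ∷_) vs))))
  where vs = vecs bools k

preimages : ∀ {A B : Set} (φ : A → B) {xs : List A} (P : List B) → (∀ {q} → q ∈ P → q ∈ List.map φ xs) →
  ∃[ I ] List.map φ I ≡ P
preimages φ []      ⊆xs = [] , refl
preimages φ (q ∷ P) ⊆xs with ∈-map⁻ φ (⊆xs (here refl)) | preimages φ P (⊆xs ∘ there)
... | x , _ , eq | I , eqs = x ∷ I , cong₂ _∷_ (sym eq) eqs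

module CubePoints {p : ℕ} (𝔽 : FieldOn p) (1<p : 1 ℕ.< p)
                  (1+1≢0 : FieldOn._+ᶠ_ 𝔽 (FieldOn.1ᶠ 𝔽) (FieldOn.1ᶠ 𝔽) ≢ FieldOn.0ᶠ 𝔽) where

  open FieldOn 𝔽
  open LinearAlgebra 𝔽

  bit : Bool → Fin p
  bit true  = 1ᶠ
  bit false = 0ᶠ

  bit-injective : ∀ a b → bit a ≡ bit b → a ≡ b
  bit-injective true  true  eq = refl
  bit-injective true  false eq = contradiction eq 1≢0
  bit-injective false true  eq = contradiction (sym eq) 1≢0
  bit-injective false false eq = refl

  emb : ∀ {r} → Vec Bool r → V r
  emb = Vec.map bit

  Bit : Fin p → Set
  Bit z = z ≡ 0ᶠ ⊎ z ≡ 1ᶠ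

  bit? : Decidable Bit
  bit? z with z Fin.≟ 0ᶠ
  ... | yes z≡0 = yes (inj₁ z≡0)
  ... | no  z≢0 with z Fin.≟ 1ᶠ
  ...   | yes z≡1 = yes (inj₂ z≡1)
  ...   | no  z≢1 = no λ { (inj₁ z≡0) → z≢0 z≡0 ; (inj₂ z≡1) → z≢1 z≡1 }

  bit-Bit : ∀ b → Bit (bit b)
  bit-Bit true  = inj₂ refl
  bit-Bit false = inj₁ refl

  χ : Fin p → ℕ
  χ z with bit? z
  ... | yes _ = 1
  ... | no  _ = 0

  -- The number counted in `count-hits`, with one cube coordinate split off at a time, so that
  -- estimates can translate `z` by single coefficients.
  hits : ∀ {k} → V k → Fin p → ℕ
  hits []      z = χ z
  hits (c ∷ cs) z = hits cs (z +ᶠ c) ℕ.+ hits cs z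

  count-hits : ∀ {k} (c : V k) z → count (λ w → bit? (z +ᶠ dot c (emb w))) (vecs bools k) ≡ hits c z
  count-hits [] z rewrite +ᶠ-identityʳ z with bit? z
  ... | yes _ = refl
  ... | no  _ = refl
  count-hits {suc k} (c ∷ cs) z = trans (count-bools (λ w → bit? (z +ᶠ dot (c ∷ cs) (emb w))))
    (cong₂ ℕ._+_ (trans (count-cong _ _ true-case) (count-hits cs (z +ᶠ c)))
                 (trans (count-cong _ _ false-case) (count-hits cs z)))
    where
    count-cong : (φ ψ : Vec Bool k → Fin p) → (∀ w → φ w ≡ ψ w) →
      count (λ w → bit? (φ w)) (vecs bools k) ≡ count (λ w → bit? (ψ w)) (vecs bools k)
    count-cong φ ψ eq = cong length (List.filter-≐ (λ w → bit? (φ w)) (λ w → bit? (ψ w))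
      ((λ {w} → subst Bit (eq w)) , λ {w} → subst Bit (sym (eq w))) (vecs bools k))
    true-case : ∀ w → z +ᶠ (dot cs (emb w) +ᶠ c *ᶠ 1ᶠ) ≡ (z +ᶠ c) +ᶠ dot cs (emb w)
    true-case w = trans (cong (z +ᶠ_) (trans (cong (dot cs (emb w) +ᶠ_) (*ᶠ-identityʳ c)) (+ᶠ-comm _ c)))
      (sym (+ᶠ-assoc z c (dot cs (emb w))))
    false-case : ∀ w → z +ᶠ (dot cs (emb w) +ᶠ c *ᶠ 0ᶠ) ≡ z +ᶠ dot cs (emb w)
    false-case w = cong (z +ᶠ_) (trans (cong (dot cs (emb w) +ᶠ_) (*ᶠ-zeroʳ c)) (+ᶠ-identityʳ _))

  -- From a point of {0, 1} there is only one other point to move to, so `a` and `b` coincide and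
  -- the second step returns to `u`: `b + b = 0`. This is where characteristic 2 has to be excluded.
  no-parallelogram : ∀ {a b} u → a ≢ 0ᶠ → b ≢ 0ᶠ →
    Bit u → Bit (u +ᶠ a) → Bit (u +ᶠ b) → Bit ((u +ᶠ a) +ᶠ b) → ⊥
  no-parallelogram {a} {b} u a≢0 b≢0 u∈ ua∈ ub∈ uab∈ = 1+1≢0 (two b≢0 2b≡0)
    where
    other : ∀ {x y z} → Bit x → Bit y → Bit z → y ≢ x → z ≢ x → y ≡ z
    other (inj₁ refl) (inj₁ refl) z∈ y≢x z≢x = contradiction refl y≢x
    other (inj₁ refl) (inj₂ refl) (inj₁ refl) y≢x z≢x = contradiction refl z≢x
    other (inj₁ refl) (inj₂ refl) (inj₂ refl) y≢x z≢x = refl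
    other (inj₂ refl) (inj₂ refl) z∈ y≢x z≢x = contradiction refl y≢x
    other (inj₂ refl) (inj₁ refl) (inj₂ refl) y≢x z≢x = contradiction refl z≢x
    other (inj₂ refl) (inj₁ refl) (inj₁ refl) y≢x z≢x = refl
    moved : ∀ {c} v → c ≢ 0ᶠ → v +ᶠ c ≢ v
    moved {c} v c≢0 eq = c≢0 (+ᶠ-cancelˡ c 0ᶠ v (trans eq (sym (+ᶠ-identityʳ v))))
    a≡b : a ≡ b
    a≡b = +ᶠ-cancelˡ a b u (other u∈ ua∈ ub∈ (moved u a≢0) (moved u b≢0))
    back : (u +ᶠ a) +ᶠ b ≡ u
    back = other ua∈ uab∈ u∈ (moved (u +ᶠ a) b≢0) (λ eq → moved u a≢0 (sym eq))
    2b≡0 : b +ᶠ b ≡ 0ᶠ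
    2b≡0 = +ᶠ-cancelˡ (b +ᶠ b) 0ᶠ u (trans (sym (+ᶠ-assoc u b b))
      (trans (cong (λ a → (u +ᶠ a) +ᶠ b) (sym a≡b)) (trans back (sym (+ᶠ-identityʳ u)))))
    two : ∀ {c} → c ≢ 0ᶠ → c +ᶠ c ≡ 0ᶠ → 1ᶠ +ᶠ 1ᶠ ≡ 0ᶠ
    two {c} c≢0 2c≡0 with *ᶠ-inverse c c≢0
    ... | d , eq = trans (cong₂ _+ᶠ_ (sym eq) (sym eq))
      (trans (sym (*ᶠ-distribˡ d c c)) (trans (cong (d *ᶠ_) 2c≡0) (*ᶠ-zeroʳ d)))

  double : ∀ k → 3 ℕ.* 2 ℕ.^ k ℕ.+ 3 ℕ.* 2 ℕ.^ k ≡ 3 ℕ.* 2 ℕ.^ suc k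
  double k = solveⁿ 1 (λ x → conⁿ 3 :*ⁿ x :+ⁿ conⁿ 3 :*ⁿ x :=ⁿ conⁿ 3 :*ⁿ (conⁿ 2 :*ⁿ x)) refl (2 ℕ.^ k)

  -- Without further coordinates at most three of the four corners lie in {0, 1}; each further
  -- coordinate replaces the parallelogram by itself and a translate.
  hits-parallelogram : ∀ {a b} → a ≢ 0ᶠ → b ≢ 0ᶠ → ∀ {k} (cs : V k) u →
    (hits cs ((u +ᶠ a) +ᶠ b) ℕ.+ hits cs (u +ᶠ a)) ℕ.+ (hits cs (u +ᶠ b) ℕ.+ hits cs u) ℕ.≤ 3 ℕ.* 2 ℕ.^ k
  hits-parallelogram {a} {b} a≢0 b≢0 [] u
    with bit? u | bit? (u +ᶠ a) | bit? (u +ᶠ b) | bit? ((u +ᶠ a) +ᶠ b)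
  ... | yes u∈ | yes ua∈ | yes ub∈ | yes uab∈ = ⊥-elim (no-parallelogram u a≢0 b≢0 u∈ ua∈ ub∈ uab∈)
  ... | no _   | no _    | no _    | no _  = z≤n
  ... | no _   | no _    | no _    | yes _ = s≤s z≤n
  ... | no _   | no _    | yes _   | no _  = s≤s z≤n
  ... | no _   | no _    | yes _   | yes _ = s≤s (s≤s z≤n)
  ... | no _   | yes _   | no _    | no _  = s≤s z≤n
  ... | no _   | yes _   | no _    | yes _ = s≤s (s≤s z≤n)
  ... | no _   | yes _   | yes _   | no _  = s≤s (s≤s z≤n)
  ... | no _   | yes _   | yes _   | yes _ = ℕ.≤-refl
  ... | yes _  | no _    | no _    | no _  = s≤s z≤n
  ... | yes _  | no _    | no _    | yes _ = s≤s (s≤s z≤n)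
  ... | yes _  | no _    | yes _   | no _  = s≤s (s≤s z≤n)
  ... | yes _  | no _    | yes _   | yes _ = ℕ.≤-refl
  ... | yes _  | yes _   | no _    | no _  = s≤s (s≤s z≤n)
  ... | yes _  | yes _   | no _    | yes _ = ℕ.≤-refl
  ... | yes _  | yes _   | yes _   | no _  = ℕ.≤-refl
  hits-parallelogram {a} {b} a≢0 b≢0 {suc k} (c ∷ cs) u = begin
    (N (((u +ᶠ a) +ᶠ b) +ᶠ c) ℕ.+ N ((u +ᶠ a) +ᶠ b) ℕ.+ (N ((u +ᶠ a) +ᶠ c) ℕ.+ N (u +ᶠ a)))
      ℕ.+ (N ((u +ᶠ b) +ᶠ c) ℕ.+ N (u +ᶠ b) ℕ.+ (N (u +ᶠ c) ℕ.+ N u))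
      ≡⟨ cong₂ ℕ._+_ (cong₂ ℕ._+_ (cong (λ z → N z ℕ.+ N ((u +ᶠ a) +ᶠ b)) eqab)
                                   (cong (λ z → N z ℕ.+ N (u +ᶠ a)) (+ᶠ-swap u a c)))
                     (cong (λ z → N z ℕ.+ N (u +ᶠ b) ℕ.+ (N (u +ᶠ c) ℕ.+ N u)) (+ᶠ-swap u b c)) ⟩
    (N (((u +ᶠ c) +ᶠ a) +ᶠ b) ℕ.+ N ((u +ᶠ a) +ᶠ b) ℕ.+ (N ((u +ᶠ c) +ᶠ a) ℕ.+ N (u +ᶠ a)))
      ℕ.+ (N ((u +ᶠ c) +ᶠ b) ℕ.+ N (u +ᶠ b) ℕ.+ (N (u +ᶠ c) ℕ.+ N u))
      ≡⟨ solveⁿ 8 (λ a b c d e f g h → 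
           (((a :+ⁿ b) :+ⁿ (c :+ⁿ d)) :+ⁿ ((e :+ⁿ f) :+ⁿ (g :+ⁿ h))) :=ⁿ (((a :+ⁿ c) :+ⁿ (e :+ⁿ g)) :+ⁿ ((b :+ⁿ d) :+ⁿ (f :+ⁿ h)))) refl
           (N (((u +ᶠ c) +ᶠ a) +ᶠ b)) (N ((u +ᶠ a) +ᶠ b)) (N ((u +ᶠ c) +ᶠ a)) (N (u +ᶠ a))
           (N ((u +ᶠ c) +ᶠ b)) (N (u +ᶠ b)) (N (u +ᶠ c)) (N u) ⟩
    ((N (((u +ᶠ c) +ᶠ a) +ᶠ b) ℕ.+ N ((u +ᶠ c) +ᶠ a)) ℕ.+ (N ((u +ᶠ c) +ᶠ b) ℕ.+ N (u +ᶠ c)))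
      ℕ.+ ((N ((u +ᶠ a) +ᶠ b) ℕ.+ N (u +ᶠ a)) ℕ.+ (N (u +ᶠ b) ℕ.+ N u))
      ≤⟨ ℕ.+-mono-≤ (hits-parallelogram a≢0 b≢0 cs (u +ᶠ c)) (hits-parallelogram a≢0 b≢0 cs u) ⟩
    3 ℕ.* 2 ℕ.^ k ℕ.+ 3 ℕ.* 2 ℕ.^ k ≡⟨ double k ⟩
    3 ℕ.* 2 ℕ.^ suc k ∎
    where
    open ℕ.≤-Reasoning
    N = hits cs
    eqab : ((u +ᶠ a) +ᶠ b) +ᶠ c ≡ ((u +ᶠ c) +ᶠ a) +ᶠ b
    eqab = trans (+ᶠ-swap (u +ᶠ a) b c) (cong (_+ᶠ b) (+ᶠ-swap u a c))

  data NonZeroEntry : ∀ {k} → V k → Set where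
    here  : ∀ {k c} {cs : V k} → c ≢ 0ᶠ → NonZeroEntry (c ∷ cs)
    there : ∀ {k c} {cs : V k} → NonZeroEntry cs → NonZeroEntry (c ∷ cs)

  data TwoNonZeroEntries : ∀ {k} → V k → Set where
    here  : ∀ {k c} {cs : V k} → c ≢ 0ᶠ → NonZeroEntry cs → TwoNonZeroEntries (c ∷ cs)
    there : ∀ {k c} {cs : V k} → TwoNonZeroEntries cs → TwoNonZeroEntries (c ∷ cs)

  -- The marked nonzero entry of `cs` provides the second side of a parallelogram; the entries in
  -- front of it only average over translates.
  hits-pair : ∀ {a k} {cs : V k} → a ≢ 0ᶠ → NonZeroEntry cs → ∀ u →
    2 ℕ.* (hits cs (u +ᶠ a) ℕ.+ hits cs u) ℕ.≤ 3 ℕ.* 2 ℕ.^ k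
  hits-pair {a} {suc k} {c ∷ cs} a≢0 (here c≢0) u = begin
    2 ℕ.* ((N ((u +ᶠ a) +ᶠ c) ℕ.+ N (u +ᶠ a)) ℕ.+ (N (u +ᶠ c) ℕ.+ N u))
      ≤⟨ ℕ.*-monoʳ-≤ 2 (hits-parallelogram a≢0 c≢0 cs u) ⟩
    2 ℕ.* (3 ℕ.* 2 ℕ.^ k) ≡⟨ solveⁿ 1 (λ x → conⁿ 2 :*ⁿ (conⁿ 3 :*ⁿ x) :=ⁿ conⁿ 3 :*ⁿ (conⁿ 2 :*ⁿ x)) refl (2 ℕ.^ k) ⟩
    3 ℕ.* 2 ℕ.^ suc k ∎
    where
    open ℕ.≤-Reasoning
    N = hits cs
  hits-pair {a} {suc k} {c ∷ cs} a≢0 (there nz) u = begin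
    2 ℕ.* ((N ((u +ᶠ a) +ᶠ c) ℕ.+ N (u +ᶠ a)) ℕ.+ (N (u +ᶠ c) ℕ.+ N u))
      ≡⟨ cong (λ z → 2 ℕ.* ((N z ℕ.+ N (u +ᶠ a)) ℕ.+ (N (u +ᶠ c) ℕ.+ N u))) (+ᶠ-swap u a c) ⟩
    2 ℕ.* ((N ((u +ᶠ c) +ᶠ a) ℕ.+ N (u +ᶠ a)) ℕ.+ (N (u +ᶠ c) ℕ.+ N u))
      ≡⟨ solveⁿ 4 (λ a b c d → 
           conⁿ 2 :*ⁿ ((a :+ⁿ b) :+ⁿ (c :+ⁿ d)) :=ⁿ conⁿ 2 :*ⁿ (a :+ⁿ c) :+ⁿ conⁿ 2 :*ⁿ (b :+ⁿ d)) refl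
           (N ((u +ᶠ c) +ᶠ a)) (N (u +ᶠ a)) (N (u +ᶠ c)) (N u) ⟩
    2 ℕ.* (N ((u +ᶠ c) +ᶠ a) ℕ.+ N (u +ᶠ c)) ℕ.+ 2 ℕ.* (N (u +ᶠ a) ℕ.+ N u)
      ≤⟨ ℕ.+-mono-≤ (hits-pair a≢0 nz (u +ᶠ c)) (hits-pair a≢0 nz u) ⟩
    3 ℕ.* 2 ℕ.^ k ℕ.+ 3 ℕ.* 2 ℕ.^ k ≡⟨ double k ⟩
    3 ℕ.* 2 ℕ.^ suc k ∎
    where
    open ℕ.≤-Reasoning
    N = hits cs

  -- The two nonzero entries are the sides of the parallelogram, and the other coordinates average
  -- the proportion 3/4 over its translates.
  hits-bound : ∀ {k} {cs : V k} → TwoNonZeroEntries cs → ∀ u → 4 ℕ.* hits cs u ℕ.≤ 3 ℕ.* 2 ℕ.^ k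
  hits-bound {suc k} {c ∷ cs} (here c≢0 nz) u = begin
    4 ℕ.* (hits cs (u +ᶠ c) ℕ.+ hits cs u)
      ≡⟨ ℕ.*-assoc 2 2 (hits cs (u +ᶠ c) ℕ.+ hits cs u) ⟩
    2 ℕ.* (2 ℕ.* (hits cs (u +ᶠ c) ℕ.+ hits cs u)) ≤⟨ ℕ.*-monoʳ-≤ 2 (hits-pair c≢0 nz u) ⟩
    2 ℕ.* (3 ℕ.* 2 ℕ.^ k) ≡⟨ solveⁿ 1 (λ x → conⁿ 2 :*ⁿ (conⁿ 3 :*ⁿ x) :=ⁿ conⁿ 3 :*ⁿ (conⁿ 2 :*ⁿ x)) refl (2 ℕ.^ k) ⟩
    3 ℕ.* 2 ℕ.^ suc k ∎
    where open ℕ.≤-Reasoning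
  hits-bound {suc k} {c ∷ cs} (there t) u = begin
    4 ℕ.* (hits cs (u +ᶠ c) ℕ.+ hits cs u) ≡⟨ ℕ.*-distribˡ-+ 4 (hits cs (u +ᶠ c)) (hits cs u) ⟩
    4 ℕ.* hits cs (u +ᶠ c) ℕ.+ 4 ℕ.* hits cs u ≤⟨ ℕ.+-mono-≤ (hits-bound t (u +ᶠ c)) (hits-bound t u) ⟩
    3 ℕ.* 2 ℕ.^ k ℕ.+ 3 ℕ.* 2 ℕ.^ k ≡⟨ double k ⟩
    3 ℕ.* 2 ℕ.^ suc k ∎
    where open ℕ.≤-Reasoning

  nonZeroEntry? : ∀ {k} (c : V k) → NonZeroEntry c ⊎ c ≡ 𝟎
  nonZeroEntry? []       = inj₂ refl
  nonZeroEntry? (c ∷ cs) with c Fin.≟ 0ᶠ | nonZeroEntry? cs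
  ... | no c≢0   | _         = inj₁ (here c≢0)
  ... | yes _    | inj₁ nz   = inj₁ (there nz)
  ... | yes refl | inj₂ refl = inj₂ refl

  -- The coordinate t forces the coefficients of z to add up to 1, so a single nonzero
  -- coefficient would have to be 1.
  module _ {A : Set} {r : ℕ} (g : A → V r) where

    open Family g

    comb-𝟎 : ∀ B → comb B 𝟎 ≡ 𝟎
    comb-𝟎 []      = refl
    comb-𝟎 (u ∷ B) = trans (cong₂ _⊞_ (comb-𝟎 B) (⊙-zeroˡ (g u))) (⊞-identityʳ 𝟎)

    two-entries : ∀ t I (c : V (length I)) z → z ≡ comb I c → (∀ i → i ∈ I → z ≢ g i) →
      lookup z t ≡ 1ᶠ → (∀ i → lookup (g i) t ≡ 1ᶠ) → TwoNonZeroEntries c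
    two-entries t [] [] z refl z∉ zt gt = contradiction (trans (sym zt) (Vec.lookup-replicate t 0ᶠ)) 1≢0
    two-entries t (i ∷ I) (c ∷ cs) z eq z∉ zt gt with c Fin.≟ 0ᶠ | nonZeroEntry? cs
    ... | yes refl | _ = there (two-entries t I cs z
            (trans eq (trans (cong (comb I cs ⊞_) (⊙-zeroˡ (g i))) (⊞-identityʳ (comb I cs))))
            (λ j j∈ → z∉ j (there j∈)) zt gt)
    ... | no c≢0 | inj₁ nz = here c≢0 nz
    ... | no c≢0 | inj₂ refl = contradiction (trans z≡ (trans (cong (_⊙ g i) c≡1) (⊙-identityˡ (g i)))) (z∉ i (here refl))
      where
      z≡ : z ≡ c ⊙ g i
      z≡ = trans eq (trans (cong (_⊞ (c ⊙ g i)) (comb-𝟎 I)) (⊞-identityˡ (c ⊙ g i)))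
      c≡1 : c ≡ 1ᶠ
      c≡1 = trans (sym (*ᶠ-identityʳ c)) (trans (cong (c *ᶠ_) (sym (gt i)))
        (trans (sym (Vec.lookup-map t (c *ᶠ_) (g i))) (trans (cong (λ w → lookup w t) (sym z≡)) zt)))

  module _ {r : ℕ} where

    open Family (emb {r})

    row : (B : List (Vec Bool r)) → Fin r → V (length B)
    row B i = along (λ u → lookup (emb u) i) B

    span-lookup : ∀ B {z} → Span B z → ∃[ y ] ∀ i → lookup z i ≡ dot y (row B i)
    span-lookup B s with span⇒comb B s
    ... | y , refl = y , lookup-comb B y

    -- Let I index a basis of the rows of B.  A 0/1 vector in the span is determined by its
    -- coordinates in I, and a further row outside I imposes a condition on them.
    cube-points : ∀ B → (∀ i j → row B i ≡ row B j → i ≡ j) → (∃[ t ] ∀ i → lookup (row B i) t ≡ 1ᶠ) →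
      length B ℕ.< r → 4 ℕ.* count (λ v → span? B (emb v)) (vecs bools r) ℕ.≤ 3 ℕ.* 2 ℕ.^ length B
    cube-points B row-injective (t , ones) B<r = begin
      4 ℕ.* count X? (vecs bools r) ≤⟨ ℕ.*-monoʳ-≤ 4 (injection-length φ (filter X? (vecs bools r))
                                         (Unique.filter⁺ X? (vecs-unique bools-unique r)) into injective) ⟩
      4 ℕ.* count W? (vecs bools (length I)) ≡⟨ cong (4 ℕ.*_) (count-hits c 0ᶠ) ⟩
      4 ℕ.* hits c 0ᶠ ≤⟨ hits-bound (two-entries (row B) t I c (row B i₀) i₀≡ i₀∉ (ones i₀) ones) 0ᶠ ⟩
      3 ℕ.* 2 ℕ.^ length I ≤⟨ ℕ.*-monoʳ-≤ 3 (ℕ.^-monoʳ-≤ 2 I≤B) ⟩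
      3 ℕ.* 2 ℕ.^ length B ∎
      where
      open ℕ.≤-Reasoning
      module R = Family (row B)
      X? : Decidable (λ v → Span B (emb v))
      X? v = span? B (emb v)
      I = R.basis (allFin r)
      I≤B : length I ℕ.≤ length B
      I≤B = R.independent-length 1<p I (R.basis-independent (allFin r))
      φ : Vec Bool r → Vec Bool (length I)
      φ v = along (lookup v) I
      -- Pigeonhole: the `r` rows are pairwise distinct, but `I` has at most `length B < r` members.
      outside-I : ∃[ i ] ¬ Any (λ j → row B i ≡ row B j) I
      outside-I = Fin.¬∀⟶∃¬ r _ (λ i → Any.any? (λ j → row B i ≟ᵛ row B j) I) λ all →
        ℕ.<⇒≱ (ℕ.≤-<-trans I≤B B<r) (subst₂ ℕ._≤_ (List.length-tabulate {n = r} id) (List.length-map (row B) I)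
          (injection-length (row B) (allFin r) {List.map (row B) I} (Unique.allFin⁺ r)
            (λ i _ → subst (_∈ List.map (row B) I) refl (any-map (all i))) (λ i j _ _ → row-injective i j)))
        where
        any-map : ∀ {z J} → Any (λ j → z ≡ row B j) J → z ∈ List.map (row B) J
        any-map (here eq)  = here eq
        any-map (there an) = there (any-map an)
      i₀ = proj₁ outside-I
      i₀∉ : ∀ i → i ∈ I → row B i₀ ≢ row B i
      i₀∉ i i∈ eq = proj₂ outside-I (Any.map (λ { refl → eq }) i∈)
      combination : ∀ i → ∃[ c ] row B i ≡ R.comb I c
      combination i = R.span⇒comb I (R.basis-spans (allFin r) (∈-allFin i))
      c = proj₁ (combination i₀)
      i₀≡ = proj₂ (combination i₀)
      -- Coordinate `i` of a vector in the span of `B` is a linear functional of row `i`, hence the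
      -- same combination of the coordinates in `I` as row `i` is of the basis rows.
      lookup-φ : ∀ {v} → Span B (emb v) → ∀ i → bit (lookup v i) ≡ dot (proj₁ (combination i)) (emb (φ v))
      lookup-φ {v} s i with span-lookup B s
      ... | y , v≡ = trans (v-row i) (trans (cong (dot y) (proj₂ (combination i)))
          (trans (R.dot-comb y I d) (cong (dot d) (trans (along-cong (λ j → sym (v-row j)) I)
            (sym (map-along bit (lookup v) I))))))
        where
        d = proj₁ (combination i)
        v-row : ∀ j → bit (lookup v j) ≡ dot y (row B j)
        v-row j = trans (sym (Vec.lookup-map j bit v)) (v≡ j)
      W? : Decidable (λ (w : Vec Bool (length I)) → Bit (0ᶠ +ᶠ dot c (emb w)))
      W? w = bit? (0ᶠ +ᶠ dot c (emb w))
      into : ∀ v → v ∈ filter X? (vecs bools r) → φ v ∈ filter W? (vecs bools (length I))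
      into v v∈ = ∈-filter⁺ W? (∈-vecs ∈-bools (φ v))
        (subst Bit (trans (lookup-φ {v} s i₀) (sym (+ᶠ-identityˡ _))) (bit-Bit (lookup v i₀)))
        where s = proj₂ (∈-filter⁻ X? {xs = vecs bools r} v∈)
      injective : ∀ v w → v ∈ filter X? (vecs bools r) → w ∈ filter X? (vecs bools r) → φ v ≡ φ w → v ≡ w
      injective v w v∈ w∈ eq = lookup-ext λ i → bit-injective _ _ (trans (lookup-φ {v} (proj₂ (∈-filter⁻ X? {xs = vecs bools r} v∈)) i)
        (trans (cong (λ z → dot (proj₁ (combination i)) (emb z)) eq) (sym (lookup-φ {w} (proj₂ (∈-filter⁻ X? {xs = vecs bools r} w∈)) i))))
        where
        lookup-ext : ∀ {k} {v w : Vec Bool k} → (∀ i → lookup v i ≡ lookup w i) → v ≡ w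
        lookup-ext {v = []}    {[]}    eq = refl
        lookup-ext {v = _ ∷ _} {_ ∷ _} eq = cong₂ _∷_ (eq Fin.zero) (lookup-ext (eq ∘ Fin.suc))

-- Finite sums

module _ {A : Set} where

  sumOver : List A → (A → ℚ) → ℚ
  sumOver []       h = 0ℚ
  sumOver (x ∷ xs) h = h x + sumOver xs h

  sum-cong∈ : ∀ xs {h g : A → ℚ} → (∀ x → x ∈ xs → h x ≡ g x) → sumOver xs h ≡ sumOver xs g
  sum-cong∈ []       eq = refl
  sum-cong∈ (x ∷ xs) eq = cong₂ _+_ (eq x (here refl)) (sum-cong∈ xs λ y y∈ → eq y (there y∈))

  sum-cong : ∀ xs {h g : A → ℚ} → (∀ x → h x ≡ g x) → sumOver xs h ≡ sumOver xs g
  sum-cong xs eq = sum-cong∈ xs λ x _ → eq x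

  sum-mono∈ : ∀ xs {h g : A → ℚ} → (∀ x → x ∈ xs → h x ≤ g x) → sumOver xs h ≤ sumOver xs g
  sum-mono∈ []       le = ≤-refl
  sum-mono∈ (x ∷ xs) le = +-mono-≤ (le x (here refl)) (sum-mono∈ xs λ y y∈ → le y (there y∈))

  sum-mono : ∀ xs {h g : A → ℚ} → (∀ x → h x ≤ g x) → sumOver xs h ≤ sumOver xs g
  sum-mono xs le = sum-mono∈ xs λ x _ → le x

  sum-zero : ∀ xs → sumOver xs (λ _ → 0ℚ) ≡ 0ℚ
  sum-zero []       = refl
  sum-zero (x ∷ xs) = trans (+-identityˡ (sumOver xs (λ _ → 0ℚ))) (sum-zero xs)

  sum-nonNeg : ∀ xs {h : A → ℚ} → (∀ x → 0ℚ ≤ h x) → 0ℚ ≤ sumOver xs h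
  sum-nonNeg xs le = subst (_≤ sumOver xs _) (sum-zero xs) (sum-mono xs le)

  sum-+ : ∀ xs (h g : A → ℚ) → sumOver xs (λ x → h x + g x) ≡ sumOver xs h + sumOver xs g
  sum-+ []       h g = refl
  sum-+ (x ∷ xs) h g = trans (cong (h x + g x +_) (sum-+ xs h g))
    (solve 4 (λ a b c d → (a :+ b) :+ (c :+ d) := (a :+ c) :+ (b :+ d)) refl (h x) (g x) (sumOver xs h) (sumOver xs g))

  sum-* : ∀ xs c (h : A → ℚ) → sumOver xs (λ x → c * h x) ≡ c * sumOver xs h
  sum-* []       c h = sym (*-zeroʳ c)
  sum-* (x ∷ xs) c h = trans (cong (c * h x +_) (sum-* xs c h)) (sym (*-distribˡ-+ c (h x) (sumOver xs h)))

  sum-const : ∀ xs c → sumOver xs (λ (_ : A) → c) ≡ fromℕ (length xs) * c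
  sum-const []       c = sym (*-zeroˡ c)
  sum-const (x ∷ xs) c = trans (cong₂ _+_ (sym (*-identityˡ c)) (sum-const xs c))
    (trans (sym (*-distribʳ-+ c 1ℚ (fromℕ (length xs)))) (cong (_* c) (sym (fromℕ-suc (length xs)))))

  sum-++ : ∀ xs ys (h : A → ℚ) → sumOver (xs ++ ys) h ≡ sumOver xs h + sumOver ys h
  sum-++ []       ys h = sym (+-identityˡ (sumOver ys h))
  sum-++ (x ∷ xs) ys h = trans (cong (h x +_) (sum-++ xs ys h)) (sym (+-assoc (h x) (sumOver xs h) (sumOver ys h)))

  ∈⇒≤sum : ∀ {xs} {h : A → ℚ} {x} → (∀ y → 0ℚ ≤ h y) → x ∈ xs → h x ≤ sumOver xs h
  ∈⇒≤sum {y ∷ xs} {h} 0≤h (here refl) =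
    subst (_≤ h y + sumOver xs h) (+-identityʳ (h y)) (+-monoʳ-≤ (h y) (sum-nonNeg xs 0≤h))
  ∈⇒≤sum {y ∷ xs} {h} {x} 0≤h (there x∈) =
    subst (_≤ h y + sumOver xs h) (+-identityˡ (h x)) (+-mono-≤ (0≤h y) (∈⇒≤sum 0≤h x∈))

module _ {A B : Set} where

  sum-map : ∀ (φ : A → B) xs (h : B → ℚ) → sumOver (List.map φ xs) h ≡ sumOver xs (h ∘ φ)
  sum-map φ []       h = refl
  sum-map φ (x ∷ xs) h = cong (h (φ x) +_) (sum-map φ xs h)

  sum-swap : ∀ xs ys (h : A → B → ℚ) →
    sumOver xs (λ x → sumOver ys (h x)) ≡ sumOver ys (λ y → sumOver xs (λ x → h x y))
  sum-swap []       ys h = sym (sum-zero ys)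
  sum-swap (x ∷ xs) ys h = trans (cong (sumOver ys (h x) +_) (sum-swap xs ys h)) (sym (sum-+ ys (h x) (λ y → sumOver xs (λ x → h x y))))

sum-product : ∀ {A B C : Set} (φ : A → B → C) xs ys (h : C → ℚ) →
  sumOver (cartesianProductWith φ xs ys) h ≡ sumOver xs (λ x → sumOver ys (λ y → h (φ x y)))
sum-product φ []       ys h = refl
sum-product φ (x ∷ xs) ys h =
  trans (sum-++ (List.map (φ x) ys) (cartesianProductWith φ xs ys) h) (cong₂ _+_ (sum-map (φ x) ys h) (sum-product φ xs ys h))

-- Indicators of decidable propositions

𝟙 : ∀ {P : Set} → Dec P → ℚ
𝟙 (yes _) = 1ℚ
𝟙 (no _)  = 0ℚ

module _ {P : Set} where

  𝟙-yes : ∀ (d : Dec P) → P → 𝟙 d ≡ 1ℚ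
  𝟙-yes (yes _) p = refl
  𝟙-yes (no ¬p) p = contradiction p ¬p

  𝟙-no : ∀ (d : Dec P) → ¬ P → 𝟙 d ≡ 0ℚ
  𝟙-no (yes p) ¬p = contradiction p ¬p
  𝟙-no (no _)  ¬p = refl

  0≤𝟙 : ∀ (d : Dec P) → 0ℚ ≤ 𝟙 d
  0≤𝟙 (yes _) = <⇒≤ 0<1
  0≤𝟙 (no _)  = ≤-refl

  𝟙≤1 : ∀ (d : Dec P) → 𝟙 d ≤ 1ℚ
  𝟙≤1 (yes _) = ≤-refl
  𝟙≤1 (no _)  = <⇒≤ 0<1

module _ {P Q : Set} where

  𝟙-cong : ∀ (d : Dec P) (e : Dec Q) → (P → Q) → (Q → P) → 𝟙 d ≡ 𝟙 e
  𝟙-cong (yes p) e to from = sym (𝟙-yes e (to p))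
  𝟙-cong (no ¬p) e to from = sym (𝟙-no e (¬p ∘ from))

  𝟙-mono : ∀ (d : Dec P) (e : Dec Q) → (P → Q) → 𝟙 d ≤ 𝟙 e
  𝟙-mono (yes p) e to = ≤-reflexive (sym (𝟙-yes e (to p)))
  𝟙-mono (no ¬p) e to = 0≤𝟙 e

  𝟙-× : ∀ (d : Dec P) (e : Dec Q) → 𝟙 (d ×-dec e) ≡ 𝟙 d * 𝟙 e
  𝟙-× (yes _) (yes _) = refl
  𝟙-× (yes _) (no _)  = refl
  𝟙-× (no _)  (yes _) = refl
  𝟙-× (no _)  (no _)  = refl

sum-𝟙 : ∀ {A : Set} {P : A → Set} (P? : Decidable P) xs →
  sumOver xs (λ x → 𝟙 (P? x)) ≡ fromℕ (length (filter P? xs))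
sum-𝟙 P? []       = refl
sum-𝟙 P? (x ∷ xs) with P? x
... | yes _ = trans (cong (1ℚ +_) (sum-𝟙 P? xs)) (sym (fromℕ-suc (length (filter P? xs))))
... | no  _ = trans (+-identityˡ (sumOver xs (λ x → 𝟙 (P? x)))) (sum-𝟙 P? xs)

sum-dirac : ∀ {A : Set} {P : A → Set} (P? : Decidable P) {xs} {x₀ : A} (h : A → ℚ) → Unique xs → x₀ ∈ xs →
  P x₀ → (∀ x → P x → x ≡ x₀) → sumOver xs (λ x → 𝟙 (P? x) * h x) ≡ h x₀
sum-dirac P? {x ∷ xs} h (x∉ ∷ u) (here refl) Px₀ uniq = trans (cong₂ _+_
    (trans (cong (_* h x) (𝟙-yes (P? x) Px₀)) (*-identityˡ (h x)))
    (trans (sum-cong∈ xs λ y y∈ → trans (cong (_* h y) (𝟙-no (P? y) λ Py → All.lookup x∉ y∈ (sym (uniq y Py)))) (*-zeroˡ (h y)))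
           (sum-zero xs)))
  (+-identityʳ (h x))
sum-dirac P? {x ∷ xs} h (x∉ ∷ u) (there x₀∈) Px₀ uniq = trans (cong₂ _+_
    (trans (cong (_* h x) (𝟙-no (P? x) λ Px → All.lookup x∉ x₀∈ (uniq x Px))) (*-zeroˡ (h x)))
    (sum-dirac P? h u x₀∈ Px₀ uniq))
  (+-identityˡ (h _))

sum-𝟙-unique : ∀ {A : Set} {P : A → Set} (P? : Decidable P) {xs} {x₀ : A} → Unique xs → x₀ ∈ xs →
  P x₀ → (∀ x → P x → x ≡ x₀) → sumOver xs (λ x → 𝟙 (P? x)) ≡ 1ℚ
sum-𝟙-unique P? {xs} u x₀∈ Px₀ uniq =
  trans (sum-cong xs λ x → sym (*-identityʳ (𝟙 (P? x)))) (sum-dirac P? (λ _ → 1ℚ) u x₀∈ Px₀ uniq)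

-- The field of integers modulo p

module Residues {p : ℕ} .{{_ : NonZero p}} where

  open ≡-Reasoning

  res : ℕ → Fin p
  res n = n mod p

  infixl 7 _⊗_

  _⊗_ : Fin p → Fin p → Fin p
  a ⊗ b = res (toℕ a ℕ.* toℕ b)

  ⊖_ : Fin p → Fin p
  ⊖ a = res (p ℕ.∸ toℕ a)

  toℕ-res : ∀ n → toℕ (res n) ≡ n % p
  toℕ-res n = Fin.toℕ-fromℕ< _

  res-toℕ : ∀ a → res (toℕ a) ≡ a
  res-toℕ a = Fin.toℕ-injective (trans (toℕ-res (toℕ a)) (m<n⇒m%n≡m (Fin.toℕ<n a)))

  res-+ : ∀ m n → res m ⊕ res n ≡ res (m ℕ.+ n)
  res-+ m n = Fin.toℕ-injective (begin
    toℕ (res m ⊕ res n) ≡⟨ toℕ-res _ ⟩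
    (toℕ (res m) ℕ.+ toℕ (res n)) % p ≡⟨ cong₂ (λ a b → (a ℕ.+ b) % p) (toℕ-res m) (toℕ-res n) ⟩
    (m % p ℕ.+ n % p) % p ≡⟨ sym (%-distribˡ-+ m n p) ⟩
    (m ℕ.+ n) % p ≡⟨ sym (toℕ-res (m ℕ.+ n)) ⟩
    toℕ (res (m ℕ.+ n)) ∎)

  res-* : ∀ m n → res m ⊗ res n ≡ res (m ℕ.* n)
  res-* m n = Fin.toℕ-injective (begin
    toℕ (res m ⊗ res n) ≡⟨ toℕ-res _ ⟩
    (toℕ (res m) ℕ.* toℕ (res n)) % p ≡⟨ cong₂ (λ a b → (a ℕ.* b) % p) (toℕ-res m) (toℕ-res n) ⟩
    ((m % p) ℕ.* (n % p)) % p ≡⟨ sym (%-distribˡ-* m n p) ⟩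
    (m ℕ.* n) % p ≡⟨ sym (toℕ-res (m ℕ.* n)) ⟩
    toℕ (res (m ℕ.* n)) ∎)

  ⊕-comm : ∀ a b → a ⊕ b ≡ b ⊕ a
  ⊕-comm a b = cong res (ℕ.+-comm (toℕ a) (toℕ b))

  ⊗-comm : ∀ a b → a ⊗ b ≡ b ⊗ a
  ⊗-comm a b = cong res (ℕ.*-comm (toℕ a) (toℕ b))

  ⊕-res : ∀ a n → a ⊕ res n ≡ res (toℕ a ℕ.+ n)
  ⊕-res a n = trans (cong (_⊕ res n) (sym (res-toℕ a))) (res-+ (toℕ a) n)

  ⊗-res : ∀ a n → a ⊗ res n ≡ res (toℕ a ℕ.* n)
  ⊗-res a n = trans (cong (_⊗ res n) (sym (res-toℕ a))) (res-* (toℕ a) n)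

  ⊕-assoc : ∀ a b c → (a ⊕ b) ⊕ c ≡ a ⊕ (b ⊕ c)
  ⊕-assoc a b c = begin
    res (toℕ a ℕ.+ toℕ b) ⊕ c ≡⟨ ⊕-comm _ c ⟩
    c ⊕ res (toℕ a ℕ.+ toℕ b) ≡⟨ ⊕-res c _ ⟩
    res (toℕ c ℕ.+ (toℕ a ℕ.+ toℕ b)) ≡⟨ cong res (trans (ℕ.+-comm (toℕ c) _) (ℕ.+-assoc (toℕ a) (toℕ b) (toℕ c))) ⟩
    res (toℕ a ℕ.+ (toℕ b ℕ.+ toℕ c)) ≡⟨ sym (⊕-res a _) ⟩
    a ⊕ (b ⊕ c) ∎

  ⊗-assoc : ∀ a b c → (a ⊗ b) ⊗ c ≡ a ⊗ (b ⊗ c)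
  ⊗-assoc a b c = begin
    res (toℕ a ℕ.* toℕ b) ⊗ c ≡⟨ ⊗-comm _ c ⟩
    c ⊗ res (toℕ a ℕ.* toℕ b) ≡⟨ ⊗-res c _ ⟩
    res (toℕ c ℕ.* (toℕ a ℕ.* toℕ b)) ≡⟨ cong res (trans (ℕ.*-comm (toℕ c) _) (ℕ.*-assoc (toℕ a) (toℕ b) (toℕ c))) ⟩
    res (toℕ a ℕ.* (toℕ b ℕ.* toℕ c)) ≡⟨ sym (⊗-res a _) ⟩
    a ⊗ (b ⊗ c) ∎

  ⊗-distribˡ : ∀ a b c → a ⊗ (b ⊕ c) ≡ a ⊗ b ⊕ a ⊗ c
  ⊗-distribˡ a b c = begin
    a ⊗ res (toℕ b ℕ.+ toℕ c) ≡⟨ ⊗-res a _ ⟩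
    res (toℕ a ℕ.* (toℕ b ℕ.+ toℕ c)) ≡⟨ cong res (ℕ.*-distribˡ-+ (toℕ a) (toℕ b) (toℕ c)) ⟩
    res (toℕ a ℕ.* toℕ b ℕ.+ toℕ a ℕ.* toℕ c) ≡⟨ sym (res-+ (toℕ a ℕ.* toℕ b) (toℕ a ℕ.* toℕ c)) ⟩
    a ⊗ b ⊕ a ⊗ c ∎

  ⊕-identityˡ : ∀ a → 𝟘 ⊕ a ≡ a
  ⊕-identityˡ a = trans (⊕-comm 𝟘 a) (trans (⊕-res a 0) (trans (cong res (ℕ.+-identityʳ (toℕ a))) (res-toℕ a)))

  ⊕-inverseʳ : ∀ a → a ⊕ (⊖ a) ≡ 𝟘
  ⊕-inverseʳ a = trans (⊕-res a _) (trans (cong res (ℕ.m+[n∸m]≡n (ℕ.<⇒≤ (Fin.toℕ<n a))))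
    (Fin.toℕ-injective (trans (toℕ-res p) (trans (trans (n%n≡0 p) (sym (m<n⇒m%n≡m (ℕ.>-nonZero⁻¹ p)))) (sym (toℕ-res 0))))))

  res-∣ : ∀ {n} → p ∣ n → res n ≡ 𝟘
  res-∣ {n} p∣n = Fin.toℕ-injective (trans (toℕ-res n)
    (trans (n∣m⇒m%n≡0 n p p∣n) (trans (sym (m<n⇒m%n≡m (ℕ.>-nonZero⁻¹ p))) (sym (toℕ-res 0)))))

module _ {p : ℕ} (pr : Prime p) where

  private instance
    nz : NonZero p
    nz = prime⇒nonZero pr

  open Residues {p}

  private
    1<p : 1 ℕ.< p
    1<p = ℕ.nonTrivial⇒n>1 p {{prime⇒nonTrivial pr}}

  toℕ-res-< : ∀ {n} → n ℕ.< p → toℕ (res n) ≡ n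
  toℕ-res-< n<p = trans (toℕ-res _) (m<n⇒m%n≡m n<p)

  res-≢ : ∀ {m n} → m ℕ.< p → n ℕ.< p → m ≢ n → res m ≢ res n
  res-≢ m<p n<p m≢n eq = m≢n (trans (sym (toℕ-res-< m<p)) (trans (cong toℕ eq) (toℕ-res-< n<p)))

  ⊗-inverse : ∀ (a : Fin p) → a ≢ 𝟘 → ∃[ b ] b ⊗ a ≡ res 1
  ⊗-inverse a a≢0 with coprime-Bézout (prime⇒coprime pr {{ℕ.≢-nonZero λ eq → a≢0 (trans (sym (res-toℕ a)) (cong res eq))}} (Fin.toℕ<n a))
  ... | Bézout.Identity.-+ x y eq = res y , (begin
      res y ⊗ a ≡⟨ cong (res y ⊗_) (sym (res-toℕ a)) ⟩
      res y ⊗ res (toℕ a) ≡⟨ res-* y (toℕ a) ⟩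
      res (y ℕ.* toℕ a) ≡⟨ cong res (sym eq) ⟩
      res (1 ℕ.+ x ℕ.* p) ≡⟨ sym (res-+ 1 (x ℕ.* p)) ⟩
      res 1 ⊕ res (x ℕ.* p) ≡⟨ cong (res 1 ⊕_) (res-∣ (divides x refl)) ⟩
      res 1 ⊕ 𝟘 ≡⟨ trans (⊕-comm (res 1) 𝟘) (⊕-identityˡ (res 1)) ⟩
      res 1 ∎)
    where open ≡-Reasoning
  -- Here `1 + y a` is a multiple of `p`, so the inverse is minus `y`.
  ... | Bézout.Identity.+- x y eq = ⊖ res y , (begin
      ⊖ res y ⊗ a ≡⟨ sym (⊕-identityˡ _) ⟩
      𝟘 ⊕ ⊖ res y ⊗ a ≡⟨ cong (_⊕ ⊖ res y ⊗ a) (sym (trans 1+ya (res-∣ (divides x eq)))) ⟩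
      (res 1 ⊕ res y ⊗ a) ⊕ ⊖ res y ⊗ a ≡⟨ ⊕-assoc (res 1) _ _ ⟩
      res 1 ⊕ (res y ⊗ a ⊕ ⊖ res y ⊗ a) ≡⟨ cong (res 1 ⊕_) (begin
        res y ⊗ a ⊕ ⊖ res y ⊗ a ≡⟨ cong₂ _⊕_ (⊗-comm (res y) a) (⊗-comm (⊖ res y) a) ⟩
        a ⊗ res y ⊕ a ⊗ ⊖ res y ≡⟨ sym (⊗-distribˡ a (res y) (⊖ res y)) ⟩
        a ⊗ (res y ⊕ ⊖ res y) ≡⟨ cong (a ⊗_) (⊕-inverseʳ (res y)) ⟩
        a ⊗ 𝟘 ≡⟨ ⊗-res a 0 ⟩
        res (toℕ a ℕ.* 0) ≡⟨ cong res (ℕ.*-zeroʳ (toℕ a)) ⟩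
        𝟘 ∎) ⟩
      res 1 ⊕ 𝟘 ≡⟨ trans (⊕-comm (res 1) 𝟘) (⊕-identityˡ (res 1)) ⟩
      res 1 ∎)
    where
    open ≡-Reasoning
    1+ya : res 1 ⊕ res y ⊗ a ≡ res (1 ℕ.+ y ℕ.* toℕ a)
    1+ya = trans (cong (λ b → res 1 ⊕ res y ⊗ b) (sym (res-toℕ a)))
      (trans (cong (res 1 ⊕_) (res-* y (toℕ a))) (res-+ 1 (y ℕ.* toℕ a)))

  residueField : FieldOn p
  residueField = record
    { _+ᶠ_ = _⊕_ ; _*ᶠ_ = _⊗_ ; -ᶠ_ = ⊖_ ; 0ᶠ = 𝟘 ; 1ᶠ = res 1
    ; +ᶠ-assoc = ⊕-assoc ; +ᶠ-comm = ⊕-comm ; +ᶠ-identityˡ = ⊕-identityˡ ; +ᶠ-inverseʳ = ⊕-inverseʳ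
    ; *ᶠ-assoc = ⊗-assoc ; *ᶠ-comm = ⊗-comm
    ; *ᶠ-identityˡ = λ a → trans (⊗-comm (res 1) a) (trans (⊗-res a 1) (trans (cong res (ℕ.*-identityʳ (toℕ a))) (res-toℕ a)))
    ; *ᶠ-distribˡ = ⊗-distribˡ ; *ᶠ-inverse = ⊗-inverse
    ; 1≢0 = res-≢ 1<p (ℕ.<-trans (s≤s z≤n) 1<p) λ ()
    }

  abstract
    residueField-1+1≢0 : 2 ℕ.< p → FieldOn._+ᶠ_ residueField (FieldOn.1ᶠ residueField) (FieldOn.1ᶠ residueField) ≢ FieldOn.0ᶠ residueField
    residueField-1+1≢0 2<p eq = res-≢ 2<p (ℕ.<-trans (s≤s z≤n) 1<p) (λ ()) (trans (sym (res-+ 1 1)) eq)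

-- Expectations

-- A probability measure as a positive normalised linear functional: uniform sequences, biased coin
-- tosses and image laws are treated alike, with no sample space to enumerate.
record Expectation (A : Set) : Set where
  field
    𝔼      : (A → ℚ) → ℚ
    𝔼-mono : ∀ {h g} → (∀ x → h x ≤ g x) → 𝔼 h ≤ 𝔼 g
    𝔼-+    : ∀ h g → 𝔼 (λ x → h x + g x) ≡ 𝔼 h + 𝔼 g
    𝔼-*    : ∀ c h → 𝔼 (λ x → c * h x) ≡ c * 𝔼 h
    𝔼-1    : 𝔼 (λ _ → 1ℚ) ≡ 1ℚ

  𝔼-cong : ∀ {h g} → (∀ x → h x ≡ g x) → 𝔼 h ≡ 𝔼 g
  𝔼-cong eq = ℚ.≤-antisym (𝔼-mono λ x → ≤-reflexive (eq x)) (𝔼-mono λ x → ≤-reflexive (sym (eq x)))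

  𝔼-const : ∀ c → 𝔼 (λ _ → c) ≡ c
  𝔼-const c = trans (𝔼-cong λ _ → sym (*-identityʳ c))
    (trans (𝔼-* c (λ _ → 1ℚ)) (trans (cong (c *_) 𝔼-1) (*-identityʳ c)))

  𝔼-nonNeg : ∀ {h} → (∀ x → 0ℚ ≤ h x) → 0ℚ ≤ 𝔼 h
  𝔼-nonNeg {h} le = subst (_≤ 𝔼 h) (𝔼-const 0ℚ) (𝔼-mono le)

  𝔼-sum : ∀ {B : Set} (ys : List B) (h : A → B → ℚ) →
    𝔼 (λ x → sumOver ys (h x)) ≡ sumOver ys (λ y → 𝔼 (λ x → h x y))
  𝔼-sum []       h = 𝔼-const 0ℚ
  𝔼-sum (y ∷ ys) h = trans (𝔼-+ (λ x → h x y) (λ x → sumOver ys (h x))) (cong (𝔼 (λ x → h x y) +_) (𝔼-sum ys h))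

open Expectation public

dirac : ∀ {A : Set} → A → Expectation A
dirac x = record
  { 𝔼 = λ h → h x ; 𝔼-mono = λ le → le x ; 𝔼-+ = λ _ _ → refl ; 𝔼-* = λ _ _ → refl ; 𝔼-1 = refl }

fromℕ-pos : ∀ n .{{_ : NonZero n}} → 0ℚ < fromℕ n
fromℕ-pos n@(suc _) = <-≤-trans 0<1 (fromℕ-mono {1} {n} (s≤s z≤n))

module Uniform {p : ℕ} .{{_ : NonZero p}} where

  ι : ℚ
  ι = recip (fromℕ p) (fromℕ-pos p)

  0<ι : 0ℚ < ι
  0<ι = recip-pos (fromℕ p) (fromℕ-pos p)

  0≤ι : 0ℚ ≤ ι
  0≤ι = <⇒≤ 0<ι

  ι*p≡1 : ι * fromℕ p ≡ 1ℚ
  ι*p≡1 = trans (*-comm ι (fromℕ p)) (recip-inv (fromℕ p) (fromℕ-pos p))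

  uniform : Expectation (Fin p)
  uniform = record
    { 𝔼      = λ h → ι * sumOver (allFin p) h
    ; 𝔼-mono = λ le → *-monoˡ ι 0≤ι (sum-mono (allFin p) le)
    ; 𝔼-+    = λ h g → trans (cong (ι *_) (sum-+ (allFin p) h g)) (*-distribˡ-+ ι (sumOver (allFin p) h) (sumOver (allFin p) g))
    ; 𝔼-*    = λ c h → trans (cong (ι *_) (sum-* (allFin p) c h))
                 (solve 3 (λ i c s → i :* (c :* s) := c :* (i :* s)) refl ι c (sumOver (allFin p) h))
    ; 𝔼-1    = trans (cong (ι *_) (trans (sum-const (allFin p) 1ℚ) (*-identityʳ (fromℕ (length (allFin p))))))
                 (trans (cong (λ n → ι * fromℕ n) (List.length-tabulate {n = p} id)) ι*p≡1)
    }

  vectors : ∀ k → Expectation (Vec (Fin p) k)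
  vectors zero    = dirac []
  vectors (suc k) = record
    { 𝔼      = λ h → 𝔼 uniform λ a → 𝔼 (vectors k) λ as → h (a ∷ as)
    ; 𝔼-mono = λ le → 𝔼-mono uniform λ a → 𝔼-mono (vectors k) λ as → le (a ∷ as)
    ; 𝔼-+    = λ h g → trans (𝔼-cong uniform λ a → 𝔼-+ (vectors k) (λ as → h (a ∷ as)) (λ as → g (a ∷ as)))
                 (𝔼-+ uniform (λ a → 𝔼 (vectors k) λ as → h (a ∷ as)) (λ a → 𝔼 (vectors k) λ as → g (a ∷ as)))
    ; 𝔼-*    = λ c h → trans (𝔼-cong uniform λ a → 𝔼-* (vectors k) c (λ as → h (a ∷ as)))
                 (𝔼-* uniform c (λ a → 𝔼 (vectors k) λ as → h (a ∷ as)))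
    ; 𝔼-1    = trans (𝔼-cong uniform λ a → 𝔼-1 (vectors k)) (𝔼-1 uniform)
    }

-- The probability that random coefficients solve a system of linear equations

module Solutions {p : ℕ} (pr : Prime p) (2<p : 2 ℕ.< p) where

  instance
    p-nonZero : NonZero p
    p-nonZero = prime⇒nonZero pr

  abstract
    1<p : 1 ℕ.< p
    1<p = ℕ.<-trans (s≤s (s≤s z≤n)) 2<p

  𝔽 = residueField pr

  open Residues {p} public
  open Uniform {p} public
  open FieldOn 𝔽 using (1≢0)
  open LinearAlgebra 𝔽 public
  open CubePoints 𝔽 1<p (residueField-1+1≢0 pr 2<p) public

  module _ {r : ℕ} where

    open Family (emb {r})

    -- The probability that `z` plus a uniformly random combination of `us` vanishes.
    solvable : List (Vec Bool r) → V r → ℚ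
    solvable []       z = 𝟙 (z ≟ᵛ 𝟎)
    solvable (u ∷ us) z = 𝔼 uniform λ a → solvable us (z ⊞ (a ⊙ emb u))

    -- A vector already in the span of the later ones does not change whether `z` is reached. For a
    -- new one exactly one of the `p` coefficients works, provided `z` lies in the larger span;
    -- hence one factor `ι` per basis vector.
    solvable-basis : ∀ us z → solvable us z ≡ ι ^ length (basis us) * 𝟙 (span? (basis us) z)
    solvable-basis []       z = sym (*-identityˡ (𝟙 (z ≟ᵛ 𝟎)))
    solvable-basis (u ∷ us) z with span? (basis us) (emb u)
    ... | yes s = trans (𝔼-cong uniform λ a → trans (solvable-basis us (z ⊞ (a ⊙ emb u)))
            (cong (ι ^ length B *_) (𝟙-cong (span? B (z ⊞ (a ⊙ emb u))) (span? B z) (span-undo B a s)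
              (λ t → span-⊞ B t (span-⊙ B a s)))))
          (𝔼-const uniform (ι ^ length B * 𝟙 (span? B z)))
      where B = basis us
    ... | no ¬s = begin
      𝔼 uniform (λ a → solvable us (z ⊞ (a ⊙ emb u)))
        ≡⟨ 𝔼-cong uniform (λ a → solvable-basis us (z ⊞ (a ⊙ emb u))) ⟩
      𝔼 uniform (λ a → ι ^ length B * 𝟙 (span? B (z ⊞ (a ⊙ emb u))))
        ≡⟨ 𝔼-* uniform (ι ^ length B) (λ a → 𝟙 (span? B (z ⊞ (a ⊙ emb u)))) ⟩
      ι ^ length B * (ι * sumOver (allFin p) (λ a → 𝟙 (span? B (z ⊞ (a ⊙ emb u)))))
        ≡⟨ cong (λ s → ι ^ length B * (ι * s)) unique ⟩
      ι ^ length B * (ι * 𝟙 (span? (u ∷ B) z))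
        ≡⟨ solve 3 (λ x i y → x :* (i :* y) := (i :* x) :* y) refl (ι ^ length B) ι (𝟙 (span? (u ∷ B) z)) ⟩
      (ι * ι ^ length B) * 𝟙 (span? (u ∷ B) z) ∎
      where
      open ≡-Reasoning
      B = basis us
      unique : sumOver (allFin p) (λ a → 𝟙 (span? B (z ⊞ (a ⊙ emb u)))) ≡ 𝟙 (span? (u ∷ B) z)
      unique = case span? (u ∷ B) z of λ
        { (yes (a , s)) → trans
            (sum-𝟙-unique (λ a → span? B (z ⊞ (a ⊙ emb u))) (Unique.allFin⁺ p) (∈-allFin a) s
              (λ b t → span-unique B ¬s t s))
            (sym (𝟙-yes (span? (u ∷ B) z) (a , s)))
        ; (no ¬t) → trans (sum-cong (allFin p) λ a → 𝟙-no (span? B (z ⊞ (a ⊙ emb u))) λ t → ¬t (a , t))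
            (trans (sum-zero (allFin p)) (sym (𝟙-no (span? (u ∷ B) z) ¬t))) }

  value : ∀ {K} → V K → Vec Bool K → Fin p → Fin p
  value []       []          x = x
  value (a ∷ as) (true ∷ S)  x = value as S (x ⊕ a)
  value (a ∷ as) (false ∷ S) x = value as S x

  vanish : ∀ {K r} → Vec (Vec Bool K) r → V r → V K → ℚ
  vanish []      []      as = 1ℚ
  vanish (S ∷ τ) (x ∷ z) as = 𝟙 (value as S x Fin.≟ 𝟘) * vanish τ z as

  trues : ∀ {r} → Vec Bool r
  trues = replicate _ true

  -- The conditions x + Σ S = 0 for the rows S of τ form a linear system in the sequence
  -- and x; the column of x consists of ones.
  columns : ∀ {K r} → Vec (Vec Bool K) r → List (Vec Bool r)
  columns {zero}  τ = trues ∷ []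
  columns {suc K} τ = Vec.map Vec.head τ ∷ columns (Vec.map Vec.tail τ)

  rank : ∀ {K r} → Vec (Vec Bool K) r → ℕ
  rank {r = r} τ = length (Family.basis (emb {r}) (columns τ))

  vanish-step : ∀ {K r} (τ : Vec (Vec Bool (suc K)) r) z a as →
    vanish τ z (a ∷ as) ≡ vanish (Vec.map Vec.tail τ) (z ⊞ (a ⊙ emb (Vec.map Vec.head τ))) as
  vanish-step []                []      a as = refl
  vanish-step ((true ∷ S) ∷ τ)  (x ∷ z) a as = cong₂ (λ y h → 𝟙 (value as S y Fin.≟ 𝟘) * h)
    (cong (x ⊕_) (sym (*ᶠ-identityʳ a))) (vanish-step τ z a as)
  vanish-step ((false ∷ S) ∷ τ) (x ∷ z) a as = cong₂ (λ y h → 𝟙 (value as S y Fin.≟ 𝟘) * h)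
    (trans (sym (+ᶠ-identityʳ x)) (cong (x ⊕_) (sym (*ᶠ-zeroʳ a)))) (vanish-step τ z a as)

  vanish-empty : ∀ {r} (τ : Vec (Vec Bool 0) r) z → vanish τ z [] ≡ 𝟙 (z ≟ᵛ 𝟎)
  vanish-empty []       []      = refl
  vanish-empty ([] ∷ τ) (x ∷ z) = trans (cong (𝟙 (x Fin.≟ 𝟘) *_) (vanish-empty τ z))
    (trans (sym (𝟙-× (x Fin.≟ 𝟘) (z ≟ᵛ 𝟎)))
      (𝟙-cong ((x Fin.≟ 𝟘) ×-dec (z ≟ᵛ 𝟎)) ((x ∷ z) ≟ᵛ 𝟎) (λ (eq , eqs) → cong₂ _∷_ eq eqs) Vec.∷-injective))

  -- Drawing the entries one by one adds to `z` a random multiple of one column each; the shift `x`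
  -- is drawn last and contributes the all-ones column.
  vanish-solvable : ∀ {K r} (τ : Vec (Vec Bool K) r) z →
    𝔼 (vectors K) (λ as → 𝔼 uniform λ x → vanish τ (z ⊞ (x ⊙ emb trues)) as) ≡ solvable (columns τ) z
  vanish-solvable {zero}  τ z = 𝔼-cong uniform λ x → vanish-empty τ (z ⊞ (x ⊙ emb trues))
  vanish-solvable {suc K} τ z = 𝔼-cong uniform λ a → trans
    (𝔼-cong (vectors K) λ as → 𝔼-cong uniform λ x → trans (vanish-step τ (z ⊞ (x ⊙ emb trues)) a as)
      (cong (λ w → vanish (Vec.map Vec.tail τ) w as) (⊞-swap z (x ⊙ emb trues) (a ⊙ emb (Vec.map Vec.head τ)))))
    (vanish-solvable (Vec.map Vec.tail τ) (z ⊞ (a ⊙ emb (Vec.map Vec.head τ))))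

  replicate-trues : ∀ {r} x → replicate r x ≡ 𝟎 ⊞ (x ⊙ emb trues)
  replicate-trues {r} x = trans (eq r) (sym (⊞-identityˡ (x ⊙ emb trues)))
    where
    eq : ∀ r → replicate r x ≡ x ⊙ emb trues
    eq zero    = refl
    eq (suc r) = cong₂ _∷_ (sym (*ᶠ-identityʳ x)) (eq r)

  -- The system is homogeneous, and `𝟎` lies in every span, so the probability is an exact power of
  -- `ι`.
  vanish-probability : ∀ {K r} (τ : Vec (Vec Bool K) r) →
    𝔼 (vectors K) (λ as → 𝔼 uniform λ x → vanish τ (replicate r x) as) ≡ ι ^ rank τ
  vanish-probability {K} {r} τ = trans
    (𝔼-cong (vectors K) λ as → 𝔼-cong uniform λ x → cong (λ w → vanish τ w as) (replicate-trues x))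
    (trans (vanish-solvable τ 𝟎) (trans (solvable-basis (columns τ) 𝟎)
      (trans (cong (ι ^ length B *_) (𝟙-yes (Family.span? emb B 𝟎) (Family.span-𝟎 emb B))) (*-identityʳ (ι ^ length B)))))
    where B = Family.basis (emb {r}) (columns τ)

-- Powers and numerals in the rationals

^-nonNeg : ∀ {x} → 0ℚ ≤ x → ∀ n → 0ℚ ≤ x ^ n
^-nonNeg 0≤x zero    = <⇒≤ 0<1
^-nonNeg 0≤x (suc n) = *-nonNeg 0≤x (^-nonNeg 0≤x n)

^-pos : ∀ {x} → 0ℚ < x → ∀ n → 0ℚ < x ^ n
^-pos 0<x zero    = 0<1
^-pos 0<x (suc n) = *-pos 0<x (^-pos 0<x n)

^-monoˡ : ∀ {x y} → 0ℚ ≤ x → x ≤ y → ∀ n → x ^ n ≤ y ^ n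
^-monoˡ 0≤x x≤y zero    = ≤-refl
^-monoˡ {x} {y} 0≤x x≤y (suc n) =
  *-mono {x} {y} {x ^ n} {y ^ n} 0≤x (^-nonNeg (≤-trans 0≤x x≤y) n) x≤y (^-monoˡ 0≤x x≤y n)

^-antiʳ : ∀ {x} → 0ℚ ≤ x → x ≤ 1ℚ → ∀ {m n} → m ℕ.≤ n → x ^ n ≤ x ^ m
^-antiʳ 0≤x x≤1 {n = zero}  z≤n = ≤-refl
^-antiʳ {x} 0≤x x≤1 {n = suc n} z≤n = subst (x * x ^ n ≤_) (*-identityˡ 1ℚ)
  (*-mono {x} {1ℚ} {x ^ n} {1ℚ} 0≤x (<⇒≤ 0<1) x≤1 (^-antiʳ 0≤x x≤1 {zero} {n} z≤n))
^-antiʳ {x} 0≤x x≤1 (s≤s m≤n) = *-monoˡ x 0≤x (^-antiʳ 0≤x x≤1 m≤n)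

^-monoʳ : ∀ {x} → 1ℚ ≤ x → ∀ {m n} → m ℕ.≤ n → x ^ m ≤ x ^ n
^-monoʳ 1≤x {n = zero}  z≤n = ≤-refl
^-monoʳ {x} 1≤x {n = suc n} z≤n = subst (_≤ x * x ^ n) (*-identityˡ 1ℚ)
  (*-mono {1ℚ} {x} {1ℚ} {x ^ n} (<⇒≤ 0<1) (^-nonNeg (≤-trans (<⇒≤ 0<1) 1≤x) n) 1≤x (^-monoʳ 1≤x {zero} {n} z≤n))
^-monoʳ {x} 1≤x (s≤s m≤n) = *-monoˡ x (≤-trans (<⇒≤ 0<1) 1≤x) (^-monoʳ 1≤x m≤n)

^-square : ∀ x k → x ^ (2 ℕ.^ suc k) ≡ x ^ (2 ℕ.^ k) * x ^ (2 ℕ.^ k)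
^-square x k = trans (cong (λ n → x ^ (2 ℕ.^ k ℕ.+ n)) (ℕ.+-identityʳ (2 ℕ.^ k))) (^-homo-* x (2 ℕ.^ k) (2 ℕ.^ k))

1^ : ∀ n → 1ℚ ^ n ≡ 1ℚ
1^ zero    = refl
1^ (suc n) = trans (*-identityˡ (1ℚ ^ n)) (1^ n)

fromℕ-+ : ∀ m n → fromℕ (m ℕ.+ n) ≡ fromℕ m + fromℕ n
fromℕ-+ zero    n = sym (+-identityˡ (fromℕ n))
fromℕ-+ (suc m) n = trans (fromℕ-suc (m ℕ.+ n)) (trans (cong (1ℚ +_) (fromℕ-+ m n))
  (trans (sym (+-assoc 1ℚ (fromℕ m) (fromℕ n))) (cong (_+ fromℕ n) (sym (fromℕ-suc m)))))

fromℕ-* : ∀ m n → fromℕ (m ℕ.* n) ≡ fromℕ m * fromℕ n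
fromℕ-* zero    n = sym (*-zeroˡ (fromℕ n))
fromℕ-* (suc m) n = trans (fromℕ-+ n (m ℕ.* n)) (trans (cong₂ _+_ (sym (*-identityˡ (fromℕ n))) (fromℕ-* m n))
  (trans (sym (*-distribʳ-+ (fromℕ n) 1ℚ (fromℕ m))) (cong (_* fromℕ n) (sym (fromℕ-suc m)))))

fromℕ-^ : ∀ m n → fromℕ (m ℕ.^ n) ≡ fromℕ m ^ n
fromℕ-^ m zero    = refl
fromℕ-^ m (suc n) = trans (fromℕ-* m (m ℕ.^ n)) (cong (fromℕ m *_) (fromℕ-^ m n))

0≤fromℕ : ∀ n → 0ℚ ≤ fromℕ n
0≤fromℕ n = fromℕ-mono {0} {n} z≤n

2ℚ : ℚ
2ℚ = fromℕ 2

1≤2ℚ : 1ℚ ≤ 2ℚ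
1≤2ℚ = fromℕ-mono {1} {2} (s≤s z≤n)

0<2ℚ : 0ℚ < 2ℚ
0<2ℚ = <-≤-trans 0<1 1≤2ℚ

0≤2ℚ^ : ∀ n → 0ℚ ≤ 2ℚ ^ n
0≤2ℚ^ = ^-nonNeg (<⇒≤ 0<2ℚ)

0≤½ℚ^ : ∀ n → 0ℚ ≤ ½ ^ n
0≤½ℚ^ = ^-nonNeg (<⇒≤ 0<½)

n≤2^n : ∀ n → n ℕ.≤ 2 ℕ.^ n
n≤2^n zero    = z≤n
n≤2^n (suc n) = ℕ.≤-trans (ℕ.+-mono-≤ (ℕ.^-monoʳ-≤ 2 {0} {n} z≤n) (n≤2^n n))
  (ℕ.≤-reflexive (cong (2 ℕ.^ n ℕ.+_) (sym (ℕ.+-identityʳ (2 ℕ.^ n)))))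

¾ : ℚ
¾ = ℤ.+ 3 / 4

0<¾ : 0ℚ < ¾
0<¾ = positive⁻¹ ¾

0≤¾^ : ∀ n → 0ℚ ≤ ¾ ^ n
0≤¾^ = ^-nonNeg (<⇒≤ 0<¾)

4W≤3X⇒W≤¾X : ∀ W X → 4 ℕ.* W ℕ.≤ 3 ℕ.* X → fromℕ W ≤ ¾ * fromℕ X
4W≤3X⇒W≤¾X W X le = subst₂ _≤_
  (trans (cong (¼ *_) (fromℕ-* 4 W)) (trans (sym (*-assoc ¼ (fromℕ 4) (fromℕ W))) (*-identityˡ (fromℕ W))))
  (trans (cong (¼ *_) (fromℕ-* 3 X)) (sym (*-assoc ¼ (fromℕ 3) (fromℕ X))))
  (*-monoˡ ¼ (<⇒≤ (positive⁻¹ ¼)) (fromℕ-mono le))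
  where
  ¼ : ℚ
  ¼ = ℤ.+ 1 / 4

∣p-q∣≤p : ∀ {p q} → 0ℚ ≤ q → q ≤ p → ∣ p - q ∣ ≤ p
∣p-q∣≤p {p} {q} 0≤q q≤p = subst (_≤ p) (sym (ℚ.0≤p⇒∣p∣≡p (p-q≥0 q≤p)))
  (subst (p - q ≤_) (+-identityʳ p) (+-monoʳ-≤ p (neg-antimono-≤ 0≤q)))

∣p-p∣≡0 : ∀ p → ∣ p - p ∣ ≡ 0ℚ
∣p-p∣≡0 p = cong ∣_∣ (+-inverseʳ p)

-- Dependent tuples of subsets

length-∈-words : ∀ {A : Set} {xs : List A} k {w} → w ∈ words xs k → length w ≡ k
length-∈-words zero    (here refl) = refl
length-∈-words {xs = xs} (suc k) w∈ with ∈-cartesianProductWith⁻ _∷_ xs (words xs k) w∈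
... | x , v , _ , v∈ , refl = cong suc (length-∈-words k v∈)

tuples : ∀ K r → List (Vec (Vec Bool K) r)
tuples K r = vecs (vecs bools K) r

-- Tuples are enumerated by rows, while the conditions on spans concern columns; this regroups the
-- sum by the first column.
sum-rows : ∀ {K} r (h : Vec (Vec Bool (suc K)) r → ℚ) →
  sumOver (tuples (suc K) r) h
    ≡ sumOver (vecs bools r) (λ v → sumOver (tuples K r) (λ τ → h (zipWith _∷_ v τ)))
sum-rows zero    h = cong (_+ 0ℚ) (sym (+-identityʳ (h [])))
sum-rows {K} (suc r) h = begin
  sumOver (tuples (suc K) (suc r)) h
    ≡⟨ sum-product _∷_ (vecs bools (suc K)) (tuples (suc K) r) h ⟩
  sumOver (vecs bools (suc K)) (λ S → sumOver (tuples (suc K) r) (λ τ → h (S ∷ τ)))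
    ≡⟨ sum-product _∷_ bools (vecs bools K) _ ⟩
  sumOver bools (λ b → sumOver (vecs bools K) (λ S → sumOver (tuples (suc K) r) (λ τ → h ((b ∷ S) ∷ τ))))
    ≡⟨ sum-cong bools (λ b → trans (sum-cong (vecs bools K) (λ S → sum-rows r (λ τ → h ((b ∷ S) ∷ τ))))
         (sum-swap (vecs bools K) (vecs bools r) _)) ⟩
  sumOver bools (λ b → sumOver (vecs bools r) (λ v → sumOver (vecs bools K) (λ S →
      sumOver (tuples K r) (λ τ → h ((b ∷ S) ∷ zipWith _∷_ v τ)))))
    ≡⟨ sum-cong bools (λ b → sum-cong (vecs bools r) (λ v → sym (sum-product _∷_ (vecs bools K) (tuples K r) (λ τ → h (zipWith _∷_ (b ∷ v) τ))))) ⟩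
  sumOver bools (λ b → sumOver (vecs bools r) (λ v → sumOver (tuples K (suc r)) (λ τ → h (zipWith _∷_ (b ∷ v) τ))))
    ≡⟨ sym (sum-product _∷_ bools (vecs bools r) (λ v → sumOver (tuples K (suc r)) (λ τ → h (zipWith _∷_ v τ)))) ⟩
  sumOver (vecs bools (suc r)) (λ v → sumOver (tuples K (suc r)) (λ τ → h (zipWith _∷_ v τ))) ∎
  where open ≡-Reasoning

module Dependence {p : ℕ} (pr : Prime p) (2<p : 2 ℕ.< p) where

  open Solutions pr 2<p
  open FieldOn 𝔽 using (1≢0)

  ι≤1 : ι ≤ 1ℚ
  ι≤1 = subst₂ _≤_ (*-identityʳ ι) ι*p≡1 (*-monoˡ ι 0≤ι (fromℕ-mono {1} {p} (ℕ.>-nonZero⁻¹ p)))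

  _⁺ : ∀ {r} → List (Vec Bool r) → List (Vec Bool r)
  B ⁺ = B ++ trues ∷ []

  module _ {r : ℕ} where

    open Family (emb {r})

    inSpan? : (B : List (Vec Bool r)) → Decidable (λ v → Span B (emb v))
    inSpan? B v = span? B (emb v)

    points : List (Vec Bool r) → ℕ
    points B = count (inSpan? B) (vecs bools r)

    allInSpan? : ∀ {K} B (τ : Vec (Vec Bool K) r) → Dec (All (λ v → Span B (emb v)) (columns τ))
    allInSpan? B τ = All.all? (inSpan? B) (columns τ)

    -- Each column is chosen independently in `points B` ways. It is an inequality because the
    -- all-ones column is not chosen, and its indicator is bounded by 1.
    sum-allInSpan : ∀ K B → sumOver (tuples K r) (λ τ → 𝟙 (allInSpan? B τ)) ≤ fromℕ (points B) ^ K
    sum-allInSpan zero B = ≤-trans (sum-mono (tuples 0 r) λ τ → 𝟙≤1 (allInSpan? B τ))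
      (≤-reflexive (trans (sum-const (tuples 0 r) 1ℚ)
        (trans (*-identityʳ (fromℕ (length (tuples 0 r)))) (cong fromℕ (trans (length-vecs (vecs bools 0) r) (ℕ.^-zeroˡ r))))))
    sum-allInSpan (suc K) B = begin
      sumOver (tuples (suc K) r) (λ τ → 𝟙 (allInSpan? B τ))
        ≡⟨ sum-rows r (λ τ → 𝟙 (allInSpan? B τ)) ⟩
      sumOver (vecs bools r) (λ v → sumOver (tuples K r) (λ τ → 𝟙 (allInSpan? B (zipWith _∷_ v τ))))
        ≡⟨ sum-cong (vecs bools r) (λ v → trans (sum-cong (tuples K r) (split v))
             (sum-* (tuples K r) (𝟙 (inSpan? B v)) (λ τ → 𝟙 (allInSpan? B τ)))) ⟩
      sumOver (vecs bools r) (λ v → 𝟙 (inSpan? B v) * s)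
        ≡⟨ trans (sum-cong (vecs bools r) λ v → *-comm (𝟙 (inSpan? B v)) s) (sum-* (vecs bools r) s (λ v → 𝟙 (inSpan? B v))) ⟩
      s * sumOver (vecs bools r) (λ v → 𝟙 (inSpan? B v))
        ≡⟨ trans (*-comm s _) (cong (_* s) (sum-𝟙 (inSpan? B) (vecs bools r))) ⟩
      fromℕ (points B) * s
        ≤⟨ *-monoˡ (fromℕ (points B)) (0≤fromℕ (points B)) (sum-allInSpan K B) ⟩
      fromℕ (points B) ^ suc K ∎
      where
      open ≤-Reasoning
      s = sumOver (tuples K r) (λ τ → 𝟙 (allInSpan? B τ))
      heads : ∀ {r} (v : Vec Bool r) (τ : Vec (Vec Bool K) r) → Vec.map Vec.head (zipWith _∷_ v τ) ≡ v
      heads []      []      = refl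
      heads (b ∷ v) (S ∷ τ) = cong (b ∷_) (heads v τ)
      tails : ∀ {r} (v : Vec Bool r) (τ : Vec (Vec Bool K) r) → Vec.map Vec.tail (zipWith _∷_ v τ) ≡ τ
      tails []      []      = refl
      tails (b ∷ v) (S ∷ τ) = cong (S ∷_) (tails v τ)
      columns-zip : ∀ v τ → columns (zipWith _∷_ v τ) ≡ v ∷ columns τ
      columns-zip v τ = cong₂ _∷_ (heads v τ) (cong columns (tails v τ))
      split : ∀ v τ → 𝟙 (allInSpan? B (zipWith _∷_ v τ)) ≡ 𝟙 (inSpan? B v) * 𝟙 (allInSpan? B τ)
      split v τ = trans (𝟙-cong (allInSpan? B (zipWith _∷_ v τ)) (inSpan? B v ×-dec allInSpan? B τ)
          (λ all → case subst (All _) (columns-zip v τ) all of λ { (s ∷ ss) → s , ss })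
          (λ (s , ss) → subst (All _) (sym (columns-zip v τ)) (s ∷ ss)))
        (𝟙-× (inSpan? B v) (allInSpan? B τ))

    small? : Decidable (λ B → 4 ℕ.* points B ℕ.≤ 3 ℕ.* 2 ℕ.^ length B)
    small? B = 4 ℕ.* points B ℕ.≤? 3 ℕ.* 2 ℕ.^ length B

    -- B ranges over the possible bases, of d vectors besides the all-ones vector, of the
    -- space generated by the columns of τ.
    excess : ∀ {K} → ℕ → Vec (Vec Bool K) r → List (Vec Bool r) → ℚ
    excess d τ B = ι ^ suc d * (𝟙 (small? (B ⁺)) * 𝟙 (allInSpan? (B ⁺) τ))

    0≤excess : ∀ {K} d (τ : Vec (Vec Bool K) r) B → 0ℚ ≤ excess d τ B
    0≤excess d τ B = *-nonNeg (^-nonNeg 0≤ι (suc d))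
      (*-nonNeg (0≤𝟙 (small? (B ⁺))) (0≤𝟙 (allInSpan? (B ⁺) τ)))

    -- A union bound over all candidate bases: unlike the basis of `τ` they do not depend on `τ`, so
    -- the sum over tuples can be carried out first.
    totalExcess : ∀ {K} → Vec (Vec Bool K) r → ℚ
    totalExcess τ = sumOver (List.upTo r) (λ d → sumOver (words (vecs bools r) d) (excess d τ))

    0≤totalExcess : ∀ {K} (τ : Vec (Vec Bool K) r) → 0ℚ ≤ totalExcess τ
    0≤totalExcess τ = sum-nonNeg (List.upTo r) λ d → sum-nonNeg (words (vecs bools r) d) (0≤excess d τ)

    columns-injective : ∀ {K} (τ : Vec (Vec Bool K) r) i j →
      (∀ v → v ∈ columns τ → lookup v i ≡ lookup v j) → lookup τ i ≡ lookup τ j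
    columns-injective {zero}  τ i j eq with lookup τ i | lookup τ j
    ... | [] | [] = refl
    columns-injective {suc K} τ i j eq = uncons (lookup τ i) (lookup τ j)
      (trans (sym (Vec.lookup-map i Vec.head τ)) (trans (eq _ (here refl)) (Vec.lookup-map j Vec.head τ)))
      (trans (sym (Vec.lookup-map i Vec.tail τ)) (trans
        (columns-injective (Vec.map Vec.tail τ) i j (λ v v∈ → eq v (there v∈))) (Vec.lookup-map j Vec.tail τ)))
      where
      uncons : ∀ (v w : Vec Bool (suc K)) → Vec.head v ≡ Vec.head w → Vec.tail v ≡ Vec.tail w → v ≡ w
      uncons (_ ∷ _) (_ ∷ _) = cong₂ _∷_

    along-∈ : ∀ {A C : Set} (h : A → Fin r → C) {B u} → u ∈ B → ∃[ t ] ∀ i → lookup (along (λ u → h u i) B) t ≡ h u i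
    along-∈ h (here refl) = Fin.zero , λ i → refl
    along-∈ h (there u∈)  with along-∈ h u∈
    ... | t , eq = Fin.suc t , eq

    Distinct : ∀ {K} → Vec (Vec Bool K) r → Set
    Distinct τ = ∀ i j → lookup τ i ≡ lookup τ j → i ≡ j

    -- Every column is a combination of the basis, so equal rows `i` and `j` of the basis would make
    -- rows `i` and `j` of `τ` equal. The all-ones vector provides the coordinate `t` of
    -- `cube-points`.
    small-basis : ∀ {K} (τ : Vec (Vec Bool K) r) → Distinct τ → let B = basis (columns τ) in
      trues ∈ B → length B ℕ.< r → 4 ℕ.* points B ℕ.≤ 3 ℕ.* 2 ℕ.^ length B
    small-basis τ distinct trues∈ b<r = cube-points B
      (λ i j eq → distinct i j (columns-injective τ i j λ v v∈ → bit-injective _ _ (begin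
        bit (lookup v i) ≡⟨ sym (Vec.lookup-map i bit v) ⟩
        lookup (emb v) i ≡⟨ proj₂ (coordinates v∈) i ⟩
        dot (proj₁ (coordinates v∈)) (row B i) ≡⟨ cong (dot (proj₁ (coordinates v∈))) eq ⟩
        dot (proj₁ (coordinates v∈)) (row B j) ≡⟨ sym (proj₂ (coordinates v∈) j) ⟩
        lookup (emb v) j ≡⟨ Vec.lookup-map j bit v ⟩
        bit (lookup v j) ∎)))
      (case along-∈ (λ u i → lookup (emb u) i) trues∈ of λ (t , eq) → t , λ i → trans (eq i)
        (trans (Vec.lookup-map i bit trues) (cong bit (Vec.lookup-replicate i true))))
      b<r
      where
      open ≡-Reasoning
      B = basis (columns τ)
      coordinates : ∀ {v} → v ∈ columns τ → _
      coordinates v∈ = span-lookup B (basis-spans (columns τ) v∈)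

  -- The all-ones vector is the last column and is nonzero because there is at least one row;
  -- `basis` therefore keeps it.
  basis-trues : ∀ {K r} (τ : Vec (Vec Bool K) (suc r)) → ∃[ B ] Family.basis emb (columns τ) ≡ B ⁺
  basis-trues {zero} {r} τ = [] , Family.basis-new (emb {suc r}) {us = []} λ eq → contradiction (Vec.∷-injectiveˡ eq) 1≢0
  basis-trues {suc K} {r} τ = case span? (basis us) (emb u) of λ
    { (yes s) → proj₁ rest , trans (basis-old {u} {us} s) (proj₂ rest)
    ; (no ¬s) → u ∷ proj₁ rest , trans (basis-new {u} {us} ¬s) (cong (u ∷_) (proj₂ rest)) }
    where
    open Family (emb {suc r})
    u = Vec.map Vec.head τ
    us = columns (Vec.map Vec.tail τ)
    rest = basis-trues (Vec.map Vec.tail τ)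

  -- A tuple of full rank has no error. Otherwise its own basis occurs among the candidates with
  -- both indicators equal to 1 and contributes `ι ^ rank τ`, which dominates the difference.
  probability-error : ∀ {K r} (τ : Vec (Vec Bool K) r) → Distinct τ →
    ∣ ι ^ rank τ - ι ^ r ∣ ≤ totalExcess τ
  probability-error {K} {zero} τ distinct = subst (λ b → ∣ ι ^ b - 1ℚ ∣ ≤ totalExcess τ) (sym b≡0) (0≤totalExcess τ)
    where
    open Family (emb {0})
    b≡0 : length (basis (columns τ)) ≡ 0
    b≡0 = ℕ.n≤0⇒n≡0 (independent-length 1<p _ (basis-independent (columns τ)))
  probability-error {K} {suc r} τ distinct with ℕ.m≤n⇒m<n∨m≡n (Family.independent-length emb 1<p _ (Family.basis-independent (emb {suc r}) (columns τ)))
  ... | inj₂ b≡r = subst (λ b → ∣ ι ^ b - ι ^ suc r ∣ ≤ totalExcess τ) (sym b≡r)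
                     (subst (_≤ totalExcess τ) (sym (∣p-p∣≡0 (ι ^ suc r))) (0≤totalExcess τ))
  ... | inj₁ b<r = begin
    ∣ ι ^ b - ι ^ suc r ∣ ≤⟨ ∣p-q∣≤p (^-nonNeg 0≤ι (suc r)) (^-antiʳ 0≤ι ι≤1 (ℕ.<⇒≤ b<r)) ⟩
    ι ^ b ≡⟨ cong (ι ^_) b≡d ⟩
    ι ^ suc d ≡⟨ sym (trans (cong (ι ^ suc d *_) (cong₂ _*_ (𝟙-yes (small? (B′ ⁺)) small) (𝟙-yes (allInSpan? (B′ ⁺) τ) all))) (*-identityʳ (ι ^ suc d))) ⟩
    excess d τ B′ ≤⟨ ∈⇒≤sum (0≤excess d τ) (∈-words (∈-vecs ∈-bools) B′) ⟩
    sumOver (words (vecs bools (suc r)) d) (excess d τ)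
      ≤⟨ ∈⇒≤sum {h = λ d → sumOver (words (vecs bools (suc r)) d) (excess d τ)}
           (λ d → sum-nonNeg (words (vecs bools (suc r)) d) (0≤excess d τ))
           (∈-upTo⁺ (ℕ.<-trans (ℕ.≤-reflexive (sym b≡d)) b<r)) ⟩
    totalExcess τ ∎
    where
    open ≤-Reasoning
    open Family (emb {suc r})
    B = basis (columns τ)
    b = length B
    B′ = proj₁ (basis-trues τ)
    B≡ = proj₂ (basis-trues τ)
    d = length B′
    b≡d : b ≡ suc d
    b≡d = trans (cong length B≡) (trans (List.length-++ B′) (ℕ.+-comm d 1))
    small : 4 ℕ.* points (B′ ⁺) ℕ.≤ 3 ℕ.* 2 ℕ.^ length (B′ ⁺)
    small = subst (λ B → 4 ℕ.* points B ℕ.≤ 3 ℕ.* 2 ℕ.^ length B) B≡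
      (small-basis τ distinct (subst (trues ∈_) (sym B≡) (∈-++⁺ʳ B′ (here refl))) b<r)
    all : All (λ v → Span (B′ ⁺) (emb v)) (columns τ)
    all = All.tabulate λ v∈ → subst (λ B → Span B (emb _)) B≡ (basis-spans (columns τ) v∈)

  -- The number of candidates times their weight regroups into `2ℚ ^ (r d)`, a power of the mean
  -- `ι * 2ℚ ^ K` and `¾ ^ K`. As `r` and `suc d` are at most `M`, the first two factors are each at
  -- most `2ℚ ^ (M * M)`.
  sum-excess : ∀ K r d {M} → 1 ℕ.≤ M → r ℕ.≤ M → d ℕ.< r → ι * 2ℚ ^ K ≤ 2ℚ ^ M →
    sumOver (words (vecs bools r) d) (λ B → sumOver (tuples K r) (λ τ → excess d τ B))
      ≤ 2ℚ ^ (2 ℕ.* (M ℕ.* M)) * ¾ ^ K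
  sum-excess K r d {M} 1≤M r≤M d<r Y≤ = begin
    sumOver (words (vecs bools r) d) (λ B → sumOver (tuples K r) (λ τ → excess d τ B))
      ≤⟨ sum-mono∈ (words (vecs bools r) d) each ⟩
    sumOver (words (vecs bools r) d) (λ _ → c)
      ≡⟨ trans (sum-const (words (vecs bools r) d) c) (cong (λ n → fromℕ n * c)
           (trans (length-words (vecs bools r) d) (cong (ℕ._^ d) (length-vecs bools r)))) ⟩
    fromℕ ((2 ℕ.^ r) ℕ.^ d) * c ≡⟨ cong (_* c) (trans (cong fromℕ (ℕ.^-*-assoc 2 r d)) (fromℕ-^ 2 (r ℕ.* d))) ⟩
    2ℚ ^ (r ℕ.* d) * (ι ^ suc d * (¾ * 2ℚ ^ suc d) ^ K) ≡⟨ cong (2ℚ ^ (r ℕ.* d) *_) rearrange ⟩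
    2ℚ ^ (r ℕ.* d) * ((ι * 2ℚ ^ K) ^ suc d * ¾ ^ K)
      ≤⟨ *-mono (0≤2ℚ^ (r ℕ.* d)) (*-nonNeg (0≤2ℚ^ (M ℕ.* M)) (0≤¾^ K))
           (^-monoʳ 1≤2ℚ (ℕ.*-mono-≤ r≤M (ℕ.≤-trans (ℕ.<⇒≤ d<r) r≤M)))
           (*-monoʳ (¾ ^ K) (0≤¾^ K) powers) ⟩
    2ℚ ^ (M ℕ.* M) * (2ℚ ^ (M ℕ.* M) * ¾ ^ K)
      ≡⟨ trans (sym (*-assoc (2ℚ ^ (M ℕ.* M)) (2ℚ ^ (M ℕ.* M)) (¾ ^ K)))
           (cong (_* ¾ ^ K) (trans (sym (^-homo-* 2ℚ (M ℕ.* M) (M ℕ.* M)))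
             (cong (2ℚ ^_) (cong (M ℕ.* M ℕ.+_) (sym (ℕ.+-identityʳ (M ℕ.* M))))))) ⟩
    2ℚ ^ (2 ℕ.* (M ℕ.* M)) * ¾ ^ K ∎
    where
    open ≤-Reasoning
    c = ι ^ suc d * (¾ * 2ℚ ^ suc d) ^ K
    0≤ι^ = ^-nonNeg 0≤ι (suc d)
    0≤c : 0ℚ ≤ (¾ * 2ℚ ^ suc d) ^ K
    0≤c = ^-nonNeg (*-nonNeg (<⇒≤ 0<¾) (0≤2ℚ^ (suc d))) K
    each : ∀ B → B ∈ words (vecs bools r) d → sumOver (tuples K r) (λ τ → excess d τ B) ≤ c
    each B B∈ with small? (B ⁺)
    ... | no _  = ≤-trans (≤-reflexive (trans (sum-cong (tuples K r) λ τ →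
                    trans (cong (ι ^ suc d *_) (*-zeroˡ (𝟙 (allInSpan? (B ⁺) τ)))) (*-zeroʳ (ι ^ suc d)))
                    (sum-zero (tuples K r)))) (*-nonNeg 0≤ι^ 0≤c)
    ... | yes sm = begin
      sumOver (tuples K r) (λ τ → ι ^ suc d * (1ℚ * 𝟙 (allInSpan? B⁺ τ)))
        ≡⟨ trans (sum-cong (tuples K r) λ τ → cong (ι ^ suc d *_) (*-identityˡ (𝟙 (allInSpan? B⁺ τ))))
             (sum-* (tuples K r) (ι ^ suc d) (λ τ → 𝟙 (allInSpan? B⁺ τ))) ⟩
      ι ^ suc d * sumOver (tuples K r) (λ τ → 𝟙 (allInSpan? B⁺ τ))
        ≤⟨ *-monoˡ (ι ^ suc d) 0≤ι^ (≤-trans (sum-allInSpan K B⁺) (^-monoˡ (0≤fromℕ (points B⁺))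
             (subst (λ x → fromℕ (points B⁺) ≤ ¾ * x) (trans (cong (λ n → fromℕ (2 ℕ.^ n)) len) (fromℕ-^ 2 (suc d)))
               (4W≤3X⇒W≤¾X (points B⁺) (2 ℕ.^ length B⁺) sm)) K)) ⟩
      c ∎
      where
      B⁺ = B ⁺
      len : length B⁺ ≡ suc d
      len = trans (List.length-++ B) (trans (ℕ.+-comm (length B) 1) (cong suc (length-∈-words d B∈)))
    rearrange : ι ^ suc d * (¾ * 2ℚ ^ suc d) ^ K ≡ (ι * 2ℚ ^ K) ^ suc d * ¾ ^ K
    rearrange = begin-equality
      ι ^ suc d * (¾ * 2ℚ ^ suc d) ^ K ≡⟨ cong (ι ^ suc d *_) (^-distrib-* ¾ (2ℚ ^ suc d) K) ⟩
      ι ^ suc d * (¾ ^ K * (2ℚ ^ suc d) ^ K) ≡⟨ cong (λ x → ι ^ suc d * (¾ ^ K * x))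
                                                      (trans (^-assocʳ 2ℚ (suc d) K) (trans (cong (2ℚ ^_) (ℕ.*-comm (suc d) K)) (sym (^-assocʳ 2ℚ K (suc d))))) ⟩
      ι ^ suc d * (¾ ^ K * (2ℚ ^ K) ^ suc d) ≡⟨ solve 3 (λ i q t → i :* (q :* t) := (i :* t) :* q) refl (ι ^ suc d) (¾ ^ K) ((2ℚ ^ K) ^ suc d) ⟩
      (ι ^ suc d * (2ℚ ^ K) ^ suc d) * ¾ ^ K ≡⟨ cong (_* ¾ ^ K) (sym (^-distrib-* ι (2ℚ ^ K) (suc d))) ⟩
      (ι * 2ℚ ^ K) ^ suc d * ¾ ^ K ∎
    powers : (ι * 2ℚ ^ K) ^ suc d ≤ 2ℚ ^ (M ℕ.* M)
    powers = begin
      (ι * 2ℚ ^ K) ^ suc d ≤⟨ ^-monoˡ (*-nonNeg 0≤ι (0≤2ℚ^ K)) Y≤ (suc d) ⟩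
      (2ℚ ^ M) ^ suc d ≡⟨ ^-assocʳ 2ℚ M (suc d) ⟩
      2ℚ ^ (M ℕ.* suc d) ≤⟨ ^-monoʳ 1≤2ℚ (ℕ.*-monoʳ-≤ M (ℕ.≤-trans d<r r≤M)) ⟩
      2ℚ ^ (M ℕ.* M) ∎

  sum-totalExcess : ∀ K r {M} → 1 ℕ.≤ M → r ℕ.≤ M → ι * 2ℚ ^ K ≤ 2ℚ ^ M →
    sumOver (tuples K r) totalExcess ≤ 2ℚ ^ M * (2ℚ ^ (2 ℕ.* (M ℕ.* M)) * ¾ ^ K)
  sum-totalExcess K r {M} 1≤M r≤M Y≤ = begin
    sumOver (tuples K r) totalExcess
      ≡⟨ sum-swap (tuples K r) (List.upTo r) (λ τ d → sumOver (words (vecs bools r) d) (excess d τ)) ⟩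
    sumOver (List.upTo r) (λ d → sumOver (tuples K r) (λ τ → sumOver (words (vecs bools r) d) (excess d τ)))
      ≡⟨ sum-cong (List.upTo r) (λ d → sum-swap (tuples K r) (words (vecs bools r) d) (λ τ B → excess d τ B)) ⟩
    sumOver (List.upTo r) (λ d → sumOver (words (vecs bools r) d) (λ B → sumOver (tuples K r) (λ τ → excess d τ B)))
      ≤⟨ sum-mono∈ (List.upTo r) (λ d d∈ → sum-excess K r d 1≤M r≤M (∈-upTo⁻ d∈) Y≤) ⟩
    sumOver (List.upTo r) (λ _ → ε) ≡⟨ trans (sum-const (List.upTo r) ε) (cong (λ n → fromℕ n * ε) (List.length-upTo r)) ⟩
    fromℕ r * ε ≤⟨ *-monoʳ ε (*-nonNeg (0≤2ℚ^ (2 ℕ.* (M ℕ.* M))) (0≤¾^ K))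
                     (≤-trans (fromℕ-mono (ℕ.≤-trans r≤M (n≤2^n M))) (≤-reflexive (fromℕ-^ 2 M))) ⟩
    2ℚ ^ M * ε ∎
    where
    open ≤-Reasoning
    ε = 2ℚ ^ (2 ℕ.* (M ℕ.* M)) * ¾ ^ K

-- Second moment and Bonferroni inequalities

bind : ∀ {A B : Set} → Expectation A → (A → Expectation B) → Expectation B
bind E F = record
  { 𝔼      = λ h → 𝔼 E λ x → 𝔼 (F x) h
  ; 𝔼-mono = λ le → 𝔼-mono E λ x → 𝔼-mono (F x) le
  ; 𝔼-+    = λ h g → trans (𝔼-cong E λ x → 𝔼-+ (F x) h g) (𝔼-+ E (λ x → 𝔼 (F x) h) (λ x → 𝔼 (F x) g))
  ; 𝔼-*    = λ c h → trans (𝔼-cong E λ x → 𝔼-* (F x) c h) (𝔼-* E c (λ x → 𝔼 (F x) h))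
  ; 𝔼-1    = trans (𝔼-cong E λ x → 𝔼-1 (F x)) (𝔼-1 E)
  }

module _ {A : Set} (E : Expectation A) where

  𝔼-quadratic : ∀ h g t → 𝔼 E (λ x → (h x * h x + (- (2ℚ * t)) * h x) + (t * t) * g x)
    ≡ (𝔼 E (λ x → h x * h x) + (- (2ℚ * t)) * 𝔼 E h) + (t * t) * 𝔼 E g
  𝔼-quadratic h g t = trans (𝔼-+ E (λ x → h x * h x + (- (2ℚ * t)) * h x) (λ x → (t * t) * g x))
    (cong₂ _+_ (trans (𝔼-+ E (λ x → h x * h x) (λ x → (- (2ℚ * t)) * h x))
      (cong (𝔼 E (λ x → h x * h x) +_) (𝔼-* E (- (2ℚ * t)) h))) (𝔼-* E (t * t) g))

  -- The variance `𝔼 (h - 𝔼 h)²` is nonnegative.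
  𝔼-square : ∀ h → 𝔼 E h * 𝔼 E h ≤ 𝔼 E (λ x → h x * h x)
  𝔼-square h = p-q≥0⁻¹ (subst (0ℚ ≤_) (trans (𝔼-quadratic h (λ _ → 1ℚ) t)
      (trans (cong (λ o → (𝔼 E (λ x → h x * h x) + (- (2ℚ * t)) * t) + (t * t) * o) (𝔼-1 E))
        (solve 2 (λ s t → (s :+ (:- (con 2ℚ :* t)) :* t) :+ (t :* t) :* con 1ℚ := s :- t :* t) refl (𝔼 E (λ x → h x * h x)) t)))
    (𝔼-nonNeg E λ x → subst (0ℚ ≤_)
      (solve 2 (λ h t → (h :- t) :* (h :- t) := (h :* h :+ (:- (con 2ℚ :* t)) :* h) :+ (t :* t) :* con 1ℚ) refl (h x) t)
      (0≤sq (h x - t))))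
    where t = 𝔼 E h

  -- Expand 𝔼 (h - t s)² ≥ 0 for t = 3/2 𝔼 h.
  support-large : ∀ h (s : A → ℚ) → (∀ x → (s x ≡ 0ℚ × h x ≡ 0ℚ) ⊎ s x ≡ 1ℚ) → 0ℚ < 𝔼 E h →
    𝔼 E (λ x → h x * h x) ≤ (ℤ.+ 3 / 2) * (𝔼 E h * 𝔼 E h) → ℤ.+ 2 / 3 ≤ 𝔼 E s
  support-large h s dichotomy 0<H second = ℚ.*-cancelˡ-≤-pos c {{positive (*-pos (positive⁻¹ (ℤ.+ 9 / 4)) (*-pos 0<H 0<H))}}
    (p-q≥0⁻¹ (subst (0ℚ ≤_)
      (solve 2 (λ H s → (con (ℤ.+ 3 / 2) :* (H :* H) :+ (:- (con 2ℚ :* (con (ℤ.+ 3 / 2) :* H))) :* H)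
            :+ ((con (ℤ.+ 3 / 2) :* H) :* (con (ℤ.+ 3 / 2) :* H)) :* s
          := (con (ℤ.+ 9 / 4) :* (H :* H)) :* s :- (con (ℤ.+ 9 / 4) :* (H :* H)) :* con (ℤ.+ 2 / 3)) refl H (𝔼 E s))
      (≤-trans (subst (0ℚ ≤_) (𝔼-quadratic h s t) (𝔼-nonNeg E pointwise))
        (+-monoˡ-≤ ((t * t) * 𝔼 E s) (+-monoˡ-≤ ((- (2ℚ * t)) * H) second)))))
    where
    H = 𝔼 E h
    t = (ℤ.+ 3 / 2) * H
    c = (ℤ.+ 9 / 4) * (H * H)
    pointwise : ∀ x → 0ℚ ≤ (h x * h x + (- (2ℚ * t)) * h x) + (t * t) * s x
    pointwise x with dichotomy x
    ... | inj₁ (s≡0 , h≡0) rewrite s≡0 | h≡0 = ≤-reflexive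
          (solve 1 (λ t → con 0ℚ := (con 0ℚ :* con 0ℚ :+ (:- (con 2ℚ :* t)) :* con 0ℚ) :+ (t :* t) :* con 0ℚ) refl t)
    ... | inj₂ s≡1 rewrite s≡1 = subst (0ℚ ≤_)
          (solve 2 (λ h t → (h :- t) :* (h :- t) := (h :* h :+ (:- (con 2ℚ :* t)) :* h) :+ (t :* t) :* con 1ℚ) refl (h x) t)
          (0≤sq (h x - t))

choose : ℕ → ℕ → ℕ
choose n       zero    = 1
choose zero    (suc r) = 0
choose (suc n) (suc r) = choose n r ℕ.+ choose n (suc r)

-1ℚ : ℚ
-1ℚ = - 1ℚ

-- Inclusion-exclusion for a point that lies in `n` of the events, cut off after order `r`.
alternating : ℕ → ℕ → ℚ
alternating n zero    = 1ℚ
alternating n (suc r) = alternating n r + -1ℚ ^ suc r * fromℕ (choose n (suc r))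

alternating-zero : ∀ r → alternating 0 r ≡ 1ℚ
alternating-zero zero    = refl
alternating-zero (suc r) = trans (cong₂ _+_ (alternating-zero r) (*-zeroʳ (-1ℚ ^ suc r))) (+-identityʳ 1ℚ)

-- By Pascal's rule the truncated sum telescopes. This exhibits both the sign and the size of the
-- truncation error, from which the two Bonferroni bounds follow.
alternating-suc : ∀ n r → alternating (suc n) r ≡ -1ℚ ^ r * fromℕ (choose n r)
alternating-suc n zero    = refl
alternating-suc n (suc r) = trans (cong₂ (λ x y → x + -1ℚ ^ suc r * y) (alternating-suc n r) (fromℕ-+ (choose n r) (choose n (suc r))))
  (solve 3 (λ s x y → s :* x :+ (con -1ℚ :* s) :* (x :+ y) := (con -1ℚ :* s) :* y) refl (-1ℚ ^ r) (fromℕ (choose n r)) (fromℕ (choose n (suc r))))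

4ℚ : ℚ
4ℚ = fromℕ 4

-- An exponential is easy to average: `𝔼 4^n` is explicit under the binomial law. Pascal's rule
-- produces the factor 3/2 in the induction, where 2 is available.
choose-bound : ∀ n r → fromℕ (choose n r) ≤ ½ ^ r * 4ℚ ^ n
choose-bound zero    zero    = ≤-refl
choose-bound zero    (suc r) = *-nonNeg (0≤½ℚ^ (suc r)) (<⇒≤ 0<1)
choose-bound (suc n) zero    = ≤-trans (^-monoʳ {4ℚ} (fromℕ-mono {1} {4} (s≤s z≤n)) {0} {suc n} z≤n) (≤-reflexive (sym (*-identityˡ (4ℚ ^ suc n))))
choose-bound (suc n) (suc r) = begin
  fromℕ (choose n r ℕ.+ choose n (suc r)) ≡⟨ fromℕ-+ (choose n r) (choose n (suc r)) ⟩
  fromℕ (choose n r) + fromℕ (choose n (suc r)) ≤⟨ +-mono-≤ (choose-bound n r) (choose-bound n (suc r)) ⟩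
  ½ ^ r * 4ℚ ^ n + ½ * ½ ^ r * 4ℚ ^ n
    ≡⟨ solve 2 (λ x y → x :* y :+ con ½ :* x :* y := con (ℤ.+ 3 / 2) :* (x :* y)) refl (½ ^ r) (4ℚ ^ n) ⟩
  (ℤ.+ 3 / 2) * (½ ^ r * 4ℚ ^ n)
    ≤⟨ *-monoʳ (½ ^ r * 4ℚ ^ n) {ℤ.+ 3 / 2} {2ℚ} (*-nonNeg (0≤½ℚ^ r) (^-nonNeg (0≤fromℕ 4) n)) (*≤* (ℤ.+≤+ (ℕ.m≤m+n 3 1))) ⟩
  2ℚ * (½ ^ r * 4ℚ ^ n)
    ≡⟨ solve 2 (λ x y → con 2ℚ :* (x :* y) := (con ½ :* x) :* (con 4ℚ :* y)) refl (½ ^ r) (4ℚ ^ n) ⟩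
  ½ ^ suc r * 4ℚ ^ suc n ∎
  where open ≤-Reasoning

bonferroni-lower : ∀ {M} → -1ℚ ^ M ≡ 1ℚ → ∀ n → 𝟙 (n ℕ.≟ 0) ≤ alternating n M
bonferroni-lower {M} even zero    = ≤-reflexive (sym (alternating-zero M))
bonferroni-lower {M} even (suc n) = subst (0ℚ ≤_) (sym (alternating-suc n M))
  (*-nonNeg (subst (0ℚ ≤_) (sym even) (<⇒≤ 0<1)) (0≤fromℕ (choose n M)))

-- Applied under the binomial law only, where the error term has an explicit mean; for the true
-- number of hits `bonferroni-lower` suffices.
bonferroni-upper : ∀ {M} → -1ℚ ^ M ≡ 1ℚ → ∀ n → alternating n M ≤ 𝟙 (n ℕ.≟ 0) + ½ ^ M * 4ℚ ^ n
bonferroni-upper {M} even zero = subst (_≤ 1ℚ + ½ ^ M * 1ℚ) (trans (+-identityʳ 1ℚ) (sym (alternating-zero M)))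
  (+-monoʳ-≤ 1ℚ (*-nonNeg (0≤½ℚ^ M) (<⇒≤ 0<1)))
bonferroni-upper {M} even (suc n) = begin
  alternating (suc n) M ≡⟨ alternating-suc n M ⟩
  -1ℚ ^ M * fromℕ (choose n M) ≡⟨ trans (cong (_* fromℕ (choose n M)) even) (*-identityˡ (fromℕ (choose n M))) ⟩
  fromℕ (choose n M) ≤⟨ choose-bound n M ⟩
  ½ ^ M * 4ℚ ^ n ≤⟨ *-monoˡ (½ ^ M) (0≤½ℚ^ M) (^-monoʳ {4ℚ} (fromℕ-mono {1} {4} (s≤s z≤n)) (ℕ.n≤1+n n)) ⟩
  ½ ^ M * 4ℚ ^ suc n ≡⟨ sym (+-identityˡ (½ ^ M * 4ℚ ^ suc n)) ⟩
  0ℚ + ½ ^ M * 4ℚ ^ suc n ∎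
  where open ≤-Reasoning

combinations : ∀ {A : Set} → List A → ∀ r → List (Vec A r)
combinations L       zero    = [] ∷ []
combinations []      (suc r) = []
combinations (x ∷ L) (suc r) = List.map (x ∷_) (combinations L r) ++ combinations L (suc r)

module _ {A : Set} where

  sum-combinations : ∀ x (L : List A) r h → sumOver (combinations (x ∷ L) (suc r)) h
    ≡ sumOver (combinations L r) (h ∘ (x ∷_)) + sumOver (combinations L (suc r)) h
  sum-combinations x L r h = trans (sum-++ (List.map (x ∷_) (combinations L r)) (combinations L (suc r)) h)
    (cong (_+ sumOver (combinations L (suc r)) h) (sum-map (x ∷_) (combinations L r) h))

  sum-vecs-weaken : ∀ x (L : List A) r {h : Vec A r → ℚ} → (∀ τ → 0ℚ ≤ h τ) →
    sumOver (vecs L r) h ≤ sumOver (vecs (x ∷ L) r) h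
  sum-vecs-weaken x L zero    0≤h = ≤-refl
  sum-vecs-weaken x L (suc r) {h} 0≤h = begin
    sumOver (vecs L (suc r)) h ≡⟨ sum-product _∷_ L (vecs L r) h ⟩
    sumOver L (λ y → sumOver (vecs L r) (λ τ → h (y ∷ τ))) ≤⟨ sum-mono L (λ y → sum-vecs-weaken x L r (λ τ → 0≤h (y ∷ τ))) ⟩
    sumOver L (λ y → s y) ≡⟨ sym (+-identityˡ (sumOver L s)) ⟩
    0ℚ + sumOver L s ≤⟨ +-monoˡ-≤ (sumOver L s) (sum-nonNeg (vecs (x ∷ L) r) (λ τ → 0≤h (x ∷ τ))) ⟩
    s x + sumOver L s ≡⟨ sym (sum-product _∷_ (x ∷ L) (vecs (x ∷ L) r) h) ⟩
    sumOver (vecs (x ∷ L) (suc r)) h ∎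
    where
    open ≤-Reasoning
    s : A → ℚ
    s y = sumOver (vecs (x ∷ L) r) (λ τ → h (y ∷ τ))

  -- Tuples in arbitrary order and with repetitions only add nonnegative terms, and their columns
  -- vary independently, which `sum-rows` exploits.
  sum-combinations≤ : ∀ (L : List A) r {h : Vec A r → ℚ} → (∀ τ → 0ℚ ≤ h τ) →
    sumOver (combinations L r) h ≤ sumOver (vecs L r) h
  sum-combinations≤ L       zero    0≤h = ≤-refl
  sum-combinations≤ []      (suc r) 0≤h = ≤-refl
  sum-combinations≤ (x ∷ L) (suc r) {h} 0≤h = begin
    sumOver (combinations (x ∷ L) (suc r)) h ≡⟨ sum-combinations x L r h ⟩
    sumOver (combinations L r) (h ∘ (x ∷_)) + sumOver (combinations L (suc r)) h
      ≤⟨ +-mono-≤ (≤-trans (sum-combinations≤ L r (λ τ → 0≤h (x ∷ τ))) (sum-vecs-weaken x L r (λ τ → 0≤h (x ∷ τ))))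
           (≤-trans (sum-combinations≤ L (suc r) 0≤h) (≤-trans (≤-reflexive (sum-product _∷_ L (vecs L r) h))
             (sum-mono L (λ y → sum-vecs-weaken x L r (λ τ → 0≤h (y ∷ τ)))))) ⟩
    sumOver (vecs (x ∷ L) r) (h ∘ (x ∷_)) + sumOver L (λ y → sumOver (vecs (x ∷ L) r) (λ τ → h (y ∷ τ)))
      ≡⟨ sym (sum-product _∷_ (x ∷ L) (vecs (x ∷ L) r) h) ⟩
    sumOver (vecs (x ∷ L) (suc r)) h ∎
    where open ≤-Reasoning

  lookup-combinations : ∀ (L : List A) r {τ} → τ ∈ combinations L r → ∀ i → lookup τ i ∈ L
  lookup-combinations (x ∷ L) (suc r) τ∈ i with ∈-++⁻ (List.map (x ∷_) (combinations L r)) τ∈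
  ... | inj₂ τ∈′ = there (lookup-combinations L (suc r) τ∈′ i)
  ... | inj₁ τ∈′ with ∈-map⁻ (x ∷_) τ∈′
  lookup-combinations (x ∷ L) (suc r) τ∈ Fin.zero    | inj₁ τ∈′ | σ , σ∈ , refl = here refl
  lookup-combinations (x ∷ L) (suc r) τ∈ (Fin.suc i) | inj₁ τ∈′ | σ , σ∈ , refl = there (lookup-combinations L r σ∈ i)

  combinations-distinct : ∀ (L : List A) r {τ} → Unique L → τ ∈ combinations L r → ∀ i j → lookup τ i ≡ lookup τ j → i ≡ j
  combinations-distinct L zero u τ∈ () j
  combinations-distinct (x ∷ L) (suc r) (x∉ ∷ u) τ∈ i j eq with ∈-++⁻ (List.map (x ∷_) (combinations L r)) τ∈
  ... | inj₂ τ∈′ = combinations-distinct L (suc r) u τ∈′ i j eq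
  ... | inj₁ τ∈′ with ∈-map⁻ (x ∷_) τ∈′
  combinations-distinct (x ∷ L) (suc r) (x∉ ∷ u) τ∈ Fin.zero    Fin.zero    eq | inj₁ _ | σ , σ∈ , refl = refl
  combinations-distinct (x ∷ L) (suc r) (x∉ ∷ u) τ∈ Fin.zero    (Fin.suc j) eq | inj₁ _ | σ , σ∈ , refl =
    contradiction eq (All.lookup x∉ (lookup-combinations L r σ∈ j))
  combinations-distinct (x ∷ L) (suc r) (x∉ ∷ u) τ∈ (Fin.suc i) Fin.zero    eq | inj₁ _ | σ , σ∈ , refl =
    contradiction (sym eq) (All.lookup x∉ (lookup-combinations L r σ∈ i))
  combinations-distinct (x ∷ L) (suc r) (x∉ ∷ u) τ∈ (Fin.suc i) (Fin.suc j) eq | inj₁ _ | σ , σ∈ , refl =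
    cong Fin.suc (combinations-distinct L r u σ∈ i j eq)

  product𝟙 : ∀ {P : A → Set} → Decidable P → ∀ {r} → Vec A r → ℚ
  product𝟙 P? []      = 1ℚ
  product𝟙 P? (x ∷ τ) = 𝟙 (P? x) * product𝟙 P? τ

  -- Turns a factorial moment into a sum over subfamilies of size `r`, so that the mean can be taken
  -- term by term.
  choose-count : ∀ {P : A → Set} (P? : Decidable P) L r →
    fromℕ (choose (count P? L) r) ≡ sumOver (combinations L r) (product𝟙 P?)
  choose-count P? L       zero    = refl
  choose-count P? []      (suc r) = refl
  choose-count P? (x ∷ L) (suc r) = trans (step (P? x)) (sym (trans (sum-combinations x L r (product𝟙 P?))
    (cong (_+ sumOver (combinations L (suc r)) (product𝟙 P?)) (sum-* (combinations L r) (𝟙 (P? x)) (product𝟙 P?)))))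
    where
    c = sumOver (combinations L (suc r)) (product𝟙 P?)
    step : Dec _ → fromℕ (choose (count P? (x ∷ L)) (suc r)) ≡ 𝟙 (P? x) * sumOver (combinations L r) (product𝟙 P?) + c
    step (yes Px) = trans (cong (λ l → fromℕ (choose (length l) (suc r))) (List.filter-accept P? Px))
      (trans (fromℕ-+ (choose (count P? L) r) (choose (count P? L) (suc r)))
        (cong₂ _+_ (trans (choose-count P? L r) (sym (trans (cong (_* s) (𝟙-yes (P? x) Px)) (*-identityˡ s)))) (choose-count P? L (suc r))))
      where s = sumOver (combinations L r) (product𝟙 P?)
    step (no ¬Px) = trans (cong (λ l → fromℕ (choose (length l) (suc r))) (List.filter-reject P? ¬Px))
      (trans (choose-count P? L (suc r)) (sym (trans (cong (λ z → z * s + c) (𝟙-no (P? x) ¬Px)) (trans (cong (_+ c) (*-zeroˡ s)) (+-identityˡ c)))))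
      where s = sumOver (combinations L r) (product𝟙 P?)

-- The binomial law, for comparison

module Binomial (ι : ℚ) (0≤ι : 0ℚ ≤ ι) (ι≤1 : ι ≤ 1ℚ) where

  ρ : ℚ
  ρ = 1ℚ - ι

  0≤ρ : 0ℚ ≤ ρ
  0≤ρ = p-q≥0 ι≤1

  binomial : ℕ → Expectation ℕ
  binomial zero    = dirac 0
  binomial (suc N) = record
    { 𝔼      = λ h → ρ * 𝔼 B h + ι * 𝔼 B (h ∘ suc)
    ; 𝔼-mono = λ le → +-mono-≤ (*-monoˡ ρ 0≤ρ (𝔼-mono B le)) (*-monoˡ ι 0≤ι (𝔼-mono B (le ∘ suc)))
    ; 𝔼-+    = λ h g → trans (cong₂ (λ x y → ρ * x + ι * y) (𝔼-+ B h g) (𝔼-+ B (h ∘ suc) (g ∘ suc)))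
                 (solve 6 (λ r i a b c d → r :* (a :+ b) :+ i :* (c :+ d) := (r :* a :+ i :* c) :+ (r :* b :+ i :* d)) refl
                   ρ ι (𝔼 B h) (𝔼 B g) (𝔼 B (h ∘ suc)) (𝔼 B (g ∘ suc)))
    ; 𝔼-*    = λ c h → trans (cong₂ (λ x y → ρ * x + ι * y) (𝔼-* B c h) (𝔼-* B c (h ∘ suc)))
                 (solve 5 (λ r i c a b → r :* (c :* a) :+ i :* (c :* b) := c :* (r :* a :+ i :* b)) refl
                   ρ ι c (𝔼 B h) (𝔼 B (h ∘ suc)))
    ; 𝔼-1    = trans (cong₂ (λ x y → ρ * x + ι * y) (𝔼-1 B) (𝔼-1 B))
                 (solve 1 (λ i → (con 1ℚ :- i) :* con 1ℚ :+ i :* con 1ℚ := con 1ℚ) refl ι)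
    }
    where B = binomial N

  binomial-zero : ∀ N → 𝔼 (binomial N) (λ n → 𝟙 (n ℕ.≟ 0)) ≡ ρ ^ N
  binomial-zero zero    = refl
  binomial-zero (suc N) = trans (cong₂ (λ x y → ρ * x + ι * y) (binomial-zero N) (𝔼-const (binomial N) 0ℚ))
    (trans (cong (ρ * ρ ^ N +_) (*-zeroʳ ι)) (+-identityʳ (ρ * ρ ^ N)))

  binomial-4^ : ∀ N → 𝔼 (binomial N) (4ℚ ^_) ≡ (1ℚ + fromℕ 3 * ι) ^ N
  binomial-4^ zero    = refl
  binomial-4^ (suc N) = trans (cong₂ (λ x y → ρ * x + ι * y) (binomial-4^ N) (trans (𝔼-* (binomial N) 4ℚ (4ℚ ^_)) (cong (4ℚ *_) (binomial-4^ N))))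
    (solve 2 (λ i y → (con 1ℚ :- i) :* y :+ i :* (con 4ℚ :* y) := (con 1ℚ :+ con (fromℕ 3) :* i) :* y) refl ι ((1ℚ + fromℕ 3 * ι) ^ N))

  -- The right side stays a sum over `combinations`, so that `choose-error` can compare it term by
  -- term with `law-choose`.
  binomial-choose : ∀ {A : Set} (L : List A) r →
    𝔼 (binomial (length L)) (λ n → fromℕ (choose n r)) ≡ sumOver (combinations L r) (λ _ → ι ^ r)
  binomial-choose L       zero    = trans (𝔼-1 (binomial (length L))) (sym (+-identityʳ 1ℚ))
  binomial-choose []      (suc r) = refl
  binomial-choose (x ∷ L) (suc r) = begin
    ρ * 𝔼 B (λ n → fromℕ (choose n (suc r))) + ι * 𝔼 B (λ n → fromℕ (choose n r ℕ.+ choose n (suc r)))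
      ≡⟨ cong (λ z → ρ * b + ι * z) (trans (𝔼-cong B λ n → fromℕ-+ (choose n r) (choose n (suc r)))
           (𝔼-+ B (λ n → fromℕ (choose n r)) (λ n → fromℕ (choose n (suc r))))) ⟩
    ρ * b + ι * (a + b) ≡⟨ solve 3 (λ i a b → (con 1ℚ :- i) :* b :+ i :* (a :+ b) := i :* a :+ b) refl ι a b ⟩
    ι * a + b ≡⟨ cong₂ (λ x y → ι * x + y) (binomial-choose L r) (binomial-choose L (suc r)) ⟩
    ι * sumOver (combinations L r) (λ _ → ι ^ r) + sumOver (combinations L (suc r)) (λ _ → ι ^ suc r)
      ≡⟨ cong (_+ sumOver (combinations L (suc r)) (λ _ → ι ^ suc r)) (sym (sum-* (combinations L r) ι (λ _ → ι ^ r))) ⟩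
    sumOver (combinations L r) (λ _ → ι ^ suc r) + sumOver (combinations L (suc r)) (λ _ → ι ^ suc r)
      ≡⟨ sym (sum-combinations x L r (λ _ → ι ^ suc r)) ⟩
    sumOver (combinations (x ∷ L) (suc r)) (λ _ → ι ^ suc r) ∎
    where
    open ≡-Reasoning
    B = binomial (length L)
    a = 𝔼 B (λ n → fromℕ (choose n r))
    b = 𝔼 B (λ n → fromℕ (choose n (suc r)))

∣sum∣≤sum : ∀ {A : Set} xs (h g : A → ℚ) → ∣ sumOver xs h - sumOver xs g ∣ ≤ sumOver xs (λ x → ∣ h x - g x ∣)
∣sum∣≤sum []       h g = ≤-refl
∣sum∣≤sum (x ∷ xs) h g = ≤-trans (∣+-+∣ (h x) (sumOver xs h) (g x) (sumOver xs g)) (+-monoʳ-≤ ∣ h x - g x ∣ (∣sum∣≤sum xs h g))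

-- Elements missed by the subset sums of a random sequence

module Coverage {p : ℕ} (pr : Prime p) (2<p : 2 ℕ.< p) where

  open Solutions pr 2<p
  open Dependence pr 2<p
  open Binomial ι 0≤ι ι≤1

  -- The number of S with x + Σ S = 0: the sign makes the condition a homogeneous system.
  representations : ∀ {K} → V K → Fin p → ℕ
  representations []       x with x Fin.≟ 𝟘
  ... | yes _ = 1
  ... | no  _ = 0
  representations (a ∷ as) x = representations as (x ⊕ a) ℕ.+ representations as x

  missed : ∀ {K} → V K → Fin p → ℚ
  missed as x = 𝟙 (representations as x ℕ.≟ 0)

  missedDensity : ∀ {K} → V K → ℚ
  missedDensity as = 𝔼 uniform (missed as)

  missed-∷ : ∀ {K} a (as : V K) x → missed (a ∷ as) x ≡ missed as x * missed as (x ⊕ a)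
  missed-∷ a as x with representations as (x ⊕ a) | representations as x
  ... | zero  | zero  = refl
  ... | zero  | suc n = refl
  ... | suc m | zero  = refl
  ... | suc m | suc n = refl

  sum-translate : ∀ x (h : Fin p → ℚ) → sumOver (allFin p) (λ a → h (x ⊕ a)) ≡ sumOver (allFin p) h
  sum-translate x h = begin
    sumOver (allFin p) (λ a → h (x ⊕ a))
      ≡⟨ sum-cong (allFin p) (λ a → sym (sum-dirac (λ y → y Fin.≟ x ⊕ a) h (Unique.allFin⁺ p) (∈-allFin (x ⊕ a)) refl (λ y eq → eq))) ⟩
    sumOver (allFin p) (λ a → sumOver (allFin p) (λ y → 𝟙 (y Fin.≟ x ⊕ a) * h y))
      ≡⟨ sum-swap (allFin p) (allFin p) (λ a y → 𝟙 (y Fin.≟ x ⊕ a) * h y) ⟩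
    sumOver (allFin p) (λ y → sumOver (allFin p) (λ a → 𝟙 (y Fin.≟ x ⊕ a) * h y))
      ≡⟨ sum-cong (allFin p) (λ y → trans (sum-cong (allFin p) (λ a → *-comm (𝟙 (y Fin.≟ x ⊕ a)) (h y)))
           (trans (sum-* (allFin p) (h y) (λ a → 𝟙 (y Fin.≟ x ⊕ a)))
             (trans (cong (h y *_) (sum-𝟙-unique (λ a → y Fin.≟ x ⊕ a) (Unique.allFin⁺ p) (∈-allFin (y ⊕ ⊖ x)) (solution y)
               (λ a eq → +ᶠ-cancelˡ a (y ⊕ ⊖ x) x (trans (sym eq) (solution y))))) (*-identityʳ (h y))))) ⟩
    sumOver (allFin p) h ∎
    where
    open ≡-Reasoning
    solution : ∀ y → y ≡ x ⊕ (y ⊕ ⊖ x)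
    solution y = sym (trans (cong (x ⊕_) (⊕-comm y (⊖ x))) (trans (sym (⊕-assoc x (⊖ x) y))
      (trans (cong (_⊕ y) (⊕-inverseʳ x)) (⊕-identityˡ y))))

  𝔼-uniform-swap : ∀ {A : Set} (E : Expectation A) (h : Fin p → A → ℚ) →
    𝔼 uniform (λ a → 𝔼 E (h a)) ≡ 𝔼 E (λ x → 𝔼 uniform (λ a → h a x))
  𝔼-uniform-swap E h = trans (cong (ι *_) (sym (𝔼-sum E (allFin p) (λ x a → h a x))))
    (sym (𝔼-* E ι (λ x → sumOver (allFin p) (λ a → h a x))))

  -- An element `x` is missed by `a ∷ as` iff `as` misses both `x` and `x ⊕ a`; for fixed `x` the
  -- latter is uniform in `a`, so the mean factorises.
  missedDensity-∷ : ∀ {K} (as : V K) → 𝔼 uniform (λ a → missedDensity (a ∷ as)) ≡ missedDensity as * missedDensity as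
  missedDensity-∷ as = begin
    𝔼 uniform (λ a → 𝔼 uniform (λ x → missed (a ∷ as) x))
      ≡⟨ 𝔼-cong uniform (λ a → 𝔼-cong uniform (missed-∷ a as)) ⟩
    𝔼 uniform (λ a → 𝔼 uniform (λ x → missed as x * missed as (x ⊕ a)))
      ≡⟨ 𝔼-uniform-swap uniform (λ a x → missed as x * missed as (x ⊕ a)) ⟩
    𝔼 uniform (λ x → 𝔼 uniform (λ a → missed as x * missed as (x ⊕ a)))
      ≡⟨ 𝔼-cong uniform (λ x → trans (𝔼-* uniform (missed as x) (λ a → missed as (x ⊕ a)))
           (trans (cong (λ s → missed as x * (ι * s)) (sum-translate x (missed as))) (*-comm (missed as x) (missedDensity as)))) ⟩
    𝔼 uniform (λ x → missedDensity as * missed as x)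
      ≡⟨ 𝔼-* uniform (missedDensity as) (missed as) ⟩
    missedDensity as * missedDensity as ∎
    where open ≡-Reasoning

  meanMissed : ℕ → ℚ
  meanMissed k = 𝔼 (vectors k) missedDensity

  meanMissed-suc : ∀ k → meanMissed (suc k) ≡ 𝔼 (vectors k) (λ as → missedDensity as * missedDensity as)
  meanMissed-suc k = trans (𝔼-uniform-swap (vectors k) (λ a as → missedDensity (a ∷ as))) (𝔼-cong (vectors k) missedDensity-∷)

  meanMissed-zero : meanMissed 0 ≡ ρ
  meanMissed-zero = trans (𝔼-cong uniform {g = λ x → 1ℚ + (-1ℚ * 𝟙 (x Fin.≟ 𝟘))} at)
    (trans (𝔼-+ uniform (λ _ → 1ℚ) (λ x → -1ℚ * 𝟙 (x Fin.≟ 𝟘)))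
      (trans (cong₂ _+_ (𝔼-1 uniform) (trans (𝔼-* uniform -1ℚ (λ x → 𝟙 (x Fin.≟ 𝟘)))
          (cong (λ s → -1ℚ * (ι * s)) (sum-𝟙-unique (Fin._≟ 𝟘) (Unique.allFin⁺ p) (∈-allFin 𝟘) refl (λ x eq → eq)))))
        (solve 1 (λ i → con 1ℚ :+ con -1ℚ :* (i :* con 1ℚ) := con 1ℚ :- i) refl ι)))
    where
    at : ∀ x → missed [] x ≡ 1ℚ + (-1ℚ * 𝟙 (x Fin.≟ 𝟘))
    at x with x Fin.≟ 𝟘
    ... | yes _ = refl
    ... | no  _ = refl

  meanMissed-lower : ∀ k → ρ ^ (2 ℕ.^ k) ≤ meanMissed k
  meanMissed-lower zero    = ≤-reflexive (trans (*-identityʳ ρ) (sym meanMissed-zero))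
  meanMissed-lower (suc k) = begin
    ρ ^ (2 ℕ.^ suc k) ≡⟨ ^-square ρ k ⟩
    ρ ^ (2 ℕ.^ k) * ρ ^ (2 ℕ.^ k)
      ≤⟨ *-mono (^-nonNeg 0≤ρ (2 ℕ.^ k)) (≤-trans (^-nonNeg 0≤ρ (2 ℕ.^ k)) (meanMissed-lower k)) (meanMissed-lower k) (meanMissed-lower k) ⟩
    meanMissed k * meanMissed k ≤⟨ 𝔼-square (vectors k) missedDensity ⟩
    𝔼 (vectors k) (λ as → missedDensity as * missedDensity as) ≡⟨ sym (meanMissed-suc k) ⟩
    meanMissed (suc k) ∎
    where open ≤-Reasoning

  representations-count : ∀ {K} (as : V K) x → representations as x ≡ count (λ S → value as S x Fin.≟ 𝟘) (vecs bools K)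
  representations-count [] x with x Fin.≟ 𝟘
  ... | yes _ = refl
  ... | no  _ = refl
  representations-count {suc K} (a ∷ as) x = trans (cong₂ ℕ._+_ (representations-count as (x ⊕ a)) (representations-count as x))
    (sym (count-bools (λ S → value (a ∷ as) S x Fin.≟ 𝟘)))

  product-vanish : ∀ {K r} (as : V K) x (τ : Vec (Vec Bool K) r) →
    product𝟙 (λ S → value as S x Fin.≟ 𝟘) τ ≡ vanish τ (replicate r x) as
  product-vanish as x []      = refl
  product-vanish as x (S ∷ τ) = cong (𝟙 (value as S x Fin.≟ 𝟘) *_) (product-vanish as x τ)

  -- The law of the number of representations of a uniform element by a random sequence; its mass at
  -- 0 is `meanMissed K` by definition.
  law : ℕ → Expectation ℕ
  law K = bind (vectors K) (λ as → bind uniform (λ x → dirac (representations as x)))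

  law-choose : ∀ K r → 𝔼 (law K) (λ n → fromℕ (choose n r))
    ≡ sumOver (combinations (vecs bools K) r) (λ τ → ι ^ rank τ)
  law-choose K r = begin
    𝔼 (vectors K) (λ as → 𝔼 uniform (λ x → fromℕ (choose (representations as x) r)))
      ≡⟨ 𝔼-cong (vectors K) (λ as → 𝔼-cong uniform (λ x →
           trans (cong (λ n → fromℕ (choose n r)) (representations-count as x))
             (trans (choose-count (λ S → value as S x Fin.≟ 𝟘) L r)
               (sum-cong (combinations L r) (product-vanish as x))))) ⟩
    𝔼 (vectors K) (λ as → 𝔼 uniform (λ x → sumOver (combinations L r) (λ τ → vanish τ (replicate r x) as)))
      ≡⟨ trans (𝔼-cong (vectors K) (λ as → 𝔼-sum uniform (combinations L r) (λ x τ → vanish τ (replicate r x) as)))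
           (𝔼-sum (vectors K) (combinations L r) (λ as τ → 𝔼 uniform (λ x → vanish τ (replicate r x) as))) ⟩
    sumOver (combinations L r) (λ τ → 𝔼 (vectors K) (λ as → 𝔼 uniform (λ x → vanish τ (replicate r x) as)))
      ≡⟨ sum-cong (combinations L r) vanish-probability ⟩
    sumOver (combinations L r) (λ τ → ι ^ rank τ) ∎
    where
    open ≡-Reasoning
    L = vecs bools K

  size : ℕ → ℕ
  size K = length (vecs bools K)

  size≡2^ : ∀ K → size K ≡ 2 ℕ.^ K
  size≡2^ K = length-vecs bools K

  module _ (K M : ℕ) (1≤M : 1 ℕ.≤ M) (Y≤ : ι * 2ℚ ^ K ≤ 2ℚ ^ M) where

    ε : ℚ
    ε = 2ℚ ^ M * (2ℚ ^ (2 ℕ.* (M ℕ.* M)) * ¾ ^ K)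

    choose-error : ∀ r → r ℕ.≤ M →
      ∣ 𝔼 (law K) (λ n → fromℕ (choose n r)) - 𝔼 (binomial (size K)) (λ n → fromℕ (choose n r)) ∣ ≤ ε
    choose-error r r≤M = begin
      ∣ 𝔼 (law K) (λ n → fromℕ (choose n r)) - 𝔼 (binomial (size K)) (λ n → fromℕ (choose n r)) ∣
        ≡⟨ cong₂ (λ x y → ∣ x - y ∣) (law-choose K r) (binomial-choose L r) ⟩
      ∣ sumOver (combinations L r) (λ τ → ι ^ rank τ) - sumOver (combinations L r) (λ _ → ι ^ r) ∣
        ≤⟨ ∣sum∣≤sum (combinations L r) (λ τ → ι ^ rank τ) (λ _ → ι ^ r) ⟩
      sumOver (combinations L r) (λ τ → ∣ ι ^ rank τ - ι ^ r ∣)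
        ≤⟨ sum-mono∈ (combinations L r) (λ τ τ∈ → probability-error τ
             (combinations-distinct L r (vecs-unique bools-unique K) τ∈)) ⟩
      sumOver (combinations L r) totalExcess ≤⟨ sum-combinations≤ L r 0≤totalExcess ⟩
      sumOver (tuples K r) totalExcess ≤⟨ sum-totalExcess K r 1≤M r≤M Y≤ ⟩
      ε ∎
      where
      open ≤-Reasoning
      L = vecs bools K

    signed-error : ∀ r a b → ∣ a - b ∣ ≤ ε → -1ℚ ^ r * a ≤ -1ℚ ^ r * b + ε
    signed-error r a b le = begin
      -1ℚ ^ r * a ≡⟨ solve 3 (λ s a b → s :* a := s :* b :+ s :* (a :- b)) refl (-1ℚ ^ r) a b ⟩
      -1ℚ ^ r * b + -1ℚ ^ r * (a - b) ≤⟨ +-monoʳ-≤ (-1ℚ ^ r * b) (≤-trans (p≤∣p∣ (-1ℚ ^ r * (a - b)))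
                                          (≤-trans (≤-reflexive (trans (ℚ.∣p*q∣≡∣p∣*∣q∣ (-1ℚ ^ r) (a - b))
                                            (trans (cong (_* ∣ a - b ∣) (∣-1^∣ r)) (*-identityˡ ∣ a - b ∣)))) le)) ⟩
      -1ℚ ^ r * b + ε ∎
      where
      open ≤-Reasoning
      p≤∣p∣ : ∀ q → q ≤ ∣ q ∣
      p≤∣p∣ q with ≤-total 0ℚ q
      ... | inj₁ 0≤q = ≤-reflexive (sym (ℚ.0≤p⇒∣p∣≡p 0≤q))
      ... | inj₂ q≤0 = ≤-trans q≤0 (ℚ.0≤∣p∣ q)
      ∣-1^∣ : ∀ r → ∣ -1ℚ ^ r ∣ ≡ 1ℚ
      ∣-1^∣ zero    = refl
      ∣-1^∣ (suc r) = trans (ℚ.∣p*q∣≡∣p∣*∣q∣ -1ℚ (-1ℚ ^ r)) (trans (cong (1ℚ *_) (∣-1^∣ r)) (*-identityˡ 1ℚ))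

    -- Order 0 is exact, and each further order costs one `ε`, whatever its sign.
    alternating-error : ∀ m → m ℕ.≤ M →
      𝔼 (law K) (λ n → alternating n m) ≤ 𝔼 (binomial (size K)) (λ n → alternating n m) + fromℕ m * ε
    alternating-error zero    _   = ≤-reflexive (trans (𝔼-1 (law K))
      (sym (trans (cong₂ _+_ (𝔼-1 (binomial (size K))) (*-zeroˡ ε)) (+-identityʳ 1ℚ))))
    alternating-error (suc m) m<M = begin
      𝔼 T (λ n → alternating n m + s * c n) ≡⟨ trans (𝔼-+ T (λ n → alternating n m) (λ n → s * c n)) (cong (𝔼 T (λ n → alternating n m) +_) (𝔼-* T s c)) ⟩
      𝔼 T (λ n → alternating n m) + s * 𝔼 T c
        ≤⟨ +-mono-≤ (alternating-error m (ℕ.<⇒≤ m<M)) (signed-error (suc m) (𝔼 T c) (𝔼 B c) (choose-error (suc m) m<M)) ⟩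
      (𝔼 B (λ n → alternating n m) + fromℕ m * ε) + (s * 𝔼 B c + ε)
        ≡⟨ solve 4 (λ a f e b → (a :+ f :* e) :+ (b :+ e) := (a :+ b) :+ (con 1ℚ :+ f) :* e) refl (𝔼 B (λ n → alternating n m)) (fromℕ m) ε (s * 𝔼 B c) ⟩
      (𝔼 B (λ n → alternating n m) + s * 𝔼 B c) + (1ℚ + fromℕ m) * ε
        ≡⟨ cong₂ (λ x y → x + y * ε) (sym (trans (𝔼-+ B (λ n → alternating n m) (λ n → s * c n)) (cong (𝔼 B (λ n → alternating n m) +_) (𝔼-* B s c)))) (sym (fromℕ-suc m)) ⟩
      𝔼 B (λ n → alternating n m + s * c n) + fromℕ (suc m) * ε ∎
      where
      open ≤-Reasoning
      T = law K
      B = binomial (size K)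
      s = -1ℚ ^ suc m
      c : ℕ → ℚ
      c n = fromℕ (choose n (suc m))

    -- The law is exchanged for the binomial one between the two Bonferroni inequalities, where only
    -- factorial moments of order at most `M` are involved.
    meanMissed-upper : -1ℚ ^ M ≡ 1ℚ →
      meanMissed K ≤ (ρ ^ size K + ½ ^ M * (1ℚ + fromℕ 3 * ι) ^ size K) + fromℕ M * ε
    meanMissed-upper even = begin
      𝔼 (law K) (λ n → 𝟙 (n ℕ.≟ 0)) ≤⟨ 𝔼-mono (law K) (bonferroni-lower {M} even) ⟩
      𝔼 (law K) (λ n → alternating n M) ≤⟨ alternating-error M ℕ.≤-refl ⟩
      𝔼 B (λ n → alternating n M) + fromℕ M * ε ≤⟨ +-monoˡ-≤ (fromℕ M * ε) (𝔼-mono B (bonferroni-upper {M} even)) ⟩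
      𝔼 B (λ n → 𝟙 (n ℕ.≟ 0) + ½ ^ M * 4ℚ ^ n) + fromℕ M * ε
        ≡⟨ cong (_+ fromℕ M * ε) (trans (𝔼-+ B (λ n → 𝟙 (n ℕ.≟ 0)) (λ n → ½ ^ M * 4ℚ ^ n))
             (cong₂ _+_ (binomial-zero (size K)) (trans (𝔼-* B (½ ^ M) (4ℚ ^_)) (cong (½ ^ M *_) (binomial-4^ (size K)))))) ⟩
      (ρ ^ size K + ½ ^ M * (1ℚ + fromℕ 3 * ι) ^ size K) + fromℕ M * ε ∎
      where
      open ≤-Reasoning
      B = binomial (size K)

  Covering : ∀ {K} → V K → Set
  Covering as = ∀ x → representations as x ≢ 0

  covering? : ∀ {K} → Decidable (Covering {K})
  covering? as = Fin.all? λ x → ¬? (representations as x ℕ.≟ 0)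

  0<ρ : 0ℚ < ρ
  0<ρ = subst (0ℚ <_) (trans (ℚ.*-distribˡ-+ ι (fromℕ p) (- 1ℚ)) (cong₂ _+_ ι*p≡1 (solve 1 (λ i → i :* (:- con 1ℚ) := :- i) refl ι)))
    (*-pos 0<ι (<-≤-trans 0<1 (p-q≥0⁻¹ (subst (0ℚ ≤_) (solve 1 (λ x → x :- con 2ℚ := (x :+ (:- con 1ℚ)) :- con 1ℚ) refl (fromℕ p))
      (p-q≥0 (fromℕ-mono {2} {p} (ℕ.<⇒≤ 2<p)))))))

  -- The hypotheses bound the mean of the squared density by `3/2 * R`, and `R` is at most the
  -- square of the mean density by `meanMissed-lower`; `support-large` then leaves at most 1/3 to
  -- the covering sequences.
  covering-rare : ∀ k {η} → meanMissed (suc k) ≤ ρ ^ (2 ℕ.^ suc k) + η → η ≤ ½ * ρ ^ (2 ℕ.^ suc k) →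
    𝔼 (vectors k) (λ as → 𝟙 (covering? as)) ≤ ℤ.+ 1 / 3
  covering-rare k {η} upper η≤ = p-q≥0⁻¹ (subst (0ℚ ≤_) rearrange (p-q≥0 large))
    where
    H = meanMissed k
    R = ρ ^ (2 ℕ.^ suc k)
    s : V k → ℚ
    s as = 1ℚ + -1ℚ * 𝟙 (covering? as)
    dichotomy : ∀ as → (s as ≡ 0ℚ × missedDensity as ≡ 0ℚ) ⊎ s as ≡ 1ℚ
    dichotomy as with covering? as
    ... | yes cov = inj₁ (refl , trans (𝔼-cong uniform λ x → 𝟙-no (representations as x ℕ.≟ 0) (cov x)) (𝔼-const uniform 0ℚ))
    ... | no  _   = inj₂ refl
    R≤H² : R ≤ H * H
    R≤H² = ≤-trans (≤-reflexive (^-square ρ k))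
      (*-mono (^-nonNeg 0≤ρ (2 ℕ.^ k)) (≤-trans (^-nonNeg 0≤ρ (2 ℕ.^ k)) (meanMissed-lower k)) (meanMissed-lower k) (meanMissed-lower k))
    second : 𝔼 (vectors k) (λ as → missedDensity as * missedDensity as) ≤ (ℤ.+ 3 / 2) * (H * H)
    second = begin
      𝔼 (vectors k) (λ as → missedDensity as * missedDensity as) ≡⟨ sym (meanMissed-suc k) ⟩
      meanMissed (suc k) ≤⟨ upper ⟩
      R + η ≤⟨ +-monoʳ-≤ R η≤ ⟩
      R + ½ * R ≡⟨ solve 1 (λ r → r :+ con ½ :* r := con (ℤ.+ 3 / 2) :* r) refl R ⟩
      (ℤ.+ 3 / 2) * R ≤⟨ *-monoˡ (ℤ.+ 3 / 2) (<⇒≤ (positive⁻¹ (ℤ.+ 3 / 2))) R≤H² ⟩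
      (ℤ.+ 3 / 2) * (H * H) ∎
      where open ≤-Reasoning
    large : ℤ.+ 2 / 3 ≤ 𝔼 (vectors k) s
    large = support-large (vectors k) missedDensity s dichotomy (<-≤-trans (^-pos 0<ρ (2 ℕ.^ k)) (meanMissed-lower k)) second
    c = 𝔼 (vectors k) (λ as → 𝟙 (covering? as))
    rearrange : 𝔼 (vectors k) s - ℤ.+ 2 / 3 ≡ ℤ.+ 1 / 3 - c
    rearrange = trans (cong (_- ℤ.+ 2 / 3) (trans (𝔼-+ (vectors k) (λ _ → 1ℚ) (λ as → -1ℚ * 𝟙 (covering? as)))
        (cong₂ _+_ (𝔼-1 (vectors k)) (𝔼-* (vectors k) -1ℚ (λ as → 𝟙 (covering? as))))))
      (solve 1 (λ c → (con 1ℚ :+ con -1ℚ :* c) :- con (ℤ.+ 2 / 3) := con (ℤ.+ 1 / 3) :- c) refl c)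

-- Choice of the parameters

bernoulli : ∀ {x} → 0ℚ ≤ x → x ≤ 1ℚ → ∀ m → 1ℚ - fromℕ m * x ≤ (1ℚ - x) ^ m
bernoulli {x} 0≤x x≤1 zero = ≤-reflexive (solve 1 (λ x → con 1ℚ :- con 0ℚ :* x := con 1ℚ) refl x)
bernoulli {x} 0≤x x≤1 (suc m) = begin
  1ℚ - fromℕ (suc m) * x ≡⟨ cong (λ z → 1ℚ - z * x) (fromℕ-suc m) ⟩
  1ℚ - (1ℚ + c) * x ≤⟨ p-q≥0⁻¹ (subst (0ℚ ≤_)
      (solve 2 (λ f x → f :* (x :* x) := (con 1ℚ :- x) :* (con 1ℚ :- f :* x) :- (con 1ℚ :- (con 1ℚ :+ f) :* x)) refl c x)
      (*-nonNeg (0≤fromℕ m) (0≤sq x))) ⟩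
  (1ℚ - x) * (1ℚ - c * x) ≤⟨ *-monoˡ (1ℚ - x) (p-q≥0 x≤1) (bernoulli 0≤x x≤1 m) ⟩
  (1ℚ - x) ^ suc m ∎
  where
  open ≤-Reasoning
  c = fromℕ m

2^*½^ : ∀ m → 2ℚ ^ m * ½ ^ m ≡ 1ℚ
2^*½^ m = trans (sym (^-distrib-* 2ℚ ½ m)) (1^ m)

½≤1 : ½ ≤ 1ℚ
½≤1 = *≤* (ℤ.+≤+ (s≤s z≤n))

2^*½^+ : ∀ m n → 2ℚ ^ m * ½ ^ (m ℕ.+ n) ≡ ½ ^ n
2^*½^+ m n = trans (cong (2ℚ ^ m *_) (^-homo-* ½ m n))
  (trans (sym (*-assoc (2ℚ ^ m) (½ ^ m) (½ ^ n))) (trans (cong (_* ½ ^ n) (2^*½^ m)) (*-identityˡ (½ ^ n))))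

-1^2m : ∀ m → -1ℚ ^ (2 ℕ.* m) ≡ 1ℚ
-1^2m m = trans (sym (^-assocʳ -1ℚ 2 m)) (1^ m)

-- Since 27/64 ≤ 1/2.
¾^3m : ∀ m → ¾ ^ (3 ℕ.* m) ≤ ½ ^ m
¾^3m m = ≤-trans (≤-reflexive (sym (^-assocʳ ¾ 3 m))) (^-monoˡ {¾ ^ 3} {½} (0≤¾^ 3) (*≤* (ℤ.+≤+ (ℕ.m≤m+n 54 10))) m)

module Threshold {p : ℕ} (pr : Prime p) (2<p : 2 ℕ.< p) (n h : ℕ) (2^n≤p : 2 ℕ.^ n ℕ.≤ p) where

  open Solutions pr 2<p
  open Dependence pr 2<p
  open Binomial ι 0≤ι ι≤1
  open Coverage pr 2<p
  open ≤-Reasoning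

  -- `K` is one more than the length `n + h` in the conclusion, since `covering-rare` looks one step
  -- ahead. `Λ` bounds the mean `ι * 2ℚ ^ K`. The order `M` is a multiple of `Λ` because errors
  -- compete with the lower bound `½ ^ (2 Λ)` of the main term: of the 16, 6 are lost to the
  -- exponential moment, and the other 10 exceed the 4 that `quarter` demands.
  K Λ M : ℕ
  K = n ℕ.+ suc h
  Λ = 2 ℕ.^ suc h
  M = 16 ℕ.* Λ

  1≤Λ : 1 ℕ.≤ Λ
  1≤Λ = ℕ.^-monoʳ-≤ 2 {0} {suc h} z≤n

  Λ≤M : Λ ℕ.≤ M
  Λ≤M = ℕ.m≤m+n Λ (15 ℕ.* Λ)

  ι2^n≤1 : ι * 2ℚ ^ n ≤ 1ℚ
  ι2^n≤1 = begin
    ι * 2ℚ ^ n ≡⟨ cong (ι *_) (sym (fromℕ-^ 2 n)) ⟩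
    ι * fromℕ (2 ℕ.^ n) ≤⟨ *-monoˡ ι 0≤ι (fromℕ-mono 2^n≤p) ⟩
    ι * fromℕ p ≡⟨ ι*p≡1 ⟩
    1ℚ ∎

  Y≤ : ι * 2ℚ ^ K ≤ 2ℚ ^ M
  Y≤ = begin
    ι * 2ℚ ^ (n ℕ.+ suc h) ≡⟨ cong (ι *_) (^-homo-* 2ℚ n (suc h)) ⟩
    ι * (2ℚ ^ n * 2ℚ ^ suc h) ≡⟨ sym (*-assoc ι (2ℚ ^ n) (2ℚ ^ suc h)) ⟩
    ι * 2ℚ ^ n * 2ℚ ^ suc h ≤⟨ *-monoʳ (2ℚ ^ suc h) (0≤2ℚ^ (suc h)) ι2^n≤1 ⟩
    1ℚ * 2ℚ ^ suc h ≡⟨ *-identityˡ (2ℚ ^ suc h) ⟩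
    2ℚ ^ suc h ≤⟨ ^-monoʳ 1≤2ℚ (ℕ.≤-trans (n≤2^n (suc h)) Λ≤M) ⟩
    2ℚ ^ M ∎

  module _ (n-large : 16 ℕ.* (M ℕ.* M) ℕ.≤ n) where

    1≤M : 1 ℕ.≤ M
    1≤M = ℕ.≤-trans 1≤Λ Λ≤M

    M≤M² : M ℕ.≤ M ℕ.* M
    M≤M² = ℕ.≤-trans (ℕ.≤-reflexive (sym (ℕ.*-identityʳ M))) (ℕ.*-monoʳ-≤ M 1≤M)

    R : ℚ
    R = ρ ^ (2 ℕ.^ K)

    -- Bernoulli's inequality at `2 ^ n` may give nothing, as `ι * 2ℚ ^ n` can be close to 1; at
    -- `2 ^ (n - 1)` it gives ½, which is then squared.
    ρ^2^n : ½ ^ 2 ≤ ρ ^ (2 ℕ.^ n)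
    ρ^2^n = general n (ℕ.≤-trans (ℕ.≤-trans (ℕ.*-mono-≤ {1} {16} (s≤s z≤n) 1≤M) (ℕ.*-monoʳ-≤ 16 M≤M²)) n-large) ι2^n≤1
      where
      general : ∀ n → 1 ℕ.≤ n → ι * 2ℚ ^ n ≤ 1ℚ → ½ ^ 2 ≤ ρ ^ (2 ℕ.^ n)
      general (suc m) _ small = begin
        ½ * (½ * 1ℚ) ≤⟨ *-mono (<⇒≤ 0<½) (≤-trans (<⇒≤ 0<½) half) half half ⟩
        ρ ^ (2 ℕ.^ m) * ρ ^ (2 ℕ.^ m) ≡⟨ sym (^-square ρ m) ⟩
        ρ ^ (2 ℕ.^ suc m) ∎
        where
        half : ½ ≤ ρ ^ (2 ℕ.^ m)
        half = begin
          1ℚ - ½ ≤⟨ +-monoʳ-≤ 1ℚ (neg-antimono-≤ (begin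
            fromℕ (2 ℕ.^ m) * ι ≡⟨ cong (_* ι) (fromℕ-^ 2 m) ⟩
            2ℚ ^ m * ι ≡⟨ solve 2 (λ t i → t :* i := con ½ :* (i :* (con 2ℚ :* t))) refl (2ℚ ^ m) ι ⟩
            ½ * (ι * 2ℚ ^ suc m) ≤⟨ *-monoˡ ½ (<⇒≤ 0<½) small ⟩
            ½ * 1ℚ ≡⟨ *-identityʳ ½ ⟩
            ½ ∎)) ⟩
          1ℚ - fromℕ (2 ℕ.^ m) * ι ≤⟨ bernoulli 0≤ι ι≤1 (2 ℕ.^ m) ⟩
          ρ ^ (2 ℕ.^ m) ∎

    T : ℚ
    T = (1ℚ + fromℕ 3 * ι) ^ (2 ℕ.^ K)

    R-lower : ½ ^ (2 ℕ.* Λ) ≤ R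
    R-lower = begin
      ½ ^ (2 ℕ.* Λ) ≡⟨ sym (^-assocʳ ½ 2 Λ) ⟩
      (½ ^ 2) ^ Λ ≤⟨ ^-monoˡ (0≤½ℚ^ 2) ρ^2^n Λ ⟩
      (ρ ^ (2 ℕ.^ n)) ^ Λ ≡⟨ trans (^-assocʳ ρ (2 ℕ.^ n) Λ) (cong (ρ ^_) (sym (ℕ.^-distribˡ-+-* 2 n (suc h)))) ⟩
      R ∎

    -- `T` is bounded through the main term: `(1 + 3 ι) ρ³ ≤ 1` gives `T * R ^ 3 ≤ 1`, and `R-lower`
    -- bounds `R` from below.
    1+3ι-upper : T ≤ 2ℚ ^ (6 ℕ.* Λ)
    1+3ι-upper = begin
      T ≡⟨ sym (*-identityʳ T) ⟩
      T * 1ℚ ≡⟨ cong (T *_) (sym (2^*½^ m)) ⟩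
      T * (2ℚ ^ m * ½ ^ m) ≡⟨ solve 3 (λ t a b → t :* (a :* b) := a :* (t :* b)) refl T (2ℚ ^ m) (½ ^ m) ⟩
      2ℚ ^ m * (T * ½ ^ m) ≤⟨ *-monoˡ (2ℚ ^ m) (0≤2ℚ^ m) (*-monoˡ T 0≤T R³) ⟩
      2ℚ ^ m * (T * R ^ 3) ≡⟨ cong (λ x → 2ℚ ^ m * (T * x)) (trans (^-assocʳ ρ (2 ℕ.^ K) 3) (trans (cong (ρ ^_) (ℕ.*-comm (2 ℕ.^ K) 3)) (sym (^-assocʳ ρ 3 (2 ℕ.^ K))))) ⟩
      2ℚ ^ m * (T * (ρ ^ 3) ^ (2 ℕ.^ K)) ≡⟨ cong (2ℚ ^ m *_) (sym (^-distrib-* (1ℚ + fromℕ 3 * ι) (ρ ^ 3) (2 ℕ.^ K))) ⟩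
      2ℚ ^ m * ((1ℚ + fromℕ 3 * ι) * ρ ^ 3) ^ (2 ℕ.^ K)
        ≤⟨ *-monoˡ (2ℚ ^ m) (0≤2ℚ^ m) (≤-trans (^-monoˡ (*-nonNeg 0≤1+3ι (^-nonNeg 0≤ρ 3)) product≤1 (2 ℕ.^ K)) (≤-reflexive (1^ (2 ℕ.^ K)))) ⟩
      2ℚ ^ m * 1ℚ ≡⟨ *-identityʳ (2ℚ ^ m) ⟩
      2ℚ ^ m ∎
      where
      m = 6 ℕ.* Λ
      0≤1+3ι : 0ℚ ≤ 1ℚ + fromℕ 3 * ι
      0≤1+3ι = +-mono-≤ (<⇒≤ 0<1) (*-nonNeg (0≤fromℕ 3) 0≤ι)
      0≤T : 0ℚ ≤ T
      0≤T = ^-nonNeg 0≤1+3ι (2 ℕ.^ K)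
      R³ : ½ ^ m ≤ R ^ 3
      R³ = ≤-trans (≤-reflexive (trans (cong (½ ^_) (trans (ℕ.*-assoc 3 2 Λ) (ℕ.*-comm 3 (2 ℕ.* Λ)))) (sym (^-assocʳ ½ (2 ℕ.* Λ) 3))))
             (^-monoˡ (0≤½ℚ^ (2 ℕ.* Λ)) R-lower 3)
      product≤1 : (1ℚ + fromℕ 3 * ι) * ρ ^ 3 ≤ 1ℚ
      -- `1 - (1 + 3 i)(1 - i)³ = i² (3 i² - 8 i + 6)`, with the square completed in the quadratic
      -- factor.
      product≤1 = p-q≥0⁻¹ (subst (0ℚ ≤_)
        (solve 1 (λ i → (i :* i) :* (con (fromℕ 3) :* ((i :- con (ℤ.+ 4 / 3)) :* (i :- con (ℤ.+ 4 / 3))) :+ con (ℤ.+ 2 / 3))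
            := con 1ℚ :- (con 1ℚ :+ con (fromℕ 3) :* i) :* ((con 1ℚ :- i) :* ((con 1ℚ :- i) :* ((con 1ℚ :- i) :* con 1ℚ)))) refl ι)
        (*-nonNeg (0≤sq ι) (+-mono-≤ (*-nonNeg (0≤fromℕ 3) (0≤sq (ι - ℤ.+ 4 / 3))) (<⇒≤ (positive⁻¹ (ℤ.+ 2 / 3))))))

    -- Truncation and dependence may each take a quarter of `R`, which adds up to the half that
    -- `covering-rare` allows.
    quarter : ½ ^ (2 ℕ.+ 2 ℕ.* Λ) ≤ (½ ^ 2) * R
    quarter = ≤-trans (≤-reflexive (^-homo-* ½ 2 (2 ℕ.* Λ))) (*-monoˡ (½ ^ 2) (0≤½ℚ^ 2) R-lower)

    2Λ+2≤ : 2 ℕ.+ 2 ℕ.* Λ ℕ.≤ 4 ℕ.* Λ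
    2Λ+2≤ = ℕ.≤-trans (ℕ.+-monoˡ-≤ (2 ℕ.* Λ) (ℕ.*-monoʳ-≤ 2 1≤Λ)) (ℕ.≤-reflexive (sym (ℕ.*-distribʳ-+ Λ 2 2)))

    tail-small : ½ ^ M * T ≤ (½ ^ 2) * R
    tail-small = begin
      ½ ^ M * T ≤⟨ *-monoˡ (½ ^ M) (0≤½ℚ^ M) 1+3ι-upper ⟩
      ½ ^ M * 2ℚ ^ (6 ℕ.* Λ) ≡⟨ trans (*-comm (½ ^ M) (2ℚ ^ (6 ℕ.* Λ))) (cong (λ e → 2ℚ ^ (6 ℕ.* Λ) * ½ ^ e) (ℕ.*-distribʳ-+ Λ 6 10)) ⟩
      2ℚ ^ (6 ℕ.* Λ) * ½ ^ (6 ℕ.* Λ ℕ.+ 10 ℕ.* Λ) ≡⟨ 2^*½^+ (6 ℕ.* Λ) (10 ℕ.* Λ) ⟩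
      ½ ^ (10 ℕ.* Λ) ≤⟨ ^-antiʳ (<⇒≤ 0<½) ½≤1 (ℕ.≤-trans 2Λ+2≤ (ℕ.*-monoˡ-≤ Λ (ℕ.m≤m+n 4 6))) ⟩
      ½ ^ (2 ℕ.+ 2 ℕ.* Λ) ≤⟨ quarter ⟩
      (½ ^ 2) * R ∎

    dependence-small : fromℕ M * ε K M 1≤M Y≤ ≤ (½ ^ 2) * R
    dependence-small = begin
      fromℕ M * (2ℚ ^ M * (2ℚ ^ (2 ℕ.* Q) * ¾ ^ K))
        ≤⟨ *-mono (0≤fromℕ M) (*-nonNeg (0≤2ℚ^ M) (*-nonNeg (0≤2ℚ^ (2 ℕ.* Q)) (0≤½ℚ^ J)))
             (≤-trans (fromℕ-mono (n≤2^n M)) (≤-reflexive (fromℕ-^ 2 M)))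
             (*-monoˡ (2ℚ ^ M) (0≤2ℚ^ M) (*-monoˡ (2ℚ ^ (2 ℕ.* Q)) (0≤2ℚ^ (2 ℕ.* Q))
               (≤-trans (^-antiʳ (<⇒≤ 0<¾) (*≤* (ℤ.+≤+ (ℕ.m≤m+n 3 1))) 3J≤K) (¾^3m J)))) ⟩
      2ℚ ^ M * (2ℚ ^ M * (2ℚ ^ (2 ℕ.* Q) * ½ ^ J))
        ≤⟨ *-mono (0≤2ℚ^ M) (*-nonNeg (0≤2ℚ^ Q) (*-nonNeg (0≤2ℚ^ (2 ℕ.* Q)) (0≤½ℚ^ J)))
             (^-monoʳ 1≤2ℚ M≤M²) (*-monoʳ (2ℚ ^ (2 ℕ.* Q) * ½ ^ J) (*-nonNeg (0≤2ℚ^ (2 ℕ.* Q)) (0≤½ℚ^ J)) (^-monoʳ 1≤2ℚ M≤M²)) ⟩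
      2ℚ ^ Q * (2ℚ ^ Q * (2ℚ ^ (2 ℕ.* Q) * ½ ^ J))
        ≡⟨ trans (solve 3 (λ a b c → a :* (a :* (b :* c)) := (a :* a :* b) :* c) refl (2ℚ ^ Q) (2ℚ ^ (2 ℕ.* Q)) (½ ^ J))
             (cong (_* ½ ^ J) (trans (cong (_* 2ℚ ^ (2 ℕ.* Q)) (sym (^-homo-* 2ℚ Q Q))) (trans (sym (^-homo-* 2ℚ (Q ℕ.+ Q) (2 ℕ.* Q)))
               (cong (2ℚ ^_) (solveⁿ 1 (λ q → (q :+ⁿ q) :+ⁿ (conⁿ 2 :*ⁿ q) :=ⁿ conⁿ 4 :*ⁿ q) refl Q))))) ⟩
      2ℚ ^ (4 ℕ.* Q) * ½ ^ J ≡⟨ 2^*½^+ (4 ℕ.* Q) (2 ℕ.+ 2 ℕ.* Λ) ⟩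
      ½ ^ (2 ℕ.+ 2 ℕ.* Λ) ≤⟨ quarter ⟩
      (½ ^ 2) * R ∎
      where
      Q = M ℕ.* M
      -- `4 Q` pays for `fromℕ M`, `2ℚ ^ M` and `2ℚ ^ (2 Q)`; the rest reaches `quarter`. Then
      -- `3 J ≤ 12 Q + 12 Λ ≤ 16 Q`, which accounts for the 16 in `n-large`.
      J = 4 ℕ.* Q ℕ.+ (2 ℕ.+ 2 ℕ.* Λ)
      3J≤K : 3 ℕ.* J ℕ.≤ K
      3J≤K = ℕ.≤-trans (ℕ.≤-trans (ℕ.≤-reflexive (ℕ.*-distribˡ-+ 3 (4 ℕ.* Q) (2 ℕ.+ 2 ℕ.* Λ)))
        (ℕ.≤-trans (ℕ.+-mono-≤ (ℕ.≤-reflexive (sym (ℕ.*-assoc 3 4 Q)))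
            (ℕ.≤-trans (ℕ.*-monoʳ-≤ 3 2Λ+2≤) (ℕ.≤-trans (ℕ.≤-reflexive (sym (ℕ.*-assoc 3 4 Λ)))
              (ℕ.≤-trans (ℕ.*-monoˡ-≤ Λ (ℕ.m≤m+n 12 4)) (ℕ.≤-trans M≤M² (ℕ.m≤m+n Q (3 ℕ.* Q)))))))
          (ℕ.≤-reflexive (sym (ℕ.*-distribʳ-+ Q 12 4)))))
        (ℕ.≤-trans n-large (ℕ.m≤m+n n (suc h)))

    η : ℚ
    η = ½ ^ M * T + fromℕ M * ε K M 1≤M Y≤

    covering-rare-at : 𝔼 (vectors (n ℕ.+ h)) (λ as → 𝟙 (covering? as)) ≤ ℤ.+ 1 / 3
    covering-rare-at = covering-rare (n ℕ.+ h) {η}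
      (subst (λ k → meanMissed k ≤ ρ ^ (2 ℕ.^ k) + η) (ℕ.+-suc n h)
        -- `M = 2 (8 Λ)` is even, as both Bonferroni bounds require.
        (≤-trans (meanMissed-upper K M 1≤M Y≤ (subst (λ m → -1ℚ ^ m ≡ 1ℚ) (sym (ℕ.*-assoc 2 8 Λ)) (-1^2m (8 ℕ.* Λ))))
          (≤-reflexive (trans (cong (λ s → (ρ ^ s + ½ ^ M * (1ℚ + fromℕ 3 * ι) ^ s) + fromℕ M * ε K M 1≤M Y≤) (size≡2^ K))
            (+-assoc R (½ ^ M * T) (fromℕ M * ε K M 1≤M Y≤))))))
      (subst (λ k → η ≤ ½ * ρ ^ (2 ℕ.^ k)) (ℕ.+-suc n h)
        (≤-trans (+-mono-≤ tail-small dependence-small)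
          (≤-reflexive (solve 1 (λ r → (con ½ :* (con ½ :* con 1ℚ)) :* r :+ (con ½ :* (con ½ :* con 1ℚ)) :* r := con ½ :* r) refl R))))

-- From random sequences to random subsets

sum-filter : ∀ {A : Set} {P : A → Set} (P? : Decidable P) xs (h : A → ℚ) →
  sumOver (filter P? xs) h ≡ sumOver xs (λ x → 𝟙 (P? x) * h x)
sum-filter P? []       h = refl
sum-filter P? (x ∷ xs) h with P? x
... | yes _ = cong₂ _+_ (sym (*-identityˡ (h x))) (sum-filter P? xs h)
... | no  _ = trans (sum-filter P? xs h) (sym (trans (cong (_+ s) (*-zeroˡ (h x))) (+-identityˡ s)))
  where s = sumOver xs (λ x → 𝟙 (P? x) * h x)

sum-allFin-suc : ∀ n (h : Fin (suc n) → ℚ) →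
  sumOver (allFin (suc n)) h ≡ h Fin.zero + sumOver (allFin n) (h ∘ Fin.suc)
sum-allFin-suc n h = cong (h Fin.zero +_) (trans (cong (λ l → sumOver l h) (sym (List.map-tabulate {n = n} id Fin.suc)))
  (sum-map Fin.suc (allFin n) h))

sumExtensions : ∀ {n} → Subset n → (Subset n → ℚ) → ℚ
sumExtensions []            G = 0ℚ
sumExtensions (inside  ∷ A) G = sumExtensions A (G ∘ (inside ∷_))
sumExtensions (outside ∷ A) G = G (inside ∷ A) + sumExtensions A (G ∘ (outside ∷_))

sumSize : ∀ {n} → ℕ → (Subset n → ℚ) → ℚ
sumSize {n} i G = sumOver (allSubsets n) (λ A → 𝟙 (card A ℕ.≟ i) * G A)

sumSize-∷ : ∀ {n} i (G : Subset (suc n) → ℚ) → sumSize (suc i) G ≡ sumSize i (G ∘ (inside ∷_)) + sumSize (suc i) (G ∘ (outside ∷_))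
sumSize-∷ {n} i G = trans (sum-++ (List.map (inside ∷_) (allSubsets n)) (List.map (outside ∷_) (allSubsets n)) _)
  (cong₂ _+_
    (trans (sum-map (inside ∷_) (allSubsets n) (λ A → 𝟙 (card A ℕ.≟ suc i) * G A))
      (sum-cong (allSubsets n) λ A → cong (_* G (inside ∷ A)) (𝟙-cong (suc (card A) ℕ.≟ suc i) (card A ℕ.≟ i) ℕ.suc-injective (cong suc))))
    (sum-map (outside ∷_) (allSubsets n) (λ A → 𝟙 (card A ℕ.≟ suc i) * G A)))

sumSize-∷-zero : ∀ {n} (G : Subset (suc n) → ℚ) → sumSize 0 G ≡ sumSize 0 (G ∘ (outside ∷_))
sumSize-∷-zero {n} G = trans (sum-++ (List.map (inside ∷_) (allSubsets n)) (List.map (outside ∷_) (allSubsets n)) _)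
  (trans (cong₂ _+_
    (trans (sum-map (inside ∷_) (allSubsets n) (λ A → 𝟙 (card A ℕ.≟ 0) * G A))
      (trans (sum-cong (allSubsets n) λ A → *-zeroˡ (G (inside ∷ A))) (sum-zero (allSubsets n))))
    (sum-map (outside ∷_) (allSubsets n) (λ A → 𝟙 (card A ℕ.≟ 0) * G A)))
  (+-identityˡ (sumSize 0 (G ∘ (outside ∷_)))))

sumSize-+ : ∀ {n} i (G H : Subset n → ℚ) → sumSize i (λ A → G A + H A) ≡ sumSize i G + sumSize i H
sumSize-+ {n} i G H = trans (sum-cong (allSubsets n) λ A → *-distribˡ-+ (𝟙 (card A ℕ.≟ i)) (G A) (H A))
  (sum-+ (allSubsets n) (λ A → 𝟙 (card A ℕ.≟ i) * G A) (λ A → 𝟙 (card A ℕ.≟ i) * H A))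

sumSize-∅ : ∀ {n} (G : Subset n → ℚ) → sumSize 0 G ≡ G ∅
sumSize-∅ {zero}  G = trans (+-identityʳ (1ℚ * G [])) (*-identityˡ (G []))
sumSize-∅ {suc n} G = trans (sumSize-∷-zero G) (sumSize-∅ (G ∘ (outside ∷_)))

-- Each set of size i + 1 is an extension of i + 1 sets of size i.
sumSize-extensions : ∀ {n} i (G : Subset n → ℚ) →
  sumSize i (λ A → sumExtensions A G) ≡ fromℕ (suc i) * sumSize (suc i) G
sumSize-extensions {zero} i G = trans (cong (_+ 0ℚ) (*-zeroʳ (𝟙 (0 ℕ.≟ i))))
  (sym (trans (cong (fromℕ (suc i) *_) (trans (cong (_+ 0ℚ) (*-zeroˡ (G []))) refl)) (*-zeroʳ (fromℕ (suc i)))))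
sumSize-extensions {suc n} zero G = begin
  sumSize 0 (λ A → sumExtensions A G) ≡⟨ sumSize-∷-zero (λ A → sumExtensions A G) ⟩
  sumSize 0 (λ A → G (inside ∷ A) + sumExtensions A (G ∘ (outside ∷_))) ≡⟨ sumSize-+ 0 (G ∘ (inside ∷_)) (λ A → sumExtensions A (G ∘ (outside ∷_))) ⟩
  a + sumSize 0 (λ A → sumExtensions A (G ∘ (outside ∷_))) ≡⟨ cong (a +_) (trans (sumSize-extensions 0 (G ∘ (outside ∷_))) (*-identityˡ b)) ⟩
  a + b ≡⟨ sym (sumSize-∷ 0 G) ⟩
  sumSize 1 G ≡⟨ sym (*-identityˡ (sumSize 1 G)) ⟩
  1ℚ * sumSize 1 G ∎
  where
  open ≡-Reasoning
  a = sumSize 0 (G ∘ (inside ∷_))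
  b = sumSize 1 (G ∘ (outside ∷_))
sumSize-extensions {suc n} (suc i) G = begin
  sumSize (suc i) (λ A → sumExtensions A G) ≡⟨ sumSize-∷ i (λ A → sumExtensions A G) ⟩
  sumSize i (λ A → sumExtensions A (G ∘ (inside ∷_))) + sumSize (suc i) (λ A → G (inside ∷ A) + sumExtensions A (G ∘ (outside ∷_)))
    ≡⟨ cong₂ _+_ (sumSize-extensions i (G ∘ (inside ∷_)))
         (trans (sumSize-+ (suc i) (G ∘ (inside ∷_)) (λ A → sumExtensions A (G ∘ (outside ∷_)))) (cong (a +_) (sumSize-extensions (suc i) (G ∘ (outside ∷_))))) ⟩
  fromℕ (suc i) * a + (a + fromℕ (suc (suc i)) * b)
    ≡⟨ cong (λ c → fromℕ (suc i) * a + (a + c * b)) (fromℕ-suc (suc i)) ⟩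
  fromℕ (suc i) * a + (a + (1ℚ + fromℕ (suc i)) * b)
    ≡⟨ solve 3 (λ c a b → c :* a :+ (a :+ (con 1ℚ :+ c) :* b) := (con 1ℚ :+ c) :* (a :+ b)) refl (fromℕ (suc i)) a b ⟩
  (1ℚ + fromℕ (suc i)) * (a + b) ≡⟨ cong₂ _*_ (sym (fromℕ-suc (suc i))) (sym (sumSize-∷ (suc i) G)) ⟩
  fromℕ (suc (suc i)) * sumSize (suc (suc i)) G ∎
  where
  open ≡-Reasoning
  a = sumSize (suc i) (G ∘ (inside ∷_))
  b = sumSize (suc (suc i)) (G ∘ (outside ∷_))

-- Adding `j` new elements to `A` one after another: sampling without repetition, in a form
-- comparable with `vectors`.
sumOrderings : ∀ {n} → ℕ → (Subset n → ℚ) → Subset n → ℚ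
sumOrderings zero    F A = F A
sumOrderings (suc j) F A = sumExtensions A (sumOrderings j F)

-- The rising factorial `(i + 1) ⋯ (i + j)`, which is `j!` for `i = 0`.
orderings : ℕ → ℕ → ℚ
orderings i zero    = 1ℚ
orderings i (suc j) = fromℕ (suc i) * orderings (suc i) j

sumSize-orderings : ∀ {n} i j (F : Subset n → ℚ) → sumSize i (sumOrderings j F) ≡ orderings i j * sumSize (i ℕ.+ j) F
sumSize-orderings i zero    F = trans (cong (λ k → sumSize k F) (sym (ℕ.+-identityʳ i))) (sym (*-identityˡ (sumSize (i ℕ.+ 0) F)))
sumSize-orderings i (suc j) F = trans (sumSize-extensions i (sumOrderings j F))
  (trans (cong (fromℕ (suc i) *_) (trans (sumSize-orderings (suc i) j F) (cong (λ k → orderings (suc i) j * sumSize k F) (sym (ℕ.+-suc i j)))))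
    (sym (*-assoc (fromℕ (suc i)) (orderings (suc i) j) (sumSize (i ℕ.+ suc j) F))))

sumOrderings-∅ : ∀ {n} j (F : Subset n → ℚ) → sumOrderings j F ∅ ≡ orderings 0 j * sumSize j F
sumOrderings-∅ j F = trans (sym (sumSize-∅ (sumOrderings j F))) (sumSize-orderings 0 j F)

sumExtensions-nonNeg : ∀ {n} (A : Subset n) {G} → (∀ B → 0ℚ ≤ G B) → 0ℚ ≤ sumExtensions A G
sumExtensions-nonNeg []            0≤G = ≤-refl
sumExtensions-nonNeg (inside  ∷ A) 0≤G = sumExtensions-nonNeg A (λ B → 0≤G (inside ∷ B))
sumExtensions-nonNeg (outside ∷ A) 0≤G = +-mono-≤ (0≤G (inside ∷ A)) (sumExtensions-nonNeg A (λ B → 0≤G (outside ∷ B)))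

sumOrderings-nonNeg : ∀ {n} j {F : Subset n → ℚ} → (∀ B → 0ℚ ≤ F B) → ∀ A → 0ℚ ≤ sumOrderings j F A
sumOrderings-nonNeg zero    0≤F A = 0≤F A
sumOrderings-nonNeg (suc j) 0≤F A = sumExtensions-nonNeg A (sumOrderings-nonNeg j 0≤F)

-- The right side also inserts elements already present, which only adds nonnegative terms.
sumExtensions-upper : ∀ {n} (A : Subset n) {G} → (∀ B → 0ℚ ≤ G B) → sumExtensions A G ≤ sumOver (allFin n) (λ a → G (A [ a ]≔ inside))
sumExtensions-upper []            0≤G = ≤-refl
sumExtensions-upper {suc n} (inside ∷ A) {G} 0≤G = begin
  sumExtensions A (G ∘ (inside ∷_)) ≤⟨ sumExtensions-upper A (λ B → 0≤G (inside ∷ B)) ⟩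
  s ≡⟨ sym (+-identityˡ s) ⟩
  0ℚ + s ≤⟨ +-monoˡ-≤ s (0≤G (inside ∷ A)) ⟩
  G (inside ∷ A) + s ≡⟨ sym (sum-allFin-suc n (λ a → G ((inside ∷ A) [ a ]≔ inside))) ⟩
  sumOver (allFin (suc n)) (λ a → G ((inside ∷ A) [ a ]≔ inside)) ∎
  where
  open ≤-Reasoning
  s = sumOver (allFin n) (λ a → G (inside ∷ (A [ a ]≔ inside)))
sumExtensions-upper {suc n} (outside ∷ A) {G} 0≤G = ≤-trans
  (+-monoʳ-≤ (G (inside ∷ A)) (sumExtensions-upper A (λ B → 0≤G (outside ∷ B))))
  (≤-reflexive (sym (sum-allFin-suc n (λ a → G ((outside ∷ A) [ a ]≔ inside)))))

-- `A` has `n - card A` extensions by one element.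
sumExtensions-lower : ∀ {n} (A : Subset n) {G g} → (∀ B → card B ≡ suc (card A) → g ≤ G B) →
  (fromℕ n - fromℕ (card A)) * g ≤ sumExtensions A G
sumExtensions-lower [] {G} {g} le = ≤-reflexive (solve 1 (λ g → (con 0ℚ :- con 0ℚ) :* g := con 0ℚ) refl g)
sumExtensions-lower {suc n} (inside ∷ A) {G} {g} le = ≤-trans
  (≤-reflexive (trans (cong₂ (λ x y → (x - y) * g) (fromℕ-suc n) (fromℕ-suc (card A)))
    (solve 3 (λ n a g → ((con 1ℚ :+ n) :- (con 1ℚ :+ a)) :* g := (n :- a) :* g) refl (fromℕ n) (fromℕ (card A)) g)))
  (sumExtensions-lower A (λ B eq → le (inside ∷ B) (cong suc eq)))
sumExtensions-lower {suc n} (outside ∷ A) {G} {g} le = ≤-trans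
  (≤-reflexive (trans (cong (λ x → (x - fromℕ (card A)) * g) (fromℕ-suc n))
    (solve 3 (λ n a g → ((con 1ℚ :+ n) :- a) :* g := g :+ (n :- a) :* g) refl (fromℕ n) (fromℕ (card A)) g)))
  (+-mono-≤ (le (inside ∷ A) refl) (sumExtensions-lower A (λ B eq → le (outside ∷ B) eq)))

-- Random sequences and the sets of their entries

module SubsetSums {p : ℕ} .{{_ : NonZero p}} where

  open Residues {p}
  open Uniform {p}

  insertAll : ∀ {k} → Vec (Fin p) k → Subset p → Subset p
  insertAll []       A = A
  insertAll (a ∷ as) A = insertAll as (A [ a ]≔ inside)

  sumOrderings-upper : ∀ k {F : Subset p → ℚ} → (∀ B → 0ℚ ≤ F B) → ∀ A →
    ι ^ k * sumOrderings k F A ≤ 𝔼 (vectors k) (λ as → F (insertAll as A))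
  sumOrderings-upper zero    {F} 0≤F A = ≤-reflexive (*-identityˡ (F A))
  sumOrderings-upper (suc k) {F} 0≤F A = begin
    (ι * ι ^ k) * sumExtensions A (sumOrderings k F)
      ≤⟨ *-monoˡ (ι * ι ^ k) (^-nonNeg 0≤ι (suc k)) (sumExtensions-upper A (sumOrderings-nonNeg k 0≤F)) ⟩
    (ι * ι ^ k) * sumOver (allFin p) (λ a → sumOrderings k F (A [ a ]≔ inside))
      ≡⟨ trans (*-assoc ι (ι ^ k) (sumOver (allFin p) (λ a → sumOrderings k F (A [ a ]≔ inside))))
           (cong (ι *_) (sym (sum-* (allFin p) (ι ^ k) (λ a → sumOrderings k F (A [ a ]≔ inside))))) ⟩
    𝔼 uniform (λ a → ι ^ k * sumOrderings k F (A [ a ]≔ inside))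
      ≤⟨ 𝔼-mono uniform (λ a → sumOrderings-upper k 0≤F (A [ a ]≔ inside)) ⟩
    𝔼 (vectors (suc k)) (λ as → F (insertAll as A)) ∎
    where open ≤-Reasoning

  -- The right side is the probability that `k` draws are distinct and outside `A`. Each draw is new
  -- with probability at least `1 - m / p`, as at most `m` elements are occupied before it.
  sumOrderings-lower : ∀ k m → 0ℚ ≤ 1ℚ - fromℕ m * ι → ∀ (A : Subset p) → card A ℕ.+ k ℕ.≤ m →
    (1ℚ - fromℕ m * ι) ^ k ≤ ι ^ k * sumOrderings k (λ _ → 1ℚ) A
  sumOrderings-lower zero    m 0≤x A _  = ≤-reflexive (sym (*-identityˡ 1ℚ))
  sumOrderings-lower (suc k) m 0≤x A le = begin
    (1ℚ - fromℕ m * ι) * x ^ k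
      ≤⟨ *-monoʳ (x ^ k) (^-nonNeg 0≤x k) (+-monoʳ-≤ 1ℚ (neg-antimono-≤ (*-monoʳ ι 0≤ι (fromℕ-mono (ℕ.≤-trans (ℕ.m≤m+n (card A) (suc k)) le))))) ⟩
    (1ℚ - fromℕ (card A) * ι) * x ^ k
      ≡⟨ cong (λ o → (o - fromℕ (card A) * ι) * x ^ k) (sym ι*p≡1) ⟩
    (ι * fromℕ p - fromℕ (card A) * ι) * x ^ k
      ≡⟨ solve 4 (λ i p a x → (i :* p :- a :* i) :* x := i :* ((p :- a) :* x)) refl ι (fromℕ p) (fromℕ (card A)) (x ^ k) ⟩
    ι * ((fromℕ p - fromℕ (card A)) * x ^ k)
      ≤⟨ *-monoˡ ι 0≤ι (≤-trans (sumExtensions-lower A (λ B eq → sumOrderings-lower k m 0≤x B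
           (subst (λ c → c ℕ.+ k ℕ.≤ m) (sym eq) (subst (ℕ._≤ m) (ℕ.+-suc (card A) k) le)))) (≤-reflexive (scale A (ι ^ k) (sumOrderings k (λ _ → 1ℚ))))) ⟩
    ι * (ι ^ k * sumExtensions A (sumOrderings k (λ _ → 1ℚ)))
      ≡⟨ sym (*-assoc ι (ι ^ k) (sumExtensions A (sumOrderings k (λ _ → 1ℚ)))) ⟩
    ι ^ suc k * sumOrderings (suc k) (λ _ → 1ℚ) A ∎
    where
    open ≤-Reasoning
    x = 1ℚ - fromℕ m * ι
    scale : ∀ {n} (A : Subset n) c (G : Subset n → ℚ) → sumExtensions A (λ B → c * G B) ≡ c * sumExtensions A G
    scale []            c G = sym (*-zeroʳ c)
    scale (inside ∷ A)  c G = scale A c (G ∘ (inside ∷_))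
    scale (outside ∷ A) c G = trans (cong (c * G (inside ∷ A) +_) (scale A c (G ∘ (outside ∷_))))
      (sym (*-distribˡ-+ c (G (inside ∷ A)) (sumExtensions A (G ∘ (outside ∷_)))))

  -- `∑` over an arbitrary list, so that the removal of an element can be handled by induction.
  sumOf : Subset p → List (Fin p) → Fin p
  sumOf S L = foldr _⊕_ 𝟘 (filter (_∈? S) L)

  ∈-≔-other : ∀ {S : Subset p} {a b s} → b ≢ a → b ∈ₛ S [ a ]≔ s → b ∈ₛ S
  ∈-≔-other {S} {a} {b} {s} b≢a b∈ = Vec.lookup⇒[]= b S (trans (sym (Vec.lookup∘update′ b≢a S s)) (Vec.[]=⇒lookup b∈))

  ∉-≔-outside : ∀ {S : Subset p} {a} → a ∉ₛ S [ a ]≔ outside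
  ∉-≔-outside {S} {a} a∈ with trans (sym (Vec.[]=⇒lookup a∈)) (Vec.lookup∘update a S outside)
  ... | ()

  sumOf-remove-∉ : ∀ S a L → a ∉ L → sumOf (S [ a ]≔ outside) L ≡ sumOf S L
  sumOf-remove-∉ S a [] a∉ = refl
  sumOf-remove-∉ S a (b ∷ L) a∉ with b ∈? S | b ∈? (S [ a ]≔ outside)
  ... | yes _  | yes _  = cong (b ⊕_) (sumOf-remove-∉ S a L (a∉ ∘ there))
  ... | no _   | no _   = sumOf-remove-∉ S a L (a∉ ∘ there)
  ... | yes b∈ | no b∉  = contradiction (Vec.[]≔-minimal S b a (λ eq → a∉ (here (sym eq))) b∈) b∉
  ... | no b∉  | yes b∈ = contradiction (∈-≔-other (λ eq → a∉ (here (sym eq))) b∈) b∉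

  sumOf-remove : ∀ S a L → Unique L → a ∈ L → a ∈ₛ S → sumOf S L ≡ a ⊕ sumOf (S [ a ]≔ outside) L
  sumOf-remove S a (b ∷ L) (b∉ ∷ u) (here refl) a∈S with b ∈? S | b ∈? (S [ b ]≔ outside)
  ... | no b∉S | _     = contradiction a∈S b∉S
  ... | yes _  | yes b∈ = contradiction b∈ ∉-≔-outside
  ... | yes _  | no _  = cong (b ⊕_) (sym (sumOf-remove-∉ S b L λ b∈ → All.lookup b∉ b∈ refl))
  sumOf-remove S a (b ∷ L) (b∉ ∷ u) (there a∈) a∈S with b ∈? S | b ∈? (S [ a ]≔ outside)
  ... | yes _  | yes _  = trans (cong (b ⊕_) (sumOf-remove S a L u a∈ a∈S))
        (trans (sym (⊕-assoc b a (sumOf (S [ a ]≔ outside) L))) (trans (cong (_⊕ sumOf (S [ a ]≔ outside) L) (⊕-comm b a)) (⊕-assoc a b (sumOf (S [ a ]≔ outside) L))))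
  ... | no _   | no _   = sumOf-remove S a L u a∈ a∈S
  ... | yes b∈ | no b∉′  = contradiction (Vec.[]≔-minimal S b a (λ eq → All.lookup b∉ a∈ eq) b∈) b∉′
  ... | no b∉′  | yes b∈ = contradiction (∈-≔-other (λ eq → All.lookup b∉ a∈ eq) b∈) b∉′

  ∑-remove : ∀ S a → a ∈ₛ S → ∑ S ≡ a ⊕ ∑ (S [ a ]≔ outside)
  ∑-remove S a = sumOf-remove S a (allFin p) (Unique.allFin⁺ p) (∈-allFin a)

  ∑-empty : ∀ S → S ⊆ ∅ → ∑ S ≡ 𝟘
  ∑-empty S S⊆∅ = cong (foldr _⊕_ 𝟘) (List.filter-none (_∈? S) {xs = allFin p} (All.tabulate λ {x} _ x∈ → ∉⊥ (S⊆∅ x∈)))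

half⁻¹ : ∀ m n .{{_ : NonZero n}} → ½ ≤ ℤ.+ m / n → n ℕ.≤ m ℕ.* 2
half⁻¹ m (suc n) le = case ℚᵘ.≤-respʳ-≃ (ℚ.toℚᵘ-fromℚᵘ (ℚᵘ.mkℚᵘ (ℤ.+ m) n)) (ℚ.toℚᵘ-mono-≤ le) of λ
  { (ℚᵘ.*≤* le′) → ℤ.drop‿+≤+ (subst₂ ℤ._≤_ (ℤ.*-identityˡ (ℤ.+ suc n)) (sym (ℤ.pos-* m 2)) le′) }

-- The base case is 1452 < 2048; at 10 the inequality fails. It serves to make `3 (n + h)² < p`,
-- that is, to make repetitions rare.
12n²<2^n : ∀ {n} → 11 ℕ.≤′ n → 12 ℕ.* (n ℕ.* n) ℕ.< 2 ℕ.^ n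
12n²<2^n ℕ.≤′-refl = ℕ.m≤m+n 1453 595
12n²<2^n {suc n} (ℕ.≤′-step le) = begin-strict
  12 ℕ.* (suc n ℕ.* suc n)
    ≡⟨ solveⁿ 1 (λ n → conⁿ 12 :*ⁿ ((conⁿ 1 :+ⁿ n) :*ⁿ (conⁿ 1 :+ⁿ n)) :=ⁿ conⁿ 12 :*ⁿ (n :*ⁿ n :+ⁿ (conⁿ 2 :*ⁿ n :+ⁿ conⁿ 1))) refl n ⟩
  12 ℕ.* (n ℕ.* n ℕ.+ (2 ℕ.* n ℕ.+ 1)) ≤⟨ ℕ.*-monoʳ-≤ 12 (ℕ.+-monoʳ-≤ (n ℕ.* n) 2n+1≤n²) ⟩
  12 ℕ.* (n ℕ.* n ℕ.+ n ℕ.* n) ≡⟨ ℕ.*-distribˡ-+ 12 (n ℕ.* n) (n ℕ.* n) ⟩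
  12 ℕ.* (n ℕ.* n) ℕ.+ 12 ℕ.* (n ℕ.* n) <⟨ ℕ.+-mono-< (12n²<2^n le) (12n²<2^n le) ⟩
  2 ℕ.^ n ℕ.+ 2 ℕ.^ n ≡⟨ cong (2 ℕ.^ n ℕ.+_) (sym (ℕ.+-identityʳ (2 ℕ.^ n))) ⟩
  2 ℕ.^ suc n ∎
  where
  open ℕ.≤-Reasoning
  11≤n : 11 ℕ.≤ n
  11≤n = ℕ.≤′⇒≤ le
  2n+1≤n² : 2 ℕ.* n ℕ.+ 1 ℕ.≤ n ℕ.* n
  2n+1≤n² = begin
    2 ℕ.* n ℕ.+ 1 ≤⟨ ℕ.+-monoʳ-≤ (2 ℕ.* n) (ℕ.≤-trans (s≤s z≤n) 11≤n) ⟩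
    2 ℕ.* n ℕ.+ n ≡⟨ ℕ.+-comm (2 ℕ.* n) n ⟩
    3 ℕ.* n ≤⟨ ℕ.*-monoˡ-≤ n (ℕ.≤-trans (ℕ.m≤m+n 3 8) 11≤n) ⟩
    n ℕ.* n ∎

-- Random sets are incomplete

module Incomplete {p : ℕ} (pr : Prime p) (2<p : 2 ℕ.< p) where

  open Solutions pr 2<p
  open Coverage pr 2<p
  open Dependence pr 2<p using (ι≤1)
  open SubsetSums {p}

  value-zero : ∀ {K} (as : V K) T x → value as T x ≡ 𝟘 → representations as x ≢ 0
  value-zero [] [] x eq with x Fin.≟ 𝟘
  ... | yes _  = λ ()
  ... | no x≢0 = contradiction eq x≢0
  value-zero (a ∷ as) (true ∷ T)  x eq = value-zero as T (x ⊕ a) eq ∘ ℕ.m+n≡0⇒m≡0 (representations as (x ⊕ a))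
  value-zero (a ∷ as) (false ∷ T) x eq = value-zero as T x eq ∘ ℕ.m+n≡0⇒n≡0 (representations as (x ⊕ a))

  -- An element of `S` that occurs several times in `as` is charged to its last position only: it
  -- leaves `S′` there, and the earlier copies find it gone. The quantifier over `x` follows the
  -- accumulator of `value`.
  split-subset : ∀ {K} (as : V K) A S → S ⊆ insertAll as A →
    ∃[ T ] Σ[ S′ ∈ Subset p ] S′ ⊆ A × (∀ x → value as T (x ⊕ ∑ S′) ≡ x ⊕ ∑ S)
  split-subset []       A S S⊆ = [] , S , S⊆ , λ x → refl
  split-subset (a ∷ as) A S S⊆ with split-subset as (A [ a ]≔ inside) S S⊆
  ... | T , S′ , S′⊆ , eq with a ∈? S′
  ...   | no a∉ = false ∷ T , S′ , (λ {b} b∈ → ∈-≔-other (λ { refl → a∉ b∈ }) (S′⊆ b∈)) , eq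
  ...   | yes a∈ = true ∷ T , (S′ [ a ]≔ outside) ,
          (λ {b} b∈ → ∈-≔-other (λ { refl → ∉-≔-outside b∈ }) (S′⊆ (∈-≔-other (λ { refl → ∉-≔-outside b∈ }) b∈))) ,
          λ x → trans (cong (value as T) (trans (⊕-assoc x (∑ (S′ [ a ]≔ outside)) a)
            (cong (x ⊕_) (trans (⊕-comm (∑ (S′ [ a ]≔ outside)) a) (sym (∑-remove S′ a a∈)))))) (eq x)

  -- `representations` counts solutions of `x + Σ S = 0`, so completeness is applied to `⊖ x`.
  complete⇒covering : ∀ {K} (as : V K) → Complete (insertAll as ∅) → Covering as
  complete⇒covering as complete x = case complete (⊖ x) of λ (S , S⊆ , ∑S≡) →
    case split-subset as ∅ S S⊆ of λ (T , S′ , S′⊆ , eq) →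
      value-zero as T x (trans (cong (value as T) (sym (trans (cong (x ⊕_) (∑-empty S′ S′⊆)) (+ᶠ-identityʳ x))))
        (trans (eq x) (trans (cong (x ⊕_) ∑S≡) (⊕-inverseʳ x))))

  coveringProbability : ℕ → ℚ
  coveringProbability k = 𝔼 (vectors k) (λ as → 𝟙 (covering? as))

  -- Prepending an entry keeps every subset sum; thus one estimate at `k₀` serves all smaller sizes.
  coveringProbability-mono : ∀ {j k} → j ℕ.≤ k → coveringProbability j ≤ coveringProbability k
  coveringProbability-mono {j} j≤k = go (ℕ.≤⇒≤′ j≤k)
    where
    step : ∀ k → coveringProbability k ≤ coveringProbability (suc k)
    step k = subst (_≤ coveringProbability (suc k)) (𝔼-const uniform (coveringProbability k))
      (𝔼-mono uniform λ a → 𝔼-mono (vectors k) λ as → 𝟙-mono (covering? as) (covering? (a ∷ as))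
        λ cov x → cov x ∘ ℕ.m+n≡0⇒n≡0 (representations as (x ⊕ a)))
    go : ∀ {k} → j ℕ.≤′ k → coveringProbability j ≤ coveringProbability k
    go ℕ.≤′-refl     = ≤-refl
    go {suc k} (ℕ.≤′-step le) = ≤-trans (go le) (step k)

  sumSize-complete : ∀ k → sumSize {p} k (λ A → 𝟙 (complete? A)) ≡ fromℕ (#complete p k)
  sumSize-complete k = trans (sym (sum-filter (λ A → card A ℕ.≟ k) (allSubsets p) (λ A → 𝟙 (complete? A))))
    (sum-𝟙 complete? (subsetsOfSize p k))

  sumSize-all : ∀ k → sumSize {p} k (λ A → 1ℚ) ≡ fromℕ (#all p k)
  sumSize-all k = trans (sum-cong (allSubsets p) λ A → *-identityʳ (𝟙 (card A ℕ.≟ k))) (sum-𝟙 (λ A → card A ℕ.≟ k) (allSubsets p))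

  0≤orderings : ∀ i j → 0ℚ ≤ orderings i j
  0≤orderings i zero    = <⇒≤ 0<1
  0≤orderings i (suc j) = *-nonNeg (0≤fromℕ (suc i)) (0≤orderings (suc i) j)

  -- With `w = k! / p ^ k`, the product `w * A` is the probability that a random sequence has
  -- distinct entries, at least `1 - k² / p`, and `w * C` that they also form a complete set, at
  -- most 1/3. If half of the sets were complete, `1 - q ≤ 2/3` would follow, against `3 k² < p`.
  incomplete : ∀ {k₀} → coveringProbability k₀ ≤ ℤ.+ 1 / 3 → 3 ℕ.* (k₀ ℕ.* k₀) ℕ.< p →
    ∀ {k} → k ℕ.≤ k₀ → ¬ CompleteWithProbability≥½ p k
  incomplete {k₀} rare small {k} k≤k₀ (nz , half) = ℚ.<-irrefl refl (<-≤-trans 0<ι (begin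
    -- `q-small` uses `3 k² + 1 ≤ p`; the 1 leaves the slack `ι` that makes the contradiction
    -- strict.
    ι ≡⟨ solve 2 (λ q i → i := (con 1ℚ :- con 3ℚ :* q) :- ((con 1ℚ :- i) :- con 3ℚ :* q)) refl q ι ⟩
    (1ℚ - 3ℚ * q) - ((1ℚ - ι) - 3ℚ * q)
                              ≤⟨ +-mono-≤ upper (neg-antimono-≤ q-small) ⟩
    0ℚ - 0ℚ ≡⟨ +-inverseʳ 0ℚ ⟩
    0ℚ ∎))
    where
    open ≤-Reasoning
    3ℚ = fromℕ 3
    x = fromℕ k * ι
    q = fromℕ (k ℕ.* k) * ι
    w = ι ^ k * orderings 0 k
    C = fromℕ (#complete p k)
    A = fromℕ (#all p k)
    q-small : 0ℚ ≤ (1ℚ - ι) - 3ℚ * q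
    q-small = begin
      0ℚ ≤⟨ p-q≥0 (*-monoˡ ι 0≤ι (fromℕ-mono (ℕ.≤-trans (s≤s (ℕ.*-monoʳ-≤ 3 (ℕ.*-mono-≤ k≤k₀ k≤k₀))) small))) ⟩
      ι * fromℕ p - ι * fromℕ (suc (3 ℕ.* (k ℕ.* k)))
        ≡⟨ cong₂ (λ y z → y - ι * z) ι*p≡1 (trans (fromℕ-suc (3 ℕ.* (k ℕ.* k))) (cong (1ℚ +_) (fromℕ-* 3 (k ℕ.* k)))) ⟩
      1ℚ - ι * (1ℚ + 3ℚ * fromℕ (k ℕ.* k))
        ≡⟨ solve 2 (λ i s → con 1ℚ :- i :* (con 1ℚ :+ con 3ℚ :* s) := (con 1ℚ :- i) :- con 3ℚ :* (s :* i)) refl ι (fromℕ (k ℕ.* k)) ⟩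
      (1ℚ - ι) - 3ℚ * q ∎
    0≤q : 0ℚ ≤ q
    0≤q = *-nonNeg (0≤fromℕ (k ℕ.* k)) 0≤ι
    k*x≡q : fromℕ k * x ≡ q
    k*x≡q = trans (sym (*-assoc (fromℕ k) (fromℕ k) ι)) (cong (_* ι) (sym (fromℕ-* k k)))
    x≤1 : x ≤ 1ℚ
    x≤1 = begin
      fromℕ k * ι ≤⟨ *-monoʳ ι 0≤ι (fromℕ-mono (ℕ.≤-trans (k≤k² k) (ℕ.≤-trans (ℕ.m≤m+n (k ℕ.* k) _)
                        (ℕ.≤-trans (ℕ.*-monoʳ-≤ 3 (ℕ.*-mono-≤ k≤k₀ k≤k₀)) (ℕ.<⇒≤ small))))) ⟩
      fromℕ p * ι ≡⟨ trans (*-comm (fromℕ p) ι) ι*p≡1 ⟩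
      1ℚ ∎
      where
      k≤k² : ∀ k → k ℕ.≤ k ℕ.* k
      k≤k² zero    = z≤n
      k≤k² (suc k) = ℕ.m≤m+n (suc k) (k ℕ.* suc k)
    wC≤ : w * C ≤ ℤ.+ 1 / 3
    wC≤ = begin
      w * C ≡⟨ trans (*-assoc (ι ^ k) (orderings 0 k) C) (cong (ι ^ k *_)
                  (trans (cong (orderings 0 k *_) (sym (sumSize-complete k))) (sym (sumOrderings-∅ k (λ A → 𝟙 (complete? A)))))) ⟩
      ι ^ k * sumOrderings k (λ A → 𝟙 (complete? A)) ∅ ≤⟨ sumOrderings-upper k (λ A → 0≤𝟙 (complete? A)) ∅ ⟩
      𝔼 (vectors k) (λ as → 𝟙 (complete? (insertAll as ∅)))
        ≤⟨ 𝔼-mono (vectors k) (λ as → 𝟙-mono (complete? (insertAll as ∅)) (covering? as) (complete⇒covering as)) ⟩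
      coveringProbability k ≤⟨ coveringProbability-mono k≤k₀ ⟩
      coveringProbability k₀ ≤⟨ rare ⟩
      ℤ.+ 1 / 3 ∎
    wA≥ : 1ℚ - q ≤ w * A
    wA≥ = begin
      1ℚ - q ≡⟨ cong (λ z → 1ℚ - z) (sym k*x≡q) ⟩
      1ℚ - fromℕ k * x ≤⟨ bernoulli (*-nonNeg (0≤fromℕ k) 0≤ι) x≤1 k ⟩
      (1ℚ - x) ^ k ≤⟨ sumOrderings-lower k k (p-q≥0 x≤1) ∅ (ℕ.≤-reflexive (cong (ℕ._+ k) (∣⊥∣≡0 p))) ⟩
      ι ^ k * sumOrderings k (λ _ → 1ℚ) ∅
        ≡⟨ trans (cong (ι ^ k *_) (trans (sumOrderings-∅ k (λ _ → 1ℚ)) (cong (orderings 0 k *_) (sumSize-all k)))) (sym (*-assoc (ι ^ k) (orderings 0 k) A)) ⟩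
      w * A ∎
    A≤2C : A ≤ C * 2ℚ
    A≤2C = ≤-trans (fromℕ-mono (half⁻¹ (#complete p k) (#all p k) {{nz}} half)) (≤-reflexive (fromℕ-* (#complete p k) 2))
    upper : 1ℚ - 3ℚ * q ≤ 0ℚ
    upper = begin
      1ℚ - 3ℚ * q ≡⟨ solve 1 (λ q → con 1ℚ :- con 3ℚ :* q := con 3ℚ :* (con 1ℚ :- q) :- con 2ℚ) refl q ⟩
      3ℚ * (1ℚ - q) - 2ℚ ≤⟨ +-monoˡ-≤ (- 2ℚ) (*-monoˡ 3ℚ (0≤fromℕ 3) (begin
        1ℚ - q ≤⟨ wA≥ ⟩
        w * A ≤⟨ *-monoˡ w (*-nonNeg (^-nonNeg 0≤ι k) (0≤orderings 0 k)) A≤2C ⟩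
        w * (C * 2ℚ) ≡⟨ sym (*-assoc w C 2ℚ) ⟩
        w * C * 2ℚ ≤⟨ *-monoʳ 2ℚ (<⇒≤ 0<2ℚ) wC≤ ⟩
        (ℤ.+ 1 / 3) * 2ℚ ∎)) ⟩
      3ℚ * ((ℤ.+ 1 / 3) * 2ℚ) - 2ℚ ≡⟨ refl ⟩
      0ℚ ∎

M≤16M² : ∀ M → 16 ℕ.≤ M → M ℕ.≤ 16 ℕ.* (M ℕ.* M)
M≤16M² M 16≤M = ℕ.≤-trans (ℕ.m≤m*n M M {{ℕ.>-nonZero (ℕ.≤-trans (s≤s z≤n) 16≤M)}}) (ℕ.m≤n*m (M ℕ.* M) 16)

3[n+h]²≤12n² : ∀ {n h} → h ℕ.≤ n → 3 ℕ.* ((n ℕ.+ h) ℕ.* (n ℕ.+ h)) ℕ.≤ 12 ℕ.* (n ℕ.* n)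
3[n+h]²≤12n² {n} {h} h≤n = ℕ.≤-trans (ℕ.*-monoʳ-≤ 3 (ℕ.*-mono-≤ (ℕ.+-monoʳ-≤ n h≤n) (ℕ.+-monoʳ-≤ n h≤n)))
  (ℕ.≤-reflexive (solveⁿ 1 (λ n → conⁿ 3 :*ⁿ ((n :+ⁿ n) :*ⁿ (n :+ⁿ n)) :=ⁿ conⁿ 12 :*ⁿ (n :*ⁿ n)) refl n))

module _ {p : ℕ} (pr : Prime p) where

  private instance
    p≢0 : NonZero p
    p≢0 = prime⇒nonZero pr

  -- If `f p ≤ n + h`, the estimate at length `n + h` contradicts the property that `f p` has. The
  -- side conditions, such as `3 (n + h)² < p`, follow from the size of `n`.
  f-lower : ∀ n h → 2 ℕ.^ n ℕ.≤ p → 16 ℕ.* ((16 ℕ.* 2 ℕ.^ suc h) ℕ.* (16 ℕ.* 2 ℕ.^ suc h)) ℕ.≤ n →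
    suc (n ℕ.+ h) ℕ.≤ f p
  f-lower n h 2^n≤p n-large = ℕ.≰⇒> λ f≤ →
    Incomplete.incomplete pr 2<p {n ℕ.+ h} rare small {f p} f≤ (proj₁ (proj₂ (f-exists p)))
    where
    L≤16L : 2 ℕ.^ suc h ℕ.≤ 16 ℕ.* 2 ℕ.^ suc h
    L≤16L = ℕ.m≤n*m (2 ℕ.^ suc h) 16
    16≤M : 16 ℕ.≤ 16 ℕ.* 2 ℕ.^ suc h
    16≤M = ℕ.*-monoʳ-≤ 16 {1} {2 ℕ.^ suc h} (ℕ.^-monoʳ-≤ 2 {0} {suc h} z≤n)
    M≤n : 16 ℕ.* 2 ℕ.^ suc h ℕ.≤ n
    M≤n = ℕ.≤-trans (M≤16M² (16 ℕ.* 2 ℕ.^ suc h) 16≤M) n-large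
    11≤n : 11 ℕ.≤ n
    11≤n = ℕ.≤-trans (ℕ.m≤m+n 11 5) (ℕ.≤-trans 16≤M M≤n)
    h≤n : h ℕ.≤ n
    h≤n = ℕ.≤-trans (ℕ.n≤1+n h) (ℕ.≤-trans (n≤2^n (suc h)) (ℕ.≤-trans L≤16L M≤n))
    small : 3 ℕ.* ((n ℕ.+ h) ℕ.* (n ℕ.+ h)) ℕ.< p
    small = ℕ.≤-trans (s≤s (3[n+h]²≤12n² h≤n)) (ℕ.≤-trans (12n²<2^n (ℕ.≤⇒≤′ 11≤n)) 2^n≤p)
    2<p : 2 ℕ.< p
    2<p = ℕ.≤-trans (ℕ.≤-trans (ℕ.m≤m+n 3 8) 11≤n) (ℕ.≤-trans (n≤2^n n) 2^n≤p)
    rare : Incomplete.coveringProbability pr 2<p (n ℕ.+ h) ≤ ℤ.+ 1 / 3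
    rare = Threshold.covering-rare-at pr 2<p n h 2^n≤p n-large

-- Estimates for the logarithm

module Riemann where

  open ≤-Reasoning

  -- The hypothesis says `b / a ≤ b′ / a′`: a Riemann sum for `1 / t` depends on the endpoints only
  -- through their ratio and increases with it. This yields monotonicity in the upper limit and
  -- invariance under scaling at once.
  riemann-mono : ∀ n a b a′ b′ (0<a : 0ℚ < a) (0<b : 0ℚ < b) (0<a′ : 0ℚ < a′) (0<b′ : 0ℚ < b′) →
    b * a′ ≤ b′ * a → riemann n a b 0<a 0<b ≤ riemann n a′ b′ 0<a′ 0<b′
  riemann-mono zero a b a′ b′ 0<a 0<b 0<a′ 0<b′ le = begin
    (b - a) * r ≡⟨ solve 3 (λ a b r → (b :- a) :* r := b :* r :- a :* r) refl a b r ⟩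
    b * r - a * r ≡⟨ cong₂ (λ x y → b * x - y) (sym (trans (cong (r *_) (recip-inv a′ 0<a′)) (*-identityʳ r))) (recip-inv a 0<a) ⟩
    b * (r * (a′ * r′)) - 1ℚ ≡⟨ solve 4 (λ b r a′ r′ → b :* (r :* (a′ :* r′)) :- con 1ℚ := (b :* a′) :* (r :* r′) :- con 1ℚ) refl b r a′ r′ ⟩
    (b * a′) * (r * r′) - 1ℚ ≤⟨ +-monoˡ-≤ (- 1ℚ) (*-monoʳ (r * r′) (*-nonNeg (<⇒≤ (recip-pos a 0<a)) (<⇒≤ (recip-pos a′ 0<a′))) le) ⟩
    (b′ * a) * (r * r′) - 1ℚ ≡⟨ solve 4 (λ b′ a r r′ → (b′ :* a) :* (r :* r′) :- con 1ℚ := b′ :* (r′ :* (a :* r)) :- con 1ℚ) refl b′ a r r′ ⟩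
    b′ * (r′ * (a * r)) - 1ℚ ≡⟨ cong₂ (λ x y → b′ * x - y) (trans (cong (r′ *_) (recip-inv a 0<a)) (*-identityʳ r′)) (sym (recip-inv a′ 0<a′)) ⟩
    b′ * r′ - a′ * r′ ≡⟨ solve 3 (λ a b r → b :* r :- a :* r := (b :- a) :* r) refl a′ b′ r′ ⟩
    (b′ - a′) * r′ ∎
    where
    r = recip a 0<a
    r′ = recip a′ 0<a′
  riemann-mono (suc n) a b a′ b′ 0<a 0<b 0<a′ 0<b′ le = +-mono-≤
    (riemann-mono n a (mid a b) a′ (mid a′ b′) 0<a (0<mid 0<a 0<b) 0<a′ (0<mid 0<a′ 0<b′) (p-q≥0⁻¹ (subst (0ℚ ≤_)
      (solve 4 (λ a b a′ b′ → con ½ :* (b′ :* a :- b :* a′) := con ½ :* (a′ :+ b′) :* a :- con ½ :* (a :+ b) :* a′) refl a b a′ b′) gap)))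
    (riemann-mono n (mid a b) b (mid a′ b′) b′ (0<mid 0<a 0<b) 0<b (0<mid 0<a′ 0<b′) 0<b′ (p-q≥0⁻¹ (subst (0ℚ ≤_)
      (solve 4 (λ a b a′ b′ → con ½ :* (b′ :* a :- b :* a′) := b′ :* (con ½ :* (a :+ b)) :- b :* (con ½ :* (a′ :+ b′))) refl a b a′ b′) gap)))
    where
    gap : 0ℚ ≤ ½ * (b′ * a - b * a′)
    gap = *-nonNeg (<⇒≤ 0<½) (p-q≥0 le)

  rightSum : ℕ → (a b : ℚ) → .(0ℚ < a) → .(0ℚ < b) → ℚ
  rightSum zero    a b 0<a 0<b = (b - a) * recip b 0<b
  rightSum (suc n) a b 0<a 0<b = rightSum n a (mid a b) 0<a (0<mid 0<a 0<b) + rightSum n (mid a b) b (0<mid 0<a 0<b) 0<b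

  -- On pieces of equal length the differences between left and right sums telescope to the mesh
  -- times `1 / a - 1 / b`.
  riemann-rightSum : ∀ n a b (0<a : 0ℚ < a) (0<b : 0ℚ < b) →
    riemann n a b 0<a 0<b ≡ rightSum n a b 0<a 0<b + (b - a) * ½^ n * (recip a 0<a - recip b 0<b)
  riemann-rightSum zero a b 0<a 0<b =
    solve 4 (λ a b r s → (b :- a) :* r := (b :- a) :* s :+ (b :- a) :* con 1ℚ :* (r :- s)) refl a b (recip a 0<a) (recip b 0<b)
  riemann-rightSum (suc n) a b 0<a 0<b = trans
    (cong₂ _+_ (riemann-rightSum n a (mid a b) 0<a (0<mid 0<a 0<b)) (riemann-rightSum n (mid a b) b (0<mid 0<a 0<b) 0<b))
    (solve 8 (λ a b x y h r s t → let m = con ½ :* (a :+ b) in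
        (x :+ (m :- a) :* h :* (r :- s)) :+ (y :+ (b :- m) :* h :* (s :- t)) := (x :+ y) :+ (b :- a) :* (con ½ :* h) :* (r :- t)) refl
      a b (rightSum n a (mid a b) 0<a (0<mid 0<a 0<b)) (rightSum n (mid a b) b (0<mid 0<a 0<b) 0<b) (½^ n)
      (recip a 0<a) (recip (mid a b) (0<mid 0<a 0<b)) (recip b 0<b))

  -- Φ plays the role of a primitive of a step function above 1/x, with total increase v.
  Majorant : (a b v : ℚ) → Set
  Majorant a b v = Σ[ Φ ∈ (ℚ → ℚ) ] (∀ x y → a ≤ x → x ≤ y → y ≤ b → y - x ≤ (Φ y - Φ x) * y) × Φ b - Φ a ≡ v

  mid-bounds : ∀ {a b} → a ≤ b → a ≤ mid a b × mid a b ≤ b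
  mid-bounds {a} {b} a≤b = RiemannLemmas.mid-≥ ≤-refl a≤b ,
    p-q≥0⁻¹ (subst (0ℚ ≤_) (sym (RiemannLemmas.b-mid a b)) (*-nonNeg (<⇒≤ 0<½) (p-q≥0 a≤b)))

  -- The increments of `Φ` telescope over any subdivision, so right sums of every depth lie below
  -- the same total.
  rightSum≤majorant : ∀ {a b v} ((Φ , _) : Majorant a b v) n x y (0<x : 0ℚ < x) (0<y : 0ℚ < y) →
    a ≤ x → x ≤ y → y ≤ b → rightSum n x y 0<x 0<y ≤ Φ y - Φ x
  rightSum≤majorant (Φ , dom , _) zero x y 0<x 0<y a≤x x≤y y≤b = begin
    (y - x) * recip y 0<y ≤⟨ *-monoʳ (recip y 0<y) (<⇒≤ (recip-pos y 0<y)) (dom x y a≤x x≤y y≤b) ⟩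
    (Φ y - Φ x) * y * recip y 0<y ≡⟨ trans (*-assoc (Φ y - Φ x) y (recip y 0<y)) (trans (cong ((Φ y - Φ x) *_) (recip-inv y 0<y)) (*-identityʳ (Φ y - Φ x))) ⟩
    Φ y - Φ x ∎
  rightSum≤majorant M@(Φ , _) (suc n) x y 0<x 0<y a≤x x≤y y≤b = begin
    rightSum n x m 0<x (0<mid 0<x 0<y) + rightSum n m y (0<mid 0<x 0<y) 0<y
      ≤⟨ +-mono-≤ (rightSum≤majorant M n x m 0<x (0<mid 0<x 0<y) a≤x x≤m (≤-trans m≤y y≤b))
                  (rightSum≤majorant M n m y (0<mid 0<x 0<y) 0<y (≤-trans a≤x x≤m) m≤y y≤b) ⟩
    (Φ m - Φ x) + (Φ y - Φ m) ≡⟨ solve 3 (λ x m y → (m :- x) :+ (y :- m) := y :- x) refl (Φ x) (Φ m) (Φ y) ⟩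
    Φ y - Φ x ∎
    where
    m = mid x y
    x≤m = proj₁ (mid-bounds x≤y)
    m≤y = proj₂ (mid-bounds x≤y)

  -- The second primitive is shifted to agree with the first at `m`. A step across `m` is split
  -- there; as the first primitive increases, its share may be weighted by `y` instead of `m`.
  glue : ∀ {a m b v w} → 0ℚ < a → a ≤ m → m ≤ b → Majorant a m v → Majorant m b w → Majorant a b (v + w)
  glue {a} {m} {b} {v} {w} 0<a a≤m m≤b (Φ , domΦ , Φ≡) (Ψ , domΨ , Ψ≡) = Χ , dom , total
    where
    Χ : ℚ → ℚ
    Χ x with x ℚ.≤? m
    ... | yes _ = Φ x
    ... | no  _ = (Φ m - Ψ m) + Ψ x
    below : ∀ {x} → x ≤ m → Χ x ≡ Φ x
    below {x} x≤m with x ℚ.≤? m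
    ... | yes _ = refl
    ... | no x≰m = contradiction x≤m x≰m
    above : ∀ {x} → m ≤ x → Χ x ≡ (Φ m - Ψ m) + Ψ x
    above {x} m≤x with x ℚ.≤? m
    ... | no _ = refl
    ... | yes x≤m with ℚ.≤-antisym x≤m m≤x
    ...   | refl = solve 2 (λ p q → p := (p :- q) :+ q) refl (Φ m) (Ψ m)
    increment : ∀ {x y} → x ≤ m → m ≤ y → Χ y - Χ x ≡ (Φ m - Φ x) + (Ψ y - Ψ m)
    increment {x} {y} x≤m m≤y = trans (cong₂ _-_ (above m≤y) (below x≤m))
      (solve 4 (λ p q r s → ((p :- q) :+ r) :- s := (p :- s) :+ (r :- q)) refl (Φ m) (Ψ m) (Ψ y) (Φ x))
    total : Χ b - Χ a ≡ v + w
    total = trans (increment a≤m m≤b) (cong₂ _+_ Φ≡ Ψ≡)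
    dom : ∀ x y → a ≤ x → x ≤ y → y ≤ b → y - x ≤ (Χ y - Χ x) * y
    dom x y a≤x x≤y y≤b with ≤-total y m | ≤-total x m
    ... | inj₁ y≤m | _ = subst (λ z → y - x ≤ z * y) (sym (cong₂ _-_ (below y≤m) (below (≤-trans x≤y y≤m)))) (domΦ x y a≤x x≤y y≤m)
    ... | inj₂ m≤y | inj₂ m≤x = subst (λ z → y - x ≤ z * y)
          (sym (trans (cong₂ _-_ (above m≤y) (above m≤x)) (solve 3 (λ c r s → (c :+ r) :- (c :+ s) := r :- s) refl (Φ m - Ψ m) (Ψ y) (Ψ x))))
          (domΨ x y m≤x x≤y y≤b)
    ... | inj₂ m≤y | inj₁ x≤m = begin
      y - x ≡⟨ solve 3 (λ x m y → y :- x := (m :- x) :+ (y :- m)) refl x m y ⟩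
      (m - x) + (y - m) ≤⟨ +-mono-≤ (domΦ x m a≤x x≤m ≤-refl) (domΨ m y ≤-refl m≤y y≤b) ⟩
      (Φ m - Φ x) * m + (Ψ y - Ψ m) * y ≤⟨ +-monoˡ-≤ ((Ψ y - Ψ m) * y) (*-monoˡ (Φ m - Φ x) Φ-increasing m≤y) ⟩
      (Φ m - Φ x) * y + (Ψ y - Ψ m) * y ≡⟨ trans (sym (*-distribʳ-+ y (Φ m - Φ x) (Ψ y - Ψ m))) (cong (_* y) (sym (increment x≤m m≤y))) ⟩
      (Χ y - Χ x) * y ∎
      where
      0<m : 0ℚ < m
      0<m = <-≤-trans 0<a a≤m
      Φ-increasing : 0ℚ ≤ Φ m - Φ x
      Φ-increasing = begin
        0ℚ ≤⟨ *-nonNeg (p-q≥0 x≤m) (<⇒≤ (recip-pos m 0<m)) ⟩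
        (m - x) * recip m 0<m ≤⟨ *-monoʳ (recip m 0<m) (<⇒≤ (recip-pos m 0<m)) (domΦ x m a≤x x≤m ≤-refl) ⟩
        (Φ m - Φ x) * m * recip m 0<m ≡⟨ trans (*-assoc (Φ m - Φ x) m (recip m 0<m)) (trans (cong ((Φ m - Φ x) *_) (recip-inv m 0<m)) (*-identityʳ (Φ m - Φ x))) ⟩
        Φ m - Φ x ∎

  riemann-majorant : ∀ n a b (0<a : 0ℚ < a) (0<b : 0ℚ < b) → a ≤ b → Majorant a b (riemann n a b 0<a 0<b)
  riemann-majorant zero a b 0<a 0<b a≤b = (_* r) , dom , solve 3 (λ a b r → b :* r :- a :* r := (b :- a) :* r) refl a b r
    where
    r = recip a 0<a
    dom : ∀ x y → a ≤ x → x ≤ y → y ≤ b → y - x ≤ (y * r - x * r) * y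
    dom x y a≤x x≤y y≤b = begin
      y - x ≡⟨ sym (*-identityʳ (y - x)) ⟩
      (y - x) * 1ℚ ≡⟨ cong ((y - x) *_) (sym (recip-inv a 0<a)) ⟩
      (y - x) * (a * r) ≤⟨ *-monoˡ (y - x) (p-q≥0 x≤y) (*-monoʳ r (<⇒≤ (recip-pos a 0<a)) (≤-trans a≤x x≤y)) ⟩
      (y - x) * (y * r) ≡⟨ solve 3 (λ x y r → (y :- x) :* (y :* r) := (y :* r :- x :* r) :* y) refl x y r ⟩
      (y * r - x * r) * y ∎
  riemann-majorant (suc n) a b 0<a 0<b a≤b = glue 0<a (proj₁ (mid-bounds a≤b)) (proj₂ (mid-bounds a≤b))
    (riemann-majorant n a (mid a b) 0<a (0<mid 0<a 0<b) (proj₁ (mid-bounds a≤b)))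
    (riemann-majorant n (mid a b) b (0<mid 0<a 0<b) 0<b (proj₂ (mid-bounds a≤b)))

  log2 : ℕ → ℚ
  log2 n = riemann n 1ℚ 2ℚ 0<1 0<2ℚ

  1≤2^ : ∀ m → 1ℚ ≤ 2ℚ ^ m
  1≤2^ m = ^-monoʳ 1≤2ℚ {0} {m} z≤n

  -- `log (2 ^ m) = m log 2` in finite form: scaling carries each `[2 ^ j, 2 ^ (j + 1)]` to
  -- `[1, 2]`. These pieces do not arise from halving `[1, 2 ^ m]`, hence majorants instead of
  -- refinements.
  2^-majorant : ∀ n m → Majorant 1ℚ (2ℚ ^ m) (fromℕ m * log2 n)
  2^-majorant n zero = id , (λ x y 1≤x x≤y y≤1 → ≤-trans (≤-reflexive (sym (*-identityʳ (y - x)))) (*-monoˡ (y - x) (p-q≥0 x≤y) (≤-trans 1≤x x≤y))) ,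
    trans (+-inverseʳ 1ℚ) (sym (*-zeroˡ (log2 n)))
  2^-majorant n (suc m) = subst (Majorant 1ℚ (2ℚ ^ suc m))
    (trans (solve 2 (λ f l → f :* l :+ l := (con 1ℚ :+ f) :* l) refl (fromℕ m) (log2 n)) (cong (_* log2 n) (sym (fromℕ-suc m))))
    (glue 0<1 (1≤2^ m) 2^m≤ (2^-majorant n m)
      (subst (Majorant (2ℚ ^ m) (2ℚ ^ suc m)) (ℚ.≤-antisym
          (riemann-mono n (2ℚ ^ m) (2ℚ ^ suc m) 1ℚ 2ℚ 0<2^ 0<2^suc 0<1 0<2ℚ (≤-reflexive (*-identityʳ (2ℚ ^ suc m))))
          (riemann-mono n 1ℚ 2ℚ (2ℚ ^ m) (2ℚ ^ suc m) 0<1 0<2ℚ 0<2^ 0<2^suc (≤-reflexive (sym (*-identityʳ (2ℚ ^ suc m))))))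
        (riemann-majorant n (2ℚ ^ m) (2ℚ ^ suc m) 0<2^ 0<2^suc 2^m≤)))
    where
    0<2^ = ^-pos 0<2ℚ m
    0<2^suc = ^-pos 0<2ℚ (suc m)
    2^m≤ : 2ℚ ^ m ≤ 2ℚ ^ suc m
    2^m≤ = ^-monoʳ 1≤2ℚ (ℕ.n≤1+n m)

  -- The endpoint is rounded up to `2ℚ ^ m`, the left sum is replaced by the right one at the cost
  -- of the last term, and the majorant bounds that. The depths `n` and `n′` are independent because
  -- the tails in `estimate` start at different indices.
  log-upper : ∀ n n′ m x (0<x : 0ℚ < x) → x ≤ 2ℚ ^ m → riemann n 1ℚ x 0<1 0<x ≤ fromℕ m * log2 n′ + 2ℚ ^ m * ½^ n
  log-upper n n′ m x 0<x x≤ = begin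
    riemann n 1ℚ x 0<1 0<x ≤⟨ riemann-mono n 1ℚ x 1ℚ B 0<1 0<x 0<1 0<B (*-monoʳ 1ℚ (<⇒≤ 0<1) x≤) ⟩
    riemann n 1ℚ B 0<1 0<B ≡⟨ riemann-rightSum n 1ℚ B 0<1 0<B ⟩
    rightSum n 1ℚ B 0<1 0<B + (B - 1ℚ) * ½^ n * (recip 1ℚ 0<1 - recip B 0<B)
      ≤⟨ +-mono-≤ (≤-trans (rightSum≤majorant M n 1ℚ B 0<1 0<B ≤-refl (1≤2^ m) ≤-refl) (≤-reflexive (proj₂ (proj₂ M)))) error ⟩
    fromℕ m * log2 n′ + B * ½^ n ∎
    where
    B = 2ℚ ^ m
    0<B : 0ℚ < B
    0<B = ^-pos 0<2ℚ m
    M = 2^-majorant n′ m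
    error : (B - 1ℚ) * ½^ n * (recip 1ℚ 0<1 - recip B 0<B) ≤ B * ½^ n
    error = begin
      (B - 1ℚ) * ½^ n * (1ℚ - recip B 0<B)
        ≤⟨ *-mono (*-nonNeg (p-q≥0 (1≤2^ m)) (0≤½^ n)) (<⇒≤ 0<1)
             (*-monoʳ (½^ n) (0≤½^ n) (subst (B - 1ℚ ≤_) (+-identityʳ B) (+-monoʳ-≤ B (neg-antimono-≤ (<⇒≤ 0<1)))))
             (subst (1ℚ - recip B 0<B ≤_) (+-identityʳ 1ℚ) (+-monoʳ-≤ 1ℚ (neg-antimono-≤ (<⇒≤ (recip-pos B 0<B))))) ⟩
      B * ½^ n * 1ℚ ≡⟨ *-identityʳ (B * ½^ n) ⟩
      B * ½^ n ∎

  log2≥½ : ∀ n → ½ ≤ log2 n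
  log2≥½ n = riemann-≥ n 1ℚ 2ℚ 0<1 0<2ℚ 1≤2ℚ

  log2≤1 : ∀ n → log2 n ≤ 1ℚ
  log2≤1 n = upper n 1ℚ 2ℚ 0<1 0<2ℚ 1≤2ℚ
    where
    upper : ∀ n a b (0<a : 0ℚ < a) (0<b : 0ℚ < b) → a ≤ b → riemann n a b 0<a 0<b ≤ (b - a) * recip a 0<a
    upper zero    a b 0<a 0<b a≤b = ≤-refl
    upper (suc n) a b 0<a 0<b a≤b = begin
      riemann n a m 0<a 0<m + riemann n m b 0<m 0<b ≤⟨ +-mono-≤ (upper n a m 0<a 0<m a≤m) (≤-trans (upper n m b 0<m 0<b m≤b)
          (*-monoˡ (b - m) (p-q≥0 m≤b) (recip-anti a m 0<a 0<m a≤m))) ⟩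
      (m - a) * r + (b - m) * r ≡⟨ solve 4 (λ a m b r → (m :- a) :* r :+ (b :- m) :* r := (b :- a) :* r) refl a m b r ⟩
      (b - a) * r ∎
      where
      m = mid a b
      0<m = 0<mid 0<a 0<b
      r = recip a 0<a
      a≤m = proj₁ (mid-bounds a≤b)
      m≤b = proj₂ (mid-bounds a≤b)

-- Binary logarithms of natural numbers, and the choice of the error term

binaryLog : ∀ n → ∃[ k ] 2 ℕ.^ k ℕ.≤ suc n × suc n ℕ.< 2 ℕ.^ suc k
binaryLog zero    = 0 , ℕ.≤-refl , ℕ.≤-refl
binaryLog (suc n) with binaryLog n
... | k , lower , upper with suc (suc n) ℕ.<? 2 ℕ.^ suc k
...   | yes lt  = k , ℕ.m≤n⇒m≤1+n lower , lt
...   | no  ≮   = suc k , ℕ.≮⇒≥ ≮ , (begin-strict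
        suc (suc n) ≤⟨ upper ⟩
        2 ℕ.^ suc k <⟨ ℕ.^-monoʳ-< 2 (s≤s (s≤s z≤n)) (ℕ.n<1+n (suc k)) ⟩
        2 ℕ.^ suc (suc k) ∎)
  where open ℕ.≤-Reasoning

⌊log₂_⌋ : ℕ → ℕ
⌊log₂ n ⌋ = proj₁ (binaryLog (ℕ.pred n))

2^⌊log₂⌋≤ : ∀ n .{{_ : NonZero n}} → 2 ℕ.^ ⌊log₂ n ⌋ ℕ.≤ n
2^⌊log₂⌋≤ (suc n) = proj₁ (proj₂ (binaryLog n))

<2^⌊log₂⌋ : ∀ n .{{_ : NonZero n}} → n ℕ.< 2 ℕ.^ suc ⌊log₂ n ⌋
<2^⌊log₂⌋ (suc n) = proj₂ (proj₂ (binaryLog n))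

⌊log₂⌋-large : ∀ m {n} .{{_ : NonZero n}} → 2 ℕ.^ m ℕ.≤ n → m ℕ.≤ ⌊log₂ n ⌋
⌊log₂⌋-large m {n} le = ℕ.≮⇒≥ λ lt → ℕ.<⇒≱ (<2^⌊log₂⌋ n) (ℕ.≤-trans (ℕ.^-monoʳ-≤ 2 lt) le)

-- `log₂ log₂ p` up to rounding, chosen so that `2 ^ level p` exceeds `suc ⌊log₂ p ⌋` and hence
-- bounds `log p` in `log≤2^L`.
level : ℕ → ℕ
level p = suc ⌊log₂ suc ⌊log₂ p ⌋ ⌋

abstract
  level-large : ∀ m → ∃[ N ] (∀ p .{{_ : NonZero p}} → N ℕ.≤ p → m ℕ.≤ level p)
  level-large m = 2 ℕ.^ (2 ℕ.^ m) , λ p N≤p →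
    ℕ.m≤n⇒m≤1+n (⌊log₂⌋-large m (ℕ.m≤n⇒m≤1+n (⌊log₂⌋-large (2 ℕ.^ m) N≤p)))

½^-^ : ∀ n → ½^ n ≡ ½ ^ n
½^-^ zero    = refl
½^-^ (suc n) = cong (½ *_) (½^-^ n)

17ℚ : ℚ
17ℚ = fromℕ 17

module _ {t r s t′ w m L a ℓ e₁ e₂ : ℚ}
  (½≤t : ½ ≤ t) (0≤r : 0ℚ ≤ r) (t*r : t * r ≡ 1ℚ)
  (½≤t′ : ½ ≤ t′) (t′≤1 : t′ ≤ 1ℚ) (0≤s : 0ℚ ≤ s) (2t′*s : 2ℚ * t′ * s ≡ 1ℚ)
  (0≤w : 0ℚ ≤ w) (L*w : L * w ≡ 1ℚ) (34≤L : fromℕ 34 ≤ L)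
  (0≤e₁ : 0ℚ ≤ e₁) (0≤e₂ : 0ℚ ≤ e₂) (a≤ : a ≤ m * t + e₁) (ℓ≤ : ℓ ≤ L * t′ + e₂) where

  open ≤-Reasoning

  private
    k : ℚ
    k = 1ℚ * s + (- (17ℚ * w))

    r≤2 : r ≤ 2ℚ
    r≤2 = begin
      r ≡⟨ solve 1 (λ r → r := con 2ℚ :* (con ½ :* r)) refl r ⟩
      2ℚ * (½ * r) ≤⟨ *-monoˡ 2ℚ (<⇒≤ 0<2ℚ) (*-monoʳ r 0≤r ½≤t) ⟩
      2ℚ * (t * r) ≡⟨ trans (cong (2ℚ *_) t*r) (*-identityʳ 2ℚ) ⟩
      2ℚ ∎

    ½≤s : ½ ≤ s
    ½≤s = begin
      ½ ≡⟨ cong (½ *_) (sym 2t′*s) ⟩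
      ½ * (2ℚ * t′ * s) ≡⟨ solve 2 (λ t s → con ½ :* (con 2ℚ :* t :* s) := t :* s) refl t′ s ⟩
      t′ * s ≤⟨ *-monoʳ s 0≤s t′≤1 ⟩
      1ℚ * s ≡⟨ *-identityˡ s ⟩
      s ∎

    s≤1 : s ≤ 1ℚ
    s≤1 = begin
      s ≡⟨ solve 1 (λ s → s := con 2ℚ :* con ½ :* s) refl s ⟩
      2ℚ * ½ * s ≤⟨ *-monoʳ s 0≤s (*-monoˡ 2ℚ (<⇒≤ 0<2ℚ) ½≤t′) ⟩
      2ℚ * t′ * s ≡⟨ 2t′*s ⟩
      1ℚ ∎

    -- The origin of 34: with `17 / L ≤ ½ ≤ s` the coefficient of the iterated logarithm stays
    -- nonnegative.
    17w≤½ : 17ℚ * w ≤ ½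
    17w≤½ = begin
      17ℚ * w ≡⟨ solve 1 (λ w → con 17ℚ :* w := con ½ :* (con (fromℕ 34) :* w)) refl w ⟩
      ½ * (fromℕ 34 * w) ≤⟨ *-monoˡ ½ (<⇒≤ 0<½) (*-monoʳ w 0≤w 34≤L) ⟩
      ½ * (L * w) ≡⟨ cong (½ *_) L*w ⟩
      ½ ∎

    0≤k : 0ℚ ≤ k
    0≤k = subst (λ z → 0ℚ ≤ z + (- (17ℚ * w))) (sym (*-identityˡ s)) (p-q≥0 (≤-trans 17w≤½ ½≤s))

    k≤1 : k ≤ 1ℚ
    k≤1 = ≤-trans (+-mono-≤ (≤-trans (≤-reflexive (*-identityˡ s)) s≤1) (neg-antimono-≤ (*-nonNeg (0≤fromℕ 17) 0≤w))) (≤-reflexive (+-identityʳ 1ℚ))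

  -- Here `a` and `ℓ` stand for terms of `log p` and `log log p`, `t` and `t′` for terms of `log 2`
  -- at two indices, with `r = 1 / t`, `s = 1 / (2 t′)`, `w = 1 / L`. The main part of `k * ℓ` is at
  -- most `L / 2 - 17 t′`, and `t′ ≥ ½` turns this into `(L - 17) / 2`.
  logs-bound : a * r + (1ℚ * s + (- (17ℚ * w))) * ℓ ≤ (m + ½ * (L - 17ℚ)) + (2ℚ * e₁ + e₂)
  logs-bound = begin
    a * r + k * ℓ ≤⟨ +-mono-≤ (*-monoʳ r 0≤r a≤) (*-monoˡ k 0≤k ℓ≤) ⟩
    (m * t + e₁) * r + k * (L * t′ + e₂)
      ≡⟨ solve 9 (λ m t e₁ r s w L t′ e₂ → let k = con 1ℚ :* s :+ (:- (con 17ℚ :* w)) in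
           (m :* t :+ e₁) :* r :+ k :* (L :* t′ :+ e₂)
             := (m :* (t :* r) :+ e₁ :* r) :+ ((con ½ :* L :* (con 2ℚ :* t′ :* s) :- con 17ℚ :* (L :* w) :* t′) :+ k :* e₂)) refl m t e₁ r s w L t′ e₂ ⟩
    (m * (t * r) + e₁ * r) + ((½ * L * (2ℚ * t′ * s) - 17ℚ * (L * w) * t′) + k * e₂)
      ≡⟨ cong₂ (λ x y → (m * x + e₁ * r) + (y + k * e₂)) t*r (cong₂ (λ x y → ½ * L * x - 17ℚ * y * t′) 2t′*s L*w) ⟩
    (m * 1ℚ + e₁ * r) + ((½ * L * 1ℚ - 17ℚ * 1ℚ * t′) + k * e₂)
      ≤⟨ +-mono-≤ (+-monoʳ-≤ (m * 1ℚ) (*-monoˡ e₁ 0≤e₁ r≤2))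
           (+-mono-≤ (+-monoʳ-≤ (½ * L * 1ℚ) (neg-antimono-≤ (*-monoˡ (17ℚ * 1ℚ) (*-nonNeg (0≤fromℕ 17) (<⇒≤ 0<1)) ½≤t′)))
                     (*-monoʳ e₂ 0≤e₂ k≤1)) ⟩
    (m * 1ℚ + e₁ * 2ℚ) + ((½ * L * 1ℚ - 17ℚ * 1ℚ * ½) + 1ℚ * e₂)
      ≡⟨ solve 4 (λ m e₁ L e₂ → (m :* con 1ℚ :+ e₁ :* con 2ℚ) :+ ((con ½ :* L :* con 1ℚ :- con 17ℚ :* con 1ℚ :* con ½) :+ con 1ℚ :* e₂)
             := (m :+ con ½ :* (L :- con 17ℚ)) :+ (con 2ℚ :* e₁ :+ e₂)) refl m e₁ L e₂ ⟩
    (m + ½ * (L - 17ℚ)) + (2ℚ * e₁ + e₂) ∎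

-- With L = level p and h = ⌊(L - 16) / 2⌋ one gets f p > ⌊log₂ p⌋ + h, so that rounding
-- costs at most 17/2 compared with L/2.
errorTerm : ℕ → ℝ
errorTerm p = fromℚ (- (17ℚ * recip (fromℕ (level p)) (fromℕ-pos (level p))))

fromℚ-≤ : ∀ {x y} → x ≤ y → fromℚ x ≤ℝ fromℚ y
fromℚ-≤ {x} {y} x≤y {ε} 0<ε = 0 , λ _ _ → ≤-trans x≤y (subst (_≤ y + ε) (+-identityʳ y) (+-monoʳ-≤ y (<⇒≤ 0<ε)))

errorTerm-tendsToZero : TendsToZeroAlongPrimes errorTerm
errorTerm-tendsToZero {ε} 0<ε = proj₁ large , λ p pr N≤p →
  let instance nz : NonZero p
               nz = prime⇒nonZero pr
      L = fromℕ (level p)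
      0<L = fromℕ-pos (level p)
      w = recip L 0<L
      17w≤ε : 17ℚ * w ≤ ε
      17w≤ε = begin
        17ℚ * w ≡⟨ cong (_* w) (sym (trans (sym (*-assoc ε (recip ε 0<ε) 17ℚ)) (trans (cong (_* 17ℚ) (recip-inv ε 0<ε)) (*-identityˡ 17ℚ)))) ⟩
        ε * (recip ε 0<ε * 17ℚ) * w ≤⟨ *-monoʳ w (<⇒≤ (recip-pos L 0<L)) (*-monoˡ ε (<⇒≤ 0<ε) (≤-trans (proj₂ q) (fromℕ-mono (proj₂ large p N≤p)))) ⟩
        ε * L * w ≡⟨ trans (*-assoc ε L w) (trans (cong (ε *_) (recip-inv L 0<L)) (*-identityʳ ε)) ⟩
        ε ∎
  in fromℚ-≤ (neg-antimono-≤ 17w≤ε) ,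
     fromℚ-≤ (≤-trans (neg-antimono-≤ (*-nonNeg (0≤fromℕ 17) (<⇒≤ (recip-pos L 0<L)))) (<⇒≤ 0<ε))
  where
  open ≤-Reasoning
  q = archimedean (recip ε 0<ε * 17ℚ)
  large = level-large (proj₁ q)

-- The final estimate

module FinalBound {p : ℕ} (pr : Prime p) (34≤level : 34 ℕ.≤ level p) where

  private instance
    p-nonZero : NonZero p
    p-nonZero = prime⇒nonZero pr
    p-nonTrivial : NonTrivial p
    p-nonTrivial = prime⇒nonTrivial pr

  open Riemann
  open ≤-Reasoning

  n m L h : ℕ
  n = ⌊log₂ p ⌋
  m = suc n
  L = level p
  h = (L ℕ.∸ 16) ℕ./ 2

  2h≤ : 2 ℕ.* h ℕ.≤ L ℕ.∸ 16
  2h≤ = ℕ.≤-trans (ℕ.≤-reflexive (ℕ.*-comm 2 h)) (m/n*n≤m (L ℕ.∸ 16) 2)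

  16+2h≤L : 16 ℕ.+ 2 ℕ.* h ℕ.≤ L
  16+2h≤L = ℕ.≤-trans (ℕ.+-monoʳ-≤ 16 2h≤) (ℕ.≤-reflexive (ℕ.m+[n∸m]≡n (ℕ.≤-trans (ℕ.m≤m+n 16 18) 34≤level)))

  L≤17+2h : L ℕ.≤ 17 ℕ.+ 2 ℕ.* h
  L≤17+2h = ℕ.≤-trans (ℕ.m≤n+m∸n L 16) (ℕ.≤-trans (ℕ.+-monoʳ-≤ 16 (ℕ.≤-trans
      (ℕ.≤-reflexive (m≡m%n+[m/n]*n (L ℕ.∸ 16) 2))
      (ℕ.+-mono-≤ (ℕ.≤-pred (m%n<n (L ℕ.∸ 16) 2)) (ℕ.≤-reflexive (ℕ.*-comm h 2)))))
    (ℕ.≤-reflexive (ℕ.+-assoc 16 1 (2 ℕ.* h))))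

  -- The left side is `2 ^ (14 + 2 h)`, while `16 + 2 h ≤ L` gives `2 ^ (15 + 2 h) ≤ suc n`; the
  -- spare factor 2 absorbs the successor. This is why `h` is computed from `L - 16`.
  n-large : 16 ℕ.* ((16 ℕ.* 2 ℕ.^ suc h) ℕ.* (16 ℕ.* 2 ℕ.^ suc h)) ℕ.≤ n
  n-large = large (2 ℕ.^ h) (subst (ℕ._≤ suc n) (trans (ℕ.^-distribˡ-+-* 2 15 (2 ℕ.* h))
      (cong (2 ℕ.^ 15 ℕ.*_) (trans (cong (λ k → 2 ℕ.^ (h ℕ.+ k)) (ℕ.+-identityʳ h)) (ℕ.^-distribˡ-+-* 2 h h))))
      (ℕ.≤-trans (ℕ.^-monoʳ-≤ 2 (ℕ.≤-pred 16+2h≤L)) (2^⌊log₂⌋≤ (suc n)))) (ℕ.^-monoʳ-≤ 2 {0} {h} z≤n)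
    where
    large : ∀ x {n} → 2 ℕ.^ 15 ℕ.* (x ℕ.* x) ℕ.≤ suc n → 1 ℕ.≤ x → 16 ℕ.* ((16 ℕ.* (2 ℕ.* x)) ℕ.* (16 ℕ.* (2 ℕ.* x))) ℕ.≤ n
    large x le 1≤x = ℕ.≤-pred (ℕ.≤-trans (ℕ.≤-trans
      (ℕ.+-mono-≤ (ℕ.≤-trans (ℕ.*-mono-≤ 1≤x 1≤x) (ℕ.m≤n*m (x ℕ.* x) 16384)) (ℕ.≤-reflexive
        (solveⁿ 1 (λ x → conⁿ 16 :*ⁿ ((conⁿ 16 :*ⁿ (conⁿ 2 :*ⁿ x)) :*ⁿ (conⁿ 16 :*ⁿ (conⁿ 2 :*ⁿ x))) :=ⁿ conⁿ 16384 :*ⁿ (x :*ⁿ x)) refl x)))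
      (ℕ.≤-reflexive (sym (ℕ.*-distribʳ-+ (x ℕ.* x) 16384 16384)))) le)

  f-large : suc (n ℕ.+ h) ℕ.≤ f p
  f-large = f-lower pr n h (2^⌊log₂⌋≤ p) n-large

  f-largeℚ : fromℕ m + ½ * (fromℕ L - 17ℚ) ≤ fromℕ (f p)
  f-largeℚ = begin
    fromℕ m + ½ * (fromℕ L - 17ℚ) ≤⟨ +-monoʳ-≤ (fromℕ m) (*-monoˡ ½ (<⇒≤ 0<½) (+-monoˡ-≤ (- 17ℚ) (fromℕ-mono L≤17+2h))) ⟩
    fromℕ m + ½ * (fromℕ (17 ℕ.+ 2 ℕ.* h) - 17ℚ)
      ≡⟨ cong (λ x → fromℕ m + ½ * (x - 17ℚ)) (trans (fromℕ-+ 17 (2 ℕ.* h)) (cong (17ℚ +_) (fromℕ-* 2 h))) ⟩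
    fromℕ m + ½ * ((17ℚ + 2ℚ * fromℕ h) - 17ℚ)
      ≡⟨ solve 2 (λ m h → m :+ con ½ :* ((con 17ℚ :+ con 2ℚ :* h) :- con 17ℚ) := m :+ h) refl (fromℕ m) (fromℕ h) ⟩
    fromℕ m + fromℕ h ≡⟨ sym (fromℕ-+ m h) ⟩
    fromℕ (m ℕ.+ h) ≤⟨ fromℕ-mono f-large ⟩
    fromℕ (f p) ∎

  p≤2^m : fromℕ p ≤ 2ℚ ^ m
  p≤2^m = ≤-trans (fromℕ-mono (ℕ.<⇒≤ (<2^⌊log₂⌋ p))) (≤-reflexive (fromℕ-^ 2 m))

  0<p : 0ℚ < fromℕ p
  0<p = fromℕ-pos p

  0≤2^½^ : ∀ k n → 0ℚ ≤ 2ℚ ^ k * ½^ n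
  0≤2^½^ k n = *-nonNeg (0≤2ℚ^ k) (0≤½^ n)

  -- From depth `m` on the discretisation error is at most 1, and `log 2 ≤ 1`, so the sum is at most
  -- `m + 1`; finally `m < 2 ^ L`.
  log≤2^L : ∀ k → m ℕ.≤ k → riemann k 1ℚ (fromℕ p) 0<1 0<p ≤ 2ℚ ^ L
  log≤2^L k m≤k = begin
    riemann k 1ℚ (fromℕ p) 0<1 0<p ≤⟨ log-upper k 0 m (fromℕ p) 0<p p≤2^m ⟩
    fromℕ m * log2 0 + 2ℚ ^ m * ½^ k ≤⟨ +-mono-≤ (*-monoˡ (fromℕ m) (0≤fromℕ m) (log2≤1 0))
                                         (≤-trans (*-monoˡ (2ℚ ^ m) (0≤2ℚ^ m) (½^-anti m≤k)) (≤-reflexive (trans (cong (2ℚ ^ m *_) (½^-^ m)) (2^*½^ m)))) ⟩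
    fromℕ m * 1ℚ + 1ℚ ≡⟨ trans (cong (_+ 1ℚ) (*-identityʳ (fromℕ m))) (trans (+-comm (fromℕ m) 1ℚ) (sym (fromℕ-suc m))) ⟩
    fromℕ (suc m) ≤⟨ fromℕ-mono (<2^⌊log₂⌋ m) ⟩
    fromℕ (2 ℕ.^ L) ≡⟨ fromℕ-^ 2 L ⟩
    2ℚ ^ L ∎

  estimate : fromℕℝ (f p) ≥ℝ log₂ℕ p +ℝ (1ℝ /ℝ (2ℝ *ℝ logℕ 2) [ 0<2log2 ] +ℝ errorTerm p) *ℝ loglogℕ p
  -- From index `m` on `log≤2^L` applies; the second bound brings the error terms below `ε`.
  estimate {ε} 0<ε = m ℕ.⊔ proj₁ small , bound
    where
    c = 2ℚ * 2ℚ ^ m + 2ℚ ^ L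
    small = ½^-small c 0<ε
    module T₁ = Tail (logℕ 2) (0<logℕ 2)
    module T₂ = Tail (2ℝ *ℝ logℕ 2) 0<2log2
    module T₃ = Tail (logℕ p) (0<logℕ p)
    bound : ∀ n → m ℕ.⊔ proj₁ small ℕ.≤ n →
      seq (log₂ℕ p +ℝ (1ℝ /ℝ (2ℝ *ℝ logℕ 2) [ 0<2log2 ] +ℝ errorTerm p) *ℝ loglogℕ p) n ≤ fromℕ (f p) + ε
    bound n N≤n = begin
      seq (logℕ p) n * recip (T₁.tail n) (T₁.0<tail n)
          + (1ℚ * recip (T₂.tail n) (T₂.0<tail n) + (- (17ℚ * recip (fromℕ L) (fromℕ-pos L)))) * seq (loglogℕ p) n
        ≤⟨ logs-bound {t = T₁.tail n} {t′ = log2 (T₂.N ℕ.+ n)} {m = fromℕ m} {L = fromℕ L} {e₁ = 2ℚ ^ m * ½^ n} {e₂ = 2ℚ ^ L * ½^ n}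
             (log2≥½ (T₁.N ℕ.+ n)) (<⇒≤ (recip-pos (T₁.tail n) (T₁.0<tail n))) (recip-inv (T₁.tail n) (T₁.0<tail n))
             (log2≥½ (T₂.N ℕ.+ n)) (log2≤1 (T₂.N ℕ.+ n)) (<⇒≤ (recip-pos (T₂.tail n) (T₂.0<tail n))) (recip-inv (T₂.tail n) (T₂.0<tail n))
             (<⇒≤ (recip-pos (fromℕ L) (fromℕ-pos L))) (recip-inv (fromℕ L) (fromℕ-pos L)) (fromℕ-mono 34≤level)
             (0≤2^½^ m n) (0≤2^½^ L n)
             (log-upper n (T₁.N ℕ.+ n) m (fromℕ p) 0<p p≤2^m)
             (log-upper n (T₂.N ℕ.+ n) L (T₃.tail n) (T₃.0<tail n)
               (log≤2^L (T₃.N ℕ.+ n) (ℕ.≤-trans (ℕ.m⊔n≤o⇒m≤o m (proj₁ small) N≤n) (ℕ.m≤n+m n T₃.N)))) ⟩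
      (fromℕ m + ½ * (fromℕ L - 17ℚ)) + (2ℚ * (2ℚ ^ m * ½^ n) + 2ℚ ^ L * ½^ n)
        ≤⟨ +-mono-≤ f-largeℚ (begin
             2ℚ * (2ℚ ^ m * ½^ n) + 2ℚ ^ L * ½^ n ≡⟨ solve 3 (λ x y z → con 2ℚ :* (x :* z) :+ y :* z := (con 2ℚ :* x :+ y) :* z) refl (2ℚ ^ m) (2ℚ ^ L) (½^ n) ⟩
             c * ½^ n ≤⟨ *-monoˡ c (+-mono-≤ (*-nonNeg (<⇒≤ 0<2ℚ) (0≤2ℚ^ m)) (0≤2ℚ^ L))
                                      (½^-anti (ℕ.m⊔n≤o⇒n≤o m (proj₁ small) N≤n)) ⟩
             c * ½^ (proj₁ small) ≤⟨ proj₂ small ⟩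
             ε ∎) ⟩
      fromℕ (f p) + ε ∎

corollary1p3 : Σ[ o ∈ (ℕ → ℝ) ] TendsToZeroAlongPrimes o ×
    (∃[ p₀ ] (∀ (p : ℕ) (pr : Prime p) → p ≥ p₀ →
    fromℕℝ (f p {{prime⇒nonZero pr}})
    ≥ℝ log₂ℕ p {{prime⇒nonTrivial pr}}
    +ℝ (1ℝ /ℝ (2ℝ *ℝ logℕ 2) [ 0<2log2 ] +ℝ o p) *ℝ loglogℕ p {{prime⇒nonTrivial pr}}))
corollary1p3 = errorTerm , errorTerm-tendsToZero , proj₁ (level-large 34) , λ p pr p≥p₀ →
  FinalBound.estimate pr (proj₂ (level-large 34) p {{prime⇒nonZero pr}} p≥p₀)
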